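{- Suppose $k\ge 2$ and $n\ge 1$. Then \[ \mathrm{ex}(n,\mathcal{C}^{\mathrm{even}}_{2k}\cup\mathcal{C}_k)\le \tfrac12 n^{1+1/k}+\tfrac{k-1}{2k}n+n^{1-1/k}. \] Furthermore, if $k\in\{2,3,5\}$, then for infinitely many $n$, \[ \mathrm{ex}(n,\mathcal{C}^{\mathrm{even}}_{2k}\cup\mathcal{C}_k)\ge \tfrac12 n^{1+1/k}+\tfrac{k-1}{2k}n-n^{1-1/k}. \]
   Context: Graphs are finite and simple. $\mathcal{C}^{\mathrm{even}}_{2k}=\{C_4,C_6,\dots,C_{2k}\}$ (even cycles of length at most $2k$) and $\mathcal{C}_k=\{C_3,C_4,\dots,C_k\}$ (cycles of length at most $k$). For a family $\mathcal{F}$ of graphs, a graph is $\mathcal{F}$-free if it contains no subgraph isomorphic to a member of $\mathcal{F}$, and the Turán number $\mathrm{ex}(n,\mathcal{F})$ is the maximum number of edges in an $\mathcal{F}$-free graph on $n$ vertices. -}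

module Defs where

open import Data.Nat as ℕ using (ℕ; zero; suc; _<_; _≤_)
open import Data.Integer as ℤ using (ℤ; +_)
open import Data.Rational as ℚ using (ℚ)
open import Data.Fin as Fin using (Fin; toℕ)
open import Data.Bool using (Bool; true; false)
open import Data.List using (List; length; filter; allFin; concatMap; map)
open import Data.Product using (Σ; _×_; _,_; ∃)
open import Data.Empty using (⊥)
open import Relation.Nullary using (¬_)
open import Relation.Binary.PropositionalEquality using (_≡_)
open import Function.Definitions using (Injective)
open import Data.Nat.DivMod using (_%_)

record Graph (n : ℕ) : Set where
  field
    adj   : Fin n → Fin n → Bool
    sym   : ∀ i j → adj i j ≡ adj j i
    irrefl : ∀ i → adj i i ≡ false
open Graph public

edgePairs : ∀ {n} → Graph n → List (Fin n × Fin n)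
edgePairs {n} G =
  concatMap (λ i → map (λ j → (i , j))
    (filter (λ j → toℕ i ℕ.<? toℕ j Relation.Nullary.Decidable.×-dec
                    (adj G i j Data.Bool.Properties.≟ true)) (allFin n))) (allFin n)
  where import Relation.Nullary.Decidable
        import Data.Bool.Properties

edges : ∀ {n} → Graph n → ℕ
edges G = length (edgePairs G)

next : ∀ {L} → Fin L → Fin L
next {suc L} i = Fin.fromℕ< (Data.Nat.DivMod.m%n<n (suc (toℕ i)) (suc L))
  where import Data.Nat.DivMod

-- G contains the cycle C_L as a subgraph (L ≥ 3 is imposed where used):
-- an injective map from Fin L into the vertices sending consecutive
-- (cyclically) indices to adjacent vertices.
HasCycle : ∀ {n} → Graph n → ℕ → Set
HasCycle {n} G L =
  Σ (Fin L → Fin n) λ c → Injective _≡_ _≡_ c × (∀ i → adj G (c i) (c (next i)) ≡ true)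

InFamily : ℕ → ℕ → Set
InFamily k L = (3 ≤ L × L ≤ k) Data.Sum.⊎ (4 ≤ L × L ≤ 2 ℕ.* k × Σ ℕ λ m → L ≡ 2 ℕ.* m)
  where import Data.Sum

Free : ∀ {n} → ℕ → Graph n → Set
Free k G = ∀ L → InFamily k L → ¬ HasCycle G L

_^ℚ_ : ℚ → ℕ → ℚ
q ^ℚ zero = ℚ.1ℚ
q ^ℚ suc m = q ℚ.* (q ^ℚ m)

ℕtoℚ : ℕ → ℚ
ℕtoℚ m = + m ℚ./ 1

posQ : ℕ → ℕ → ℚ
posQ p q = + suc p ℚ./ suc q

invPosQ : ℕ → ℕ → ℚ
invPosQ p q = + suc q ℚ./ suc p

-- (k-1)/(2k) · n, for k ≥ 1
midTerm : ℕ → ℕ → ℚ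
midTerm k n = (+ (k ℕ.∸ 1) ℚ./ suc (2 ℕ.* k ℕ.∸ 1)) ℚ.* ℕtoℚ n

half : ℚ
half = + 1 ℚ./ 2

-- Writing t for a positive rational stand-in for x = n^{1/k}:
--   (1/2) n t + (k-1)/(2k) n + n / t     (upper bound expression, n^{1+1/k} = n x, n^{1-1/k} = n / x)
--   (1/2) n t + (k-1)/(2k) n - n / t     (lower bound expression)
upperAt : ℕ → ℕ → ℕ → ℕ → ℚ
upperAt k n p q = half ℚ.* ℕtoℚ n ℚ.* posQ p q ℚ.+ midTerm k n ℚ.+ ℕtoℚ n ℚ.* invPosQ p q

lowerAt : ℕ → ℕ → ℕ → ℕ → ℚ
lowerAt k n p q = half ℚ.* ℕtoℚ n ℚ.* posQ p q ℚ.+ midTerm k n ℚ.- ℕtoℚ n ℚ.* invPosQ p q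

-- Real-free encoding of  e ≤ (1/2) n^{1+1/k} + (k-1)/(2k) n + n^{1-1/k}.
-- With x = n^{1/k} and h(t) = n t/2 + (k-1)n/(2k) + n/t (convex, continuous on t>0):
-- e ≤ h(x)  iff  for all positive rationals a ≤ b with a^k ≤ n ≤ b^k,  e ≤ max(h(a), h(b)).
UpperBound : ℕ → ℕ → ℕ → Set
UpperBound k n e =
  ∀ p q p' q' → posQ p q ^ℚ k ℚ.≤ ℕtoℚ n → ℕtoℚ n ℚ.≤ posQ p' q' ^ℚ k →
    ℕtoℚ e ℚ.≤ (upperAt k n p q ℚ.⊔ upperAt k n p' q')

-- Real-free encoding of  e ≥ (1/2) n^{1+1/k} + (k-1)/(2k) n - n^{1-1/k}.
-- g(t) = n t/2 + (k-1)n/(2k) - n/t is continuous and strictly increasing on t>0, so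
-- e ≥ g(x)  iff  for all positive rationals a with a^k ≤ n,  e ≥ g(a).
LowerBound : ℕ → ℕ → ℕ → Set
LowerBound k n e =
  ∀ p q → posQ p q ^ℚ k ℚ.≤ ℕtoℚ n → lowerAt k n p q ℚ.≤ ℕtoℚ e

{-# OPTIONS --safe #-}
-- Upper bound. Let t ^ k ≥ n. Vertices of degree at most 1 may be deleted, as the bound grows by more than 1 with each
-- vertex. Two different non-backtracking walks of length k with the same ends would give a closed walk of length
-- 2m ≤ 2k without backtracking. A repeated vertex on it cuts off a closed walk of length at most k and so a cycle of
-- length at most k; without repetition it is an even cycle. So at most n such walks start at each vertex. AM-GM along
-- arcs then gives the Moore bound of Alon, Hoory and Linial as ∏ (d (d - 1) ^ (k - 1)) ^ d ≤ n ^ ∑ d over the degrees d.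
-- By logarithmic convexity all degrees may be taken to be r or r + 1, and AM-GM for t / r, t / (r ± 1) gives the bound.
--
-- Lower bound. Take the polarity graphs of the projective plane, of W(q) for q = 2 ^ (2h + 1) and of the split Cayley
-- hexagon H(q) for q = 3 ^ (2h + 1), restricted to the q ^ k affine points (all coordinates) and the q ^ (k - 1) points
-- next to infinity. The polarity needs an endomorphism σ whose square is the Frobenius map. Along a walk, the
-- coordinates of every second vertex change by (m , β) and by monomials such as β m² and β² m, so a short
-- closed walk gives vectors with vanishing sum, area and cubic moments, consecutive ones being independent; this is
-- impossible. Fields of arbitrarily large odd degree are obtained from 𝔽₈ and 𝔽₂₇ by adjoining l-th roots, l = 7 and 13.
module Submission where

-- The linear term has the same origin on both sides. From d (d - 1) ^ (k - 1) ≤ n the degree d is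
-- about n^(1/k) + (k - 1)/k. In the constructions n = q ^ k + q ^ (k - 1), so that n^(1/k) is about
-- q + 1/k, while an affine vertex has q + 1 neighbours. A vertex at infinity lacks one neighbour
-- and at most q ^ (k - 1) arcs are loops; so twice the number of edges is at least n (q + 1) - 2 q
-- ^ (k - 1), and q ^ (k - 1) = n / (q + 1) is within the error term. Neither roots nor logarithms
-- occur. For the upper bound n^(1/k) is replaced by a fraction P / Q with n Q ^ k ≤ P ^ k, AM-GM
-- has integral weights and cleared denominators, and convexity is a comparison of powers. A square
-- root of the Frobenius map exists only in odd degree over the prime field. 𝔽₂ and 𝔽₃ have no root
-- of unity of odd order l > 1; in degree 3 there are some, as 8 - 1 = 7 and 27 - 1 = 2 · 13. Since
-- l is odd, adjoining an l-th root keeps the degree odd.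

-- Commutative rings and a ring solver for characteristic p

module PrimeCharacteristic where
  open import Algebra.Bundles using (CommutativeRing; RawRing)
  open import Algebra.Structures using (IsCommutativeRing)
  open import Algebra.Solver.Ring.AlmostCommutativeRing
    using (AlmostCommutativeRing; fromCommutativeRing; _-Raw-AlmostCommutative⟶_)
  import Algebra.Solver.Ring as RingSolver
  import Algebra.Properties.Semiring.Mult as SemiringMult
  import Algebra.Properties.Semiring.Mult.TCOptimised as OptimisedMult
  import Algebra.Properties.CommutativeSemiring.Exp as CommutativeSemiringExp
  import Algebra.Properties.Ring as RingProperties
  open import Data.Fin as Fin using (Fin; toℕ)
  open import Data.Fin.Properties as Fin using (toℕ<n; toℕ-fromℕ<)
  open import Data.Maybe using (Maybe; just; nothing)
  open import Data.Nat as ℕ using (ℕ; NonZero)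
  import Data.Nat.Properties as ℕ
  open import Data.Nat.DivMod using (_%_; _/_; _mod_; m%n<n; m≡m%n+[m/n]*n)
  open import Level using (0ℓ)
  open import Relation.Binary.PropositionalEquality
  open import Relation.Nullary using (yes; no)

  record CRing : Set₁ where
    infixl 6 _+_
    infixl 7 _*_
    infix 8 -_
    field
      Carrier : Set
      _+_ _*_ : Carrier → Carrier → Carrier
      -_ : Carrier → Carrier
      0# 1# : Carrier
      isCommutativeRing : IsCommutativeRing _≡_ _+_ _*_ -_ 0# 1#
    commutativeRing : CommutativeRing 0ℓ 0ℓ
    commutativeRing = record { isCommutativeRing = isCommutativeRing }
    open CommutativeRing commutativeRing public
      using ( +-assoc; +-comm; +-identityˡ; +-identityʳ; -‿inverseˡ; -‿inverseʳ
            ; *-assoc; *-comm; *-identityˡ; *-identityʳ; distribˡ; distribʳ; zeroˡ; zeroʳ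
            ; ring; semiring; commutativeSemiring; _-_ )
    open SemiringMult semiring public using (_×_; ×-homo-+; ×-assocˡ; ×1-homo-*)
    open CommutativeSemiringExp commutativeSemiring public using (_^_; ^-homo-*; ^-assocʳ; ^-distrib-*)

  HasChar : ℕ → CRing → Set
  HasChar p R = p × 1# ≡ 0#
    where
    open CRing R

  residueRing : (p : ℕ) .{{_ : NonZero p}} → RawRing 0ℓ 0ℓ
  residueRing p = record
    { Carrier = Fin p
    ; _≈_ = _≡_
    ; _+_ = λ x y → (toℕ x ℕ.+ toℕ y) mod p
    ; _*_ = λ x y → (toℕ x ℕ.* toℕ y) mod p
    ; -_ = λ x → (p ℕ.∸ toℕ x) mod p
    ; 0# = 0 mod p
    ; 1# = 1 mod p
    }

  -- Coefficients in ℤ/p let the normalisation use p = 0 as well as the ring axioms.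
  module CharSolver (R : CRing) (p : ℕ) .{{_ : NonZero p}} (char : HasChar p R) where
    open CRing R
    open RingProperties ring using (+-cancelˡ)
    open OptimisedMult semiring using (×ᵤ≈×) renaming (_×_ to _×′_; ×-homo-+ to ×′-homo-+; ×1-homo-* to ×′1-homo-*)
    open ≡-Reasoning

    char′ : p ×′ 1# ≡ 0#
    char′ = trans (sym (×ᵤ≈× p 1#)) char

    -- With the optimised `_×′_` the multiples `0 ×′ 1#` and `1 ×′ 1#` reduce to `0#` and `1#`, so
    -- that `con 0F` and `con 1F` denote the ring constants by computation.
    ι : Fin p → Carrier
    ι x = toℕ x ×′ 1#

    ι-mod : ∀ m → ι (m mod p) ≡ m ×′ 1#
    ι-mod m = sym (begin
      m ×′ 1# ≡⟨ cong (_×′ 1#) (m≡m%n+[m/n]*n m p) ⟩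
      (m % p ℕ.+ m / p ℕ.* p) ×′ 1# ≡⟨ ×′-homo-+ 1# (m % p) _ ⟩
      (m % p) ×′ 1# + (m / p ℕ.* p) ×′ 1# ≡⟨ cong ((m % p) ×′ 1# +_) (×′1-homo-* (m / p) p) ⟩
      (m % p) ×′ 1# + (m / p) ×′ 1# * (p ×′ 1#) ≡⟨ cong (λ t → (m % p) ×′ 1# + (m / p) ×′ 1# * t) char′ ⟩
      (m % p) ×′ 1# + (m / p) ×′ 1# * 0# ≡⟨ cong ((m % p) ×′ 1# +_) (zeroʳ _) ⟩
      (m % p) ×′ 1# + 0# ≡⟨ +-identityʳ _ ⟩
      (m % p) ×′ 1# ≡⟨ cong (_×′ 1#) (sym (toℕ-fromℕ< (m%n<n m p))) ⟩
      ι (m mod p) ∎)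

    morphism : residueRing p -Raw-AlmostCommutative⟶ fromCommutativeRing commutativeRing
    morphism = record
      { ⟦_⟧ = ι
      ; +-homo = λ x y → trans (ι-mod (toℕ x ℕ.+ toℕ y)) (×′-homo-+ 1# (toℕ x) (toℕ y))
      ; *-homo = λ x y → trans (ι-mod (toℕ x ℕ.* toℕ y)) (×′1-homo-* (toℕ x) (toℕ y))
      ; -‿homo = neg-homo
      ; 0-homo = ι-mod 0
      ; 1-homo = ι-mod 1
      }
      where
      neg-homo : ∀ x → ι ((p ℕ.∸ toℕ x) mod p) ≡ - ι x
      neg-homo x = +-cancelˡ (ι x) _ _ (begin
        ι x + ι ((p ℕ.∸ toℕ x) mod p) ≡⟨ cong (ι x +_) (ι-mod (p ℕ.∸ toℕ x)) ⟩
        ι x + (p ℕ.∸ toℕ x) ×′ 1# ≡⟨ ×′-homo-+ 1# (toℕ x) _ ⟨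
        (toℕ x ℕ.+ (p ℕ.∸ toℕ x)) ×′ 1# ≡⟨ cong (_×′ 1#) (ℕ.m+[n∸m]≡n (ℕ.<⇒≤ (toℕ<n x))) ⟩
        p ×′ 1# ≡⟨ char′ ⟩
        0# ≡⟨ -‿inverseʳ (ι x) ⟨
        ι x + - ι x ∎)

    ι-≟ : ∀ x y → Maybe (ι x ≡ ι y)
    ι-≟ x y with x Fin.≟ y
    ... | yes x≡y = just (cong ι x≡y)
    ... | no _ = nothing

    open RingSolver (residueRing p) (fromCommutativeRing commutativeRing) morphism ι-≟ public
      using (solve; _:=_; _:+_; _:*_; _:-_; :-_; _:^_; con; var)

-- Coefficient vectors and the ring K[y]/(y^(n+1) - c)

module RingExtensions where
  open PrimeCharacteristic
  open import Algebra.Structures using (IsCommutativeRing)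
  open import Data.Nat as ℕ using (ℕ; zero; suc; _<_; _≤_; s≤s)
  import Data.Nat.Properties as ℕ
  open import Data.Product using (_,_)
  open import Data.Vec using (Vec; []; _∷_; map; zipWith; replicate)
  open import Data.Vec.Properties
    using (zipWith-assoc; zipWith-comm; zipWith-identityˡ; zipWith-identityʳ; zipWith-inverseˡ; zipWith-inverseʳ)
  open import Relation.Binary.PropositionalEquality

  module FreeModule (K : CRing) where
    open CRing K
    open ≡-Reasoning

    infixl 6 _⊕_
    infixr 7 _•_
    infixl 9 _!_

    _⊕_ : ∀ {m} → Vec Carrier m → Vec Carrier m → Vec Carrier m
    _⊕_ = zipWith _+_

    _•_ : ∀ {m} → Carrier → Vec Carrier m → Vec Carrier m
    x • v = map (x *_) v

    𝟎 : ∀ {m} → Vec Carrier m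
    𝟎 = replicate _ 0#

    ⊕-assoc : ∀ {m} (u v w : Vec Carrier m) → (u ⊕ v) ⊕ w ≡ u ⊕ (v ⊕ w)
    ⊕-assoc = zipWith-assoc +-assoc

    ⊕-comm : ∀ {m} (u v : Vec Carrier m) → u ⊕ v ≡ v ⊕ u
    ⊕-comm = zipWith-comm +-comm

    ⊕-identityˡ : ∀ {m} (v : Vec Carrier m) → 𝟎 ⊕ v ≡ v
    ⊕-identityˡ = zipWith-identityˡ +-identityˡ

    ⊕-identityʳ : ∀ {m} (v : Vec Carrier m) → v ⊕ 𝟎 ≡ v
    ⊕-identityʳ = zipWith-identityʳ +-identityʳ

    ⊕-interchange : ∀ {m} (a b c d : Vec Carrier m) → (a ⊕ b) ⊕ (c ⊕ d) ≡ (a ⊕ c) ⊕ (b ⊕ d)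
    ⊕-interchange a b c d = begin
      (a ⊕ b) ⊕ (c ⊕ d) ≡⟨ ⊕-assoc a b (c ⊕ d) ⟩
      a ⊕ (b ⊕ (c ⊕ d)) ≡⟨ cong (a ⊕_) (sym (⊕-assoc b c d)) ⟩
      a ⊕ ((b ⊕ c) ⊕ d) ≡⟨ cong (λ t → a ⊕ (t ⊕ d)) (⊕-comm b c) ⟩
      a ⊕ ((c ⊕ b) ⊕ d) ≡⟨ cong (a ⊕_) (⊕-assoc c b d) ⟩
      a ⊕ (c ⊕ (b ⊕ d)) ≡⟨ ⊕-assoc a c (b ⊕ d) ⟨
      (a ⊕ c) ⊕ (b ⊕ d) ∎

    •-distribˡ : ∀ {m} x (v w : Vec Carrier m) → x • (v ⊕ w) ≡ x • v ⊕ x • w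
    •-distribˡ x [] [] = refl
    •-distribˡ x (a ∷ v) (b ∷ w) = cong₂ _∷_ (distribˡ x a b) (•-distribˡ x v w)

    •-distribʳ : ∀ {m} x y (v : Vec Carrier m) → (x + y) • v ≡ x • v ⊕ y • v
    •-distribʳ x y [] = refl
    •-distribʳ x y (a ∷ v) = cong₂ _∷_ (distribʳ a x y) (•-distribʳ x y v)

    •-assoc : ∀ {m} x y (v : Vec Carrier m) → (x * y) • v ≡ x • (y • v)
    •-assoc x y [] = refl
    •-assoc x y (a ∷ v) = cong₂ _∷_ (*-assoc x y a) (•-assoc x y v)

    •-comm : ∀ {m} x y (v : Vec Carrier m) → x • (y • v) ≡ y • (x • v)
    •-comm x y v = trans (sym (•-assoc x y v)) (trans (cong (_• v) (*-comm x y)) (•-assoc y x v))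

    •-identity : ∀ {m} (v : Vec Carrier m) → 1# • v ≡ v
    •-identity [] = refl
    •-identity (a ∷ v) = cong₂ _∷_ (*-identityˡ a) (•-identity v)

    •-zeroˡ : ∀ {m} (v : Vec Carrier m) → 0# • v ≡ 𝟎
    •-zeroˡ [] = refl
    •-zeroˡ (a ∷ v) = cong₂ _∷_ (zeroˡ a) (•-zeroˡ v)

    •-zeroʳ : ∀ {m} x → x • 𝟎 {m} ≡ 𝟎
    •-zeroʳ {zero} x = refl
    •-zeroʳ {suc m} x = cong₂ _∷_ (zeroʳ x) (•-zeroʳ x)

    last : ∀ {m} → Vec Carrier (suc m) → Carrier
    last (x ∷ []) = x
    last (x ∷ y ∷ ys) = last (y ∷ ys)

    init : ∀ {m} → Vec Carrier (suc m) → Vec Carrier m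
    init (x ∷ []) = []
    init (x ∷ y ∷ ys) = x ∷ init (y ∷ ys)

    last-⊕ : ∀ {m} (v w : Vec Carrier (suc m)) → last (v ⊕ w) ≡ last v + last w
    last-⊕ (x ∷ []) (y ∷ []) = refl
    last-⊕ (x ∷ v@(_ ∷ _)) (y ∷ w@(_ ∷ _)) = last-⊕ v w

    last-• : ∀ {m} x (v : Vec Carrier (suc m)) → last (x • v) ≡ x * last v
    last-• x (y ∷ []) = refl
    last-• x (y ∷ v@(_ ∷ _)) = last-• x v

    init-⊕ : ∀ {m} (v w : Vec Carrier (suc m)) → init (v ⊕ w) ≡ init v ⊕ init w
    init-⊕ (x ∷ []) (y ∷ []) = refl
    init-⊕ (x ∷ v@(_ ∷ _)) (y ∷ w@(_ ∷ _)) = cong (x + y ∷_) (init-⊕ v w)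

    init-• : ∀ {m} x (v : Vec Carrier (suc m)) → init (x • v) ≡ x • init v
    init-• x (y ∷ []) = refl
    init-• x (y ∷ v@(_ ∷ _)) = cong (x * y ∷_) (init-• x v)

    -- Coordinates beyond the length are 0.
    _!_ : ∀ {m} → Vec Carrier m → ℕ → Carrier
    [] ! i = 0#
    (x ∷ v) ! zero = x
    (x ∷ v) ! suc i = v ! i

    !-ext : ∀ {m} (v w : Vec Carrier m) → (∀ i → v ! i ≡ w ! i) → v ≡ w
    !-ext [] [] h = refl
    !-ext (x ∷ v) (y ∷ w) h = cong₂ _∷_ (h 0) (!-ext v w (λ i → h (suc i)))

    !-⊕ : ∀ {m} (v w : Vec Carrier m) i → (v ⊕ w) ! i ≡ v ! i + w ! i
    !-⊕ [] [] i = sym (+-identityˡ 0#)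
    !-⊕ (x ∷ v) (y ∷ w) zero = refl
    !-⊕ (x ∷ v) (y ∷ w) (suc i) = !-⊕ v w i

    !-• : ∀ {m} x (v : Vec Carrier m) i → (x • v) ! i ≡ x * (v ! i)
    !-• x [] i = sym (zeroʳ x)
    !-• x (y ∷ v) zero = refl
    !-• x (y ∷ v) (suc i) = !-• x v i

    !-𝟎 : ∀ {m} i → 𝟎 {m} ! i ≡ 0#
    !-𝟎 {zero} i = refl
    !-𝟎 {suc m} zero = refl
    !-𝟎 {suc m} (suc i) = !-𝟎 {m} i

    last-! : ∀ {m} (v : Vec Carrier (suc m)) → last v ≡ v ! m
    last-! (x ∷ []) = refl
    last-! (x ∷ v@(_ ∷ _)) = last-! v

    !-init : ∀ {m} (v : Vec Carrier (suc m)) → last v ≡ 0# → ∀ i → init v ! i ≡ v ! i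
    !-init (x ∷ []) h zero = sym h
    !-init (x ∷ []) h (suc i) = refl
    !-init (x ∷ v@(_ ∷ _)) h zero = refl
    !-init (x ∷ v@(_ ∷ _)) h (suc i) = !-init v h i

    δ : ℕ → ℕ → Carrier
    δ zero zero = 1#
    δ zero (suc i) = 0#
    δ (suc j) zero = 0#
    δ (suc j) (suc i) = δ j i

    δ-≢ : ∀ {i j} → i < j → δ i j ≡ 0#
    δ-≢ {zero} (s≤s _) = refl
    δ-≢ {suc i} (s≤s i<j) = δ-≢ i<j

  -- K[y]/(y^(n+1) - c), with elements listed by increasing powers of y.
  module Companion (K : CRing) (n : ℕ) (c : Vec (CRing.Carrier K) (suc n)) where
    open CRing K
    open FreeModule K public
    open ≡-Reasoning

    V : Set
    V = Vec Carrier (suc n)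

    shift : V → V
    shift v = (0# ∷ init v) ⊕ last v • c

    shift-⊕ : ∀ v w → shift (v ⊕ w) ≡ shift v ⊕ shift w
    shift-⊕ v w = begin
      (0# ∷ init (v ⊕ w)) ⊕ last (v ⊕ w) • c
        ≡⟨ cong₂ (λ s t → (0# ∷ s) ⊕ t • c) (init-⊕ v w) (last-⊕ v w) ⟩
      (0# ∷ (init v ⊕ init w)) ⊕ (last v + last w) • c
        ≡⟨ cong₂ _⊕_ (cong (_∷ (init v ⊕ init w)) (sym (+-identityˡ 0#))) (•-distribʳ (last v) (last w) c) ⟩
      ((0# ∷ init v) ⊕ (0# ∷ init w)) ⊕ (last v • c ⊕ last w • c)
        ≡⟨ ⊕-interchange (0# ∷ init v) (0# ∷ init w) _ _ ⟩
      shift v ⊕ shift w ∎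

    shift-• : ∀ x v → shift (x • v) ≡ x • shift v
    shift-• x v = begin
      (0# ∷ init (x • v)) ⊕ last (x • v) • c
        ≡⟨ cong₂ (λ s t → (0# ∷ s) ⊕ t • c) (init-• x v) (last-• x v) ⟩
      (0# ∷ x • init v) ⊕ (x * last v) • c
        ≡⟨ cong₂ _⊕_ (cong (_∷ x • init v) (sym (zeroʳ x))) (•-assoc x (last v) c) ⟩
      x • (0# ∷ init v) ⊕ x • (last v • c)
        ≡⟨ •-distribˡ x (0# ∷ init v) _ ⟨
      x • shift v ∎

    shift-𝟎 : shift 𝟎 ≡ 𝟎
    shift-𝟎 = trans (cong shift (sym (•-zeroˡ 𝟎))) (trans (shift-• 0# 𝟎) (•-zeroˡ _))

    -- The polynomial with coefficients `u`, evaluated at the operator `shift`, which is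
    -- multiplication by y. Taking this as the product avoids double sums: polynomials in one linear
    -- operator commute, and `act-e₀` recovers `u`, whence commutativity and then associativity.
    act : ∀ {m} → Vec Carrier m → V → V
    act [] v = 𝟎
    act (x ∷ u) v = x • v ⊕ act u (shift v)

    act-⊕ : ∀ {m} (u : Vec Carrier m) v w → act u (v ⊕ w) ≡ act u v ⊕ act u w
    act-⊕ [] v w = sym (⊕-identityˡ 𝟎)
    act-⊕ (x ∷ u) v w = begin
      x • (v ⊕ w) ⊕ act u (shift (v ⊕ w))
        ≡⟨ cong₂ _⊕_ (•-distribˡ x v w) (trans (cong (act u) (shift-⊕ v w)) (act-⊕ u (shift v) (shift w))) ⟩
      (x • v ⊕ x • w) ⊕ (act u (shift v) ⊕ act u (shift w))
        ≡⟨ ⊕-interchange (x • v) (x • w) _ _ ⟩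
      act (x ∷ u) v ⊕ act (x ∷ u) w ∎

    act-• : ∀ {m} (u : Vec Carrier m) x v → act u (x • v) ≡ x • act u v
    act-• [] x v = sym (•-zeroʳ x)
    act-• (y ∷ u) x v = begin
      y • (x • v) ⊕ act u (shift (x • v))
        ≡⟨ cong₂ _⊕_ (•-comm y x v) (trans (cong (act u) (shift-• x v)) (act-• u x (shift v))) ⟩
      x • (y • v) ⊕ x • act u (shift v)
        ≡⟨ •-distribˡ x (y • v) _ ⟨
      x • act (y ∷ u) v ∎

    act-shift : ∀ {m} (u : Vec Carrier m) v → act u (shift v) ≡ shift (act u v)
    act-shift [] v = sym shift-𝟎
    act-shift (x ∷ u) v = begin
      x • shift v ⊕ act u (shift (shift v)) ≡⟨ cong₂ _⊕_ (sym (shift-• x v)) (act-shift u (shift v)) ⟩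
      shift (x • v) ⊕ shift (act u (shift v)) ≡⟨ shift-⊕ (x • v) _ ⟨
      shift (act (x ∷ u) v) ∎

    act-comm : ∀ {m k} (u : Vec Carrier m) (w : Vec Carrier k) v → act u (act w v) ≡ act w (act u v)
    act-comm u [] v = begin
      act u 𝟎 ≡⟨ cong (act u) (sym (•-zeroˡ 𝟎)) ⟩
      act u (0# • 𝟎) ≡⟨ act-• u 0# 𝟎 ⟩
      0# • act u 𝟎 ≡⟨ •-zeroˡ _ ⟩
      𝟎 ∎
    act-comm u (x ∷ w) v = begin
      act u (x • v ⊕ act w (shift v)) ≡⟨ act-⊕ u (x • v) _ ⟩
      act u (x • v) ⊕ act u (act w (shift v)) ≡⟨ cong₂ _⊕_ (act-• u x v) (act-comm u w (shift v)) ⟩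
      x • act u v ⊕ act w (act u (shift v)) ≡⟨ cong (λ t → x • act u v ⊕ act w t) (act-shift u v) ⟩
      x • act u v ⊕ act w (shift (act u v)) ∎

    e₀ : V
    e₀ = 1# ∷ 𝟎

    -- The coefficient of y^i in y^j times `u`, with nothing reduced.
    coeff : ∀ {m} → ℕ → Vec Carrier m → ℕ → Carrier
    coeff zero u i = u ! i
    coeff (suc j) u zero = 0#
    coeff (suc j) u (suc i) = coeff j u i

    coeff-[] : ∀ j i → coeff j [] i ≡ 0#
    coeff-[] zero i = refl
    coeff-[] (suc j) zero = refl
    coeff-[] (suc j) (suc i) = coeff-[] j i

    coeff-∷ : ∀ {m} j x (u : Vec Carrier m) i → x * δ j i + coeff (suc j) u i ≡ coeff j (x ∷ u) i
    coeff-∷ zero x u zero = trans (+-identityʳ _) (*-identityʳ x)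
    coeff-∷ zero x u (suc i) = trans (cong (_+ u ! i) (zeroʳ x)) (+-identityˡ _)
    coeff-∷ (suc j) x u zero = trans (+-identityʳ _) (zeroʳ x)
    coeff-∷ (suc j) x u (suc i) = coeff-∷ j x u i

    shift-δ : ∀ v j → (∀ i → v ! i ≡ δ j i) → j < n → ∀ i → shift v ! i ≡ δ (suc j) i
    shift-δ v j h j<n i = begin
      shift v ! i ≡⟨ !-⊕ (0# ∷ init v) (last v • c) i ⟩
      (0# ∷ init v) ! i + (last v • c) ! i ≡⟨ cong ((0# ∷ init v) ! i +_) (!-• (last v) c i) ⟩
      (0# ∷ init v) ! i + last v * c ! i ≡⟨ cong (λ t → (0# ∷ init v) ! i + t * c ! i) last≡0 ⟩
      (0# ∷ init v) ! i + 0# * c ! i ≡⟨ cong ((0# ∷ init v) ! i +_) (zeroˡ _) ⟩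
      (0# ∷ init v) ! i + 0# ≡⟨ +-identityʳ _ ⟩
      (0# ∷ init v) ! i ≡⟨ shifted i ⟩
      δ (suc j) i ∎
      where
      last≡0 : last v ≡ 0#
      last≡0 = trans (last-! v) (trans (h n) (δ-≢ j<n))
      shifted : ∀ i → (0# ∷ init v) ! i ≡ δ (suc j) i
      shifted zero = refl
      shifted (suc i) = trans (!-init v last≡0 i) (h i)

    -- The condition on `j + m` keeps every power of y that is read below y^(n+1), so no such shift
    -- wraps round and the basis vector just moves along.
    act-δ : ∀ {m} (u : Vec Carrier m) v j → (∀ i → v ! i ≡ δ j i) → j ℕ.+ m ≤ suc n →
            ∀ i → act u v ! i ≡ coeff j u i
    act-δ [] v j h j≤ i = trans (!-𝟎 {suc n} i) (sym (coeff-[] j i))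
    act-δ (x ∷ u) v j h j≤ i = begin
      (x • v ⊕ act u (shift v)) ! i ≡⟨ !-⊕ (x • v) (act u (shift v)) i ⟩
      (x • v) ! i + act u (shift v) ! i ≡⟨ cong₂ _+_ (trans (!-• x v i) (cong (x *_) (h i))) (rest u j≤) ⟩
      x * δ j i + coeff (suc j) u i ≡⟨ coeff-∷ j x u i ⟩
      coeff j (x ∷ u) i ∎
      where
      -- Only a nonempty tail gives `j < n`. After the last coefficient the shift may wrap round,
      -- but then `act []` discards it.
      rest : ∀ {m} (u : Vec Carrier m) → j ℕ.+ suc m ≤ suc n → act u (shift v) ! i ≡ coeff (suc j) u i
      rest [] _ = trans (!-𝟎 {suc n} i) (sym (coeff-[] (suc j) i))
      rest {suc m} u@(_ ∷ _) le = act-δ u (shift v) (suc j) (shift-δ v j h j<n) (subst (_≤ suc n) (ℕ.+-suc j (suc m)) le) i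
        where
        j<n : j < n
        j<n = ℕ.≤-pred (ℕ.≤-trans (s≤s (ℕ.m≤m+n (suc j) m)) (subst (_≤ suc n) (trans (ℕ.+-suc j (suc m)) (cong suc (ℕ.+-suc j m))) le))

    e₀-δ : ∀ i → e₀ ! i ≡ δ 0 i
    e₀-δ zero = refl
    e₀-δ (suc i) = !-𝟎 {n} i

    act-e₀ : ∀ u → act {suc n} u e₀ ≡ u
    act-e₀ u = !-ext _ _ (act-δ u e₀ 0 e₀-δ ℕ.≤-refl)

    mul : V → V → V
    mul = act

    mul-comm : ∀ u v → mul u v ≡ mul v u
    mul-comm u v = begin
      act u v ≡⟨ cong (act u) (sym (act-e₀ v)) ⟩
      act u (act v e₀) ≡⟨ act-comm u v e₀ ⟩
      act v (act u e₀) ≡⟨ cong (act v) (act-e₀ u) ⟩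
      act v u ∎

    mul-assoc : ∀ u v w → mul (mul u v) w ≡ mul u (mul v w)
    mul-assoc u v w = begin
      act (act u v) w ≡⟨ mul-comm (act u v) w ⟩
      act w (act u v) ≡⟨ act-comm w u v ⟩
      act u (act w v) ≡⟨ cong (act u) (mul-comm w v) ⟩
      act u (act v w) ∎

    act-scalar : ∀ x v → act {suc n} (x ∷ 𝟎) v ≡ x • v
    act-scalar x v = trans (cong (x • v ⊕_) (act-𝟎 n (shift v))) (⊕-identityʳ _)
      where
      act-𝟎 : ∀ m v → act (𝟎 {m}) v ≡ 𝟎
      act-𝟎 zero v = refl
      act-𝟎 (suc m) v = trans (cong₂ _⊕_ (•-zeroˡ v) (act-𝟎 m (shift v))) (⊕-identityˡ 𝟎)

    mul-identityˡ : ∀ v → mul e₀ v ≡ v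
    mul-identityˡ v = trans (act-scalar 1# v) (•-identity v)

    mul-distribˡ : ∀ u v w → mul u (v ⊕ w) ≡ mul u v ⊕ mul u w
    mul-distribˡ = act-⊕

    isCommutativeRing′ : IsCommutativeRing _≡_ _⊕_ mul (map λ x → - x) 𝟎 e₀
    isCommutativeRing′ = record
      { isRing = record
        { +-isAbelianGroup = record
          { isGroup = record
            { isMonoid = record
              { isSemigroup = record
                { isMagma = record { isEquivalence = isEquivalence ; ∙-cong = cong₂ _⊕_ }
                ; assoc = ⊕-assoc }
              ; identity = ⊕-identityˡ , ⊕-identityʳ }
            ; inverse = zipWith-inverseˡ {⁻¹ = λ x → - x} -‿inverseˡ , zipWith-inverseʳ {⁻¹ = λ x → - x} -‿inverseʳ
            ; ⁻¹-cong = cong (map λ x → - x) }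
          ; comm = ⊕-comm }
        ; *-cong = cong₂ mul
        ; *-assoc = mul-assoc
        ; *-identity = mul-identityˡ , λ v → trans (mul-comm v e₀) (mul-identityˡ v)
        ; distrib = mul-distribˡ , λ u v w → trans (mul-comm (v ⊕ w) u)
            (trans (mul-distribˡ u v w) (cong₂ _⊕_ (mul-comm u v) (mul-comm u w)))
        }
      ; *-comm = mul-comm
      }

    extension : CRing
    extension = record { isCommutativeRing = isCommutativeRing′ }

    y : V
    y = shift e₀

    embed : Carrier → V
    embed x = x ∷ 𝟎

    y-mul : ∀ v → mul y v ≡ shift v
    y-mul v = begin
      act (shift e₀) v ≡⟨ mul-comm y v ⟩
      act v (shift e₀) ≡⟨ act-shift v e₀ ⟩
      shift (act v e₀) ≡⟨ cong shift (act-e₀ v) ⟩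
      shift v ∎

    embed-mul : ∀ a b → embed (a * b) ≡ mul (embed a) (embed b)
    embed-mul a b = sym (trans (act-scalar a (embed b)) (cong (a * b ∷_) (•-zeroʳ a)))

    embed-+ : ∀ a b → embed (a + b) ≡ embed a ⊕ embed b
    embed-+ a b = cong (a + b ∷_) (sym (⊕-identityˡ 𝟎))

    act-∷-e₀ : ∀ {m} x (u : Vec Carrier m) → act (x ∷ u) e₀ ≡ embed x ⊕ mul y (act u e₀)
    act-∷-e₀ x u = cong₂ _⊕_ (cong₂ _∷_ (*-identityʳ x) (•-zeroʳ x))
      (trans (act-shift u e₀) (sym (y-mul (act u e₀))))

-- Kummer extensions of finite fields

module FieldTower where
  open PrimeCharacteristic
  open RingExtensions
  open import Data.Empty using (⊥-elim)
  open import Data.Fin as Fin using (Fin)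
  import Data.Fin.Properties as Fin
  open import Data.Nat as ℕ using (ℕ; zero; suc; _<_; _≤_; s≤s; z≤n)
  import Data.Nat.Properties as ℕ
  open import Data.Nat.Tactic.RingSolver using (solve-∀)
  open import Data.Product using (Σ; _,_; proj₁; proj₂) renaming (_×_ to _∧_)
  open import Data.Product.Function.NonDependent.Propositional using (_×-↔_)
  open import Data.Sum using (_⊎_; inj₁; inj₂; [_,_]′)
  open import Data.Vec using (Vec; []; _∷_; map; replicate)
  open import Data.Vec.Properties using (∷-injective)
  open import Function using (_↔_; mk↔ₛ′)
  open import Function.Properties.Inverse using (↔-trans; ↔-sym)
  open import Relation.Binary.PropositionalEquality
  open import Relation.Nullary using (yes; no)
  open import Relation.Nullary.Decidable using (via-injection)
  open import Relation.Binary using (DecidableEquality)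
  open import Function.Properties.Inverse using (↔⇒↣)

  IsDomain : CRing → Set
  IsDomain R = ∀ x y → x * y ≡ 0# → x ≡ 0# ⊎ y ≡ 0#
    where
    open CRing R

  AdditivePower : CRing → ℕ → Set
  AdditivePower R n = ∀ x y → (x + y) ^ n ≡ x ^ n + y ^ n
    where
    open CRing R

  Freshman : ℕ → Set₁
  Freshman p = (R : CRing) → HasChar p R → AdditivePower R p

  freshman-2 : Freshman 2
  freshman-2 R char = solve 2 (λ x y → (x :+ y) :^ 2 := x :^ 2 :+ y :^ 2) refl
    where
    open CharSolver R 2 char

  freshman-3 : Freshman 3
  freshman-3 R char = solve 2 (λ x y → (x :+ y) :^ 3 := x :^ 3 :+ y :^ 3) refl
    where
    open CharSolver R 3 char

  freshman-^ : ∀ {p} → Freshman p → (R : CRing) → HasChar p R → ∀ s → AdditivePower R (p ℕ.^ s)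
  freshman-^ {p} fresh R char zero x y = trans (*-identityʳ _) (sym (cong₂ _+_ (*-identityʳ x) (*-identityʳ y)))
    where
    open CRing R
  freshman-^ {p} fresh R char (suc s) x y = begin
    (x + y) ^ (p ℕ.* p ℕ.^ s) ≡⟨ ^-assocʳ _ p (p ℕ.^ s) ⟨
    ((x + y) ^ p) ^ (p ℕ.^ s) ≡⟨ cong (_^ (p ℕ.^ s)) (fresh R char x y) ⟩
    (x ^ p + y ^ p) ^ (p ℕ.^ s) ≡⟨ freshman-^ {p} fresh R char s _ _ ⟩
    (x ^ p) ^ (p ℕ.^ s) + (y ^ p) ^ (p ℕ.^ s) ≡⟨ cong₂ _+_ (^-assocʳ x p _) (^-assocʳ y p _) ⟩
    x ^ (p ℕ.* p ℕ.^ s) + y ^ (p ℕ.* p ℕ.^ s) ∎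
    where
    open CRing R
    open ≡-Reasoning

  module _ (R : CRing) where
    open CRing R

    one-^ : ∀ m → 1# ^ m ≡ 1#
    one-^ zero = refl
    one-^ (suc m) = trans (*-identityˡ _) (one-^ m)

    idempotent-^ : ∀ e → e * e ≡ e → ∀ m → e ^ suc m ≡ e
    idempotent-^ e ee zero = *-identityʳ e
    idempotent-^ e ee (suc m) = trans (cong (e *_) (idempotent-^ e ee m)) ee

  Vec-↔ : ∀ {A : Set} {q} → A ↔ Fin q → ∀ l → Vec A l ↔ Fin (q ℕ.^ l)
  Vec-↔ A↔ zero = mk↔ₛ′ (λ _ → Fin.zero) (λ _ → []) (λ { Fin.zero → refl ; (Fin.suc ()) }) (λ { [] → refl })
  Vec-↔ {A} A↔ (suc l) = ↔-trans uncons↔ (↔-trans (A↔ ×-↔ Vec-↔ A↔ l) (↔-sym Fin.*↔×))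
    where
    cons : A ∧ Vec A l → Vec A (suc l)
    cons (x , v) = x ∷ v
    uncons : Vec A (suc l) → A ∧ Vec A l
    uncons (x ∷ v) = x , v
    uncons↔ : Vec A (suc l) ↔ (A ∧ Vec A l)
    uncons↔ = mk↔ₛ′ uncons cons (λ _ → refl) (λ { (_ ∷ _) → refl })

  -- Besides being a field of odd degree over 𝔽ₚ, a KummerField carries an element a which is not
  -- an l-th power: a ^ m is a primitive l-th root of unity, where l m = q - 1. Hence yˡ - a is irreducible.
  record KummerField (p l : ℕ) : Set₁ where
    field
      R : CRing
    open CRing R public
    field
      char : HasChar p R
      1≢0 : 1# ≢ 0#
      domain : IsDomain R
      h m : ℕ
      enum : Carrier ↔ Fin (p ℕ.^ suc (2 ℕ.* h))
      frobenius : ∀ x → x ^ (p ℕ.^ suc (2 ℕ.* h)) ≡ x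
      0<m : 0 < m
      size : p ℕ.^ suc (2 ℕ.* h) ≡ suc (l ℕ.* m)
      a : Carrier
      root : (a ^ m) ^ l ≡ 1#
      exactOrder : ∀ i → 0 < i → i < l → (a ^ m) ^ i ≢ 1#
    q : ℕ
    q = p ℕ.^ suc (2 ℕ.* h)
    _≟_ : DecidableEquality Carrier
    _≟_ = via-injection (↔⇒↣ enum) Fin._≟_

  -- The number j (j - 1) / 2, the exponent of `ζ` in the product of y, ζ y, ..., ζ^(j-1) y. For odd
  -- l it is divisible by l at j = l, which makes the norm of y equal to `a`, without a sign.
  triangle : ℕ → ℕ
  triangle zero = 0
  triangle (suc j) = triangle j ℕ.+ j

  module Extend {p n g t : ℕ} (fresh : Freshman p) (l-odd : suc n ≡ suc (2 ℕ.* g))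
                (l∣triangle : triangle (suc n) ≡ suc n ℕ.* t) (K : KummerField p (suc n)) where
    open KummerField K
    open Companion R n (a ∷ replicate n 0#)
    open ≡-Reasoning

    l : ℕ
    l = suc n

    L : CRing
    L = extension

    module L = CRing L

    ζ : Carrier
    ζ = a ^ m

    embed-^ : ∀ x i → embed x L.^ i ≡ embed (x ^ i)
    embed-^ x zero = refl
    embed-^ x (suc i) = trans (cong (mul (embed x)) (embed-^ x i)) (sym (embed-mul x (x ^ i)))

    charL : HasChar p L
    charL = trans (embed-× p) (cong embed char)
      where
      embed-× : ∀ i → i L.× L.1# ≡ embed (i × 1#)
      embed-× zero = refl
      embed-× (suc i) = trans (cong (e₀ ⊕_) (embed-× i)) (sym (embed-+ 1# (i × 1#)))

    y-power-δ : ∀ j → j ≤ n → ∀ i → (y L.^ j) ! i ≡ δ j i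
    y-power-δ zero _ i = e₀-δ i
    y-power-δ (suc j) j<n i = trans (cong (_! i) (y-mul (y L.^ j)))
      (shift-δ (y L.^ j) j (y-power-δ j (ℕ.<⇒≤ j<n)) j<n i)

    y^l : y L.^ l ≡ embed a
    y^l = trans (y-mul (y L.^ n)) (!-ext _ _ λ i → begin
      ((0# ∷ init v) ⊕ last v • embed a) ! i ≡⟨ !-⊕ (0# ∷ init v) (last v • embed a) i ⟩
      (0# ∷ init v) ! i + (last v • embed a) ! i ≡⟨ cong₂ _+_ (low i) (trans (!-• (last v) (embed a) i) (cong (_* embed a ! i) last≡1)) ⟩
      0# + 1# * embed a ! i ≡⟨ trans (+-identityˡ _) (*-identityˡ _) ⟩
      embed a ! i ∎)
      where
      v : V
      v = y L.^ n
      v-δ : ∀ i → v ! i ≡ δ n i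
      v-δ = y-power-δ n ℕ.≤-refl
      δ-diag : ∀ j → δ j j ≡ 1#
      δ-diag zero = refl
      δ-diag (suc j) = δ-diag j
      last≡1 : last v ≡ 1#
      last≡1 = trans (last-! v) (trans (v-δ n) (δ-diag n))
      init-zero : ∀ {k} (w : Vec Carrier (suc k)) → (∀ i → w ! i ≡ δ k i) → ∀ i → init w ! i ≡ 0#
      init-zero (x ∷ []) h i = refl
      init-zero (x ∷ w@(_ ∷ _)) h zero = h 0
      init-zero (x ∷ w@(_ ∷ _)) h (suc i) = init-zero w (λ j → h (suc j)) i
      low : ∀ i → (0# ∷ init v) ! i ≡ 0#
      low zero = refl
      low (suc i) = init-zero v v-δ i

    twist : ∀ {k} → Carrier → Carrier → Vec Carrier k → Vec Carrier k
    twist ω s [] = []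
    twist ω s (x ∷ u) = s * x ∷ twist ω (s * ω) u

    -- An endomorphism of L over K that multiplies y by ω multiplies the coefficient of yⁱ by ωⁱ.
    module Twisted (ψ : V → V) (ψ-⊕ : ∀ u v → ψ (u ⊕ v) ≡ ψ u ⊕ ψ v) (ψ-mul : ∀ u v → ψ (mul u v) ≡ mul (ψ u) (ψ v))
                   (ψ-embed : ∀ x → ψ (embed x) ≡ embed x) (ω : Carrier) (ψ-y : ψ y ≡ mul (embed ω) y) where

      -- Induction along Horner's scheme; `s` collects the powers of `ω` that `ψ` splits off from y.
      ψ-horner : ∀ {k} (u : Vec Carrier k) s → mul (embed s) (ψ (act u e₀)) ≡ act (twist ω s u) e₀
      ψ-horner [] s = begin
        mul (embed s) (ψ 𝟎) ≡⟨ cong (mul (embed s)) (ψ-embed 0#) ⟩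
        mul (embed s) 𝟎 ≡⟨ L.zeroʳ (embed s) ⟩
        𝟎 ∎
      ψ-horner (x ∷ u) s = begin
        mul S (ψ (act (x ∷ u) e₀))
          ≡⟨ cong (λ z → mul S (ψ z)) (act-∷-e₀ x u) ⟩
        mul S (ψ (embed x ⊕ mul y U))
          ≡⟨ cong (mul S) (trans (ψ-⊕ _ _) (cong₂ _⊕_ (ψ-embed x) (ψ-mul y U))) ⟩
        mul S (embed x ⊕ mul (ψ y) (ψ U))
          ≡⟨ mul-distribˡ S _ _ ⟩
        mul S (embed x) ⊕ mul S (mul (ψ y) (ψ U))
          ≡⟨ cong₂ _⊕_ (sym (embed-mul s x)) (cong (λ z → mul S (mul z (ψ U))) ψ-y) ⟩
        embed (s * x) ⊕ mul S (mul (mul W y) (ψ U))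
          ≡⟨ cong (embed (s * x) ⊕_) (begin
               mul S (mul (mul W y) (ψ U)) ≡⟨ cong (mul S) (cong (λ z → mul z (ψ U)) (mul-comm W y)) ⟩
               mul S (mul (mul y W) (ψ U)) ≡⟨ cong (mul S) (mul-assoc y W (ψ U)) ⟩
               mul S (mul y (mul W (ψ U))) ≡⟨ mul-assoc S y _ ⟨
               mul (mul S y) (mul W (ψ U)) ≡⟨ cong (λ z → mul z (mul W (ψ U))) (mul-comm S y) ⟩
               mul (mul y S) (mul W (ψ U)) ≡⟨ mul-assoc y S _ ⟩
               mul y (mul S (mul W (ψ U))) ≡⟨ cong (mul y) (sym (mul-assoc S W (ψ U))) ⟩
               mul y (mul (mul S W) (ψ U)) ≡⟨ cong (λ z → mul y (mul z (ψ U))) (sym (embed-mul s ω)) ⟩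
               mul y (mul (embed (s * ω)) (ψ U)) ∎) ⟩
        embed (s * x) ⊕ mul y (mul (embed (s * ω)) (ψ U))
          ≡⟨ cong (λ z → embed (s * x) ⊕ mul y z) (ψ-horner u (s * ω)) ⟩
        embed (s * x) ⊕ mul y (act (twist ω (s * ω) u) e₀)
          ≡⟨ act-∷-e₀ (s * x) (twist ω (s * ω) u) ⟨
        act (twist ω s (x ∷ u)) e₀ ∎
        where
        S W U : V
        S = embed s
        W = embed ω
        U = act u e₀

      ψ-twist : ∀ u → ψ u ≡ twist ω 1# u
      ψ-twist u = begin
        ψ u ≡⟨ mul-identityˡ (ψ u) ⟨
        mul e₀ (ψ u) ≡⟨ cong (λ z → mul e₀ (ψ z)) (act-e₀ u) ⟨
        mul e₀ (ψ (act u e₀)) ≡⟨ ψ-horner u 1# ⟩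
        act (twist ω 1# u) e₀ ≡⟨ act-e₀ _ ⟩
        twist ω 1# u ∎

    twist-1 : ∀ {k} (u : Vec Carrier k) → twist 1# 1# u ≡ u
    twist-1 [] = refl
    twist-1 (x ∷ u) = cong₂ _∷_ (*-identityˡ x) (trans (cong (λ s → twist 1# s u) (*-identityˡ 1#)) (twist-1 u))

    φ : V → V
    φ u = u L.^ q

    φ-embed : ∀ x → φ (embed x) ≡ embed x
    φ-embed x = trans (embed-^ x q) (cong embed (frobenius x))

    φ-y : φ y ≡ mul (embed ζ) y
    φ-y = begin
      y L.^ q ≡⟨ cong (y L.^_) size ⟩
      mul y (y L.^ (l ℕ.* m)) ≡⟨ cong (mul y) (L.^-assocʳ y l m) ⟨
      mul y ((y L.^ l) L.^ m) ≡⟨ cong (λ z → mul y (z L.^ m)) y^l ⟩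
      mul y (embed a L.^ m) ≡⟨ cong (mul y) (embed-^ a m) ⟩
      mul y (embed ζ) ≡⟨ mul-comm y (embed ζ) ⟩
      mul (embed ζ) y ∎

    φ^ : ℕ → V → V
    φ^ j u = u L.^ (q ℕ.^ j)

    φ^-suc : ∀ j u → φ^ (suc j) u ≡ φ^ j (φ u)
    φ^-suc j u = sym (L.^-assocʳ u q (q ℕ.^ j))

    φ^-⊕ : ∀ j u v → φ^ j (u ⊕ v) ≡ φ^ j u ⊕ φ^ j v
    φ^-⊕ j u v = begin
      (u ⊕ v) L.^ (q ℕ.^ j) ≡⟨ cong ((u ⊕ v) L.^_) e ⟩
      (u ⊕ v) L.^ (p ℕ.^ (s ℕ.* j)) ≡⟨ freshman-^ {p} fresh L charL (s ℕ.* j) u v ⟩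
      (u L.^ (p ℕ.^ (s ℕ.* j))) ⊕ (v L.^ (p ℕ.^ (s ℕ.* j))) ≡⟨ cong (λ z → (u L.^ z) ⊕ (v L.^ z)) (sym e) ⟩
      φ^ j u ⊕ φ^ j v ∎
      where
      s : ℕ
      s = suc (2 ℕ.* h)
      e : q ℕ.^ j ≡ p ℕ.^ (s ℕ.* j)
      e = ℕ.^-*-assoc p s j

    φ^-mul : ∀ j u v → φ^ j (mul u v) ≡ mul (φ^ j u) (φ^ j v)
    φ^-mul j u v = L.^-distrib-* u v (q ℕ.^ j)

    φ^-embed : ∀ j x → φ^ j (embed x) ≡ embed x
    φ^-embed zero x = L.*-identityʳ (embed x)
    φ^-embed (suc j) x = trans (φ^-suc j (embed x)) (trans (cong (φ^ j) (φ-embed x)) (φ^-embed j x))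

    φ^-y : ∀ j → φ^ j y ≡ mul (embed (ζ ^ j)) y
    φ^-y zero = trans (L.*-identityʳ y) (sym (mul-identityˡ y))
    φ^-y (suc j) = begin
      φ^ (suc j) y ≡⟨ φ^-suc j y ⟩
      φ^ j (φ y) ≡⟨ cong (φ^ j) φ-y ⟩
      φ^ j (mul (embed ζ) y) ≡⟨ φ^-mul j (embed ζ) y ⟩
      mul (φ^ j (embed ζ)) (φ^ j y) ≡⟨ cong₂ mul (φ^-embed j ζ) (φ^-y j) ⟩
      mul (embed ζ) (mul (embed (ζ ^ j)) y) ≡⟨ mul-assoc (embed ζ) (embed (ζ ^ j)) y ⟨
      mul (mul (embed ζ) (embed (ζ ^ j))) y ≡⟨ cong (λ z → mul z y) (embed-mul ζ (ζ ^ j)) ⟨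
      mul (embed (ζ ^ suc j)) y ∎

    φ^-twist : ∀ j u → φ^ j u ≡ twist (ζ ^ j) 1# u
    φ^-twist j = Twisted.ψ-twist (φ^ j) (φ^-⊕ j) (φ^-mul j) (φ^-embed j) (ζ ^ j) (φ^-y j)

    frobeniusL : ∀ u → u L.^ (q ℕ.^ l) ≡ u
    frobeniusL u = trans (φ^-twist l u) (trans (cong (λ ω → twist ω 1# u) root) (twist-1 u))

    -- The sum 1 + q + ... + q^(j-1). Thus y ^ T l is the norm of y, and q^l - 1 = l (m T l) makes
    -- `m′` the new cofactor.
    T : ℕ → ℕ
    T zero = 0
    T (suc j) = T j ℕ.+ q ℕ.^ j

    q^-T : ∀ j → q ℕ.^ j ≡ suc (l ℕ.* (m ℕ.* T j))
    q^-T zero = cong suc (sym (trans (cong (l ℕ.*_) (ℕ.*-zeroʳ m)) (ℕ.*-zeroʳ l)))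
    q^-T (suc j) = begin
      q ℕ.* q ℕ.^ j ≡⟨ cong (ℕ._* (q ℕ.^ j)) size ⟩
      q ℕ.^ j ℕ.+ l ℕ.* m ℕ.* q ℕ.^ j ≡⟨ cong (ℕ._+ (l ℕ.* m ℕ.* q ℕ.^ j)) (q^-T j) ⟩
      suc (l ℕ.* (m ℕ.* T j) ℕ.+ l ℕ.* m ℕ.* q ℕ.^ j) ≡⟨ cong suc (factor l m (T j) (q ℕ.^ j)) ⟩
      suc (l ℕ.* (m ℕ.* T (suc j))) ∎
      where
      factor : ∀ l m t r → l ℕ.* (m ℕ.* t) ℕ.+ l ℕ.* m ℕ.* r ≡ l ℕ.* (m ℕ.* (t ℕ.+ r))
      factor = solve-∀

    m′ : ℕ
    m′ = m ℕ.* T l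

    0<q^ : ∀ j → 0 < q ℕ.^ j
    0<q^ j = subst (0 <_) (sym (q^-T j)) (s≤s z≤n)

    0<m′ : 0 < m′
    0<m′ = ℕ.*-mono-< 0<m (ℕ.<-≤-trans (0<q^ n) (ℕ.m≤n+m (q ℕ.^ n) (T n)))

    y^T : ∀ j → y L.^ T j ≡ mul (embed (ζ ^ triangle j)) (y L.^ j)
    y^T zero = sym (mul-identityˡ e₀)
    y^T (suc j) = begin
      y L.^ (T j ℕ.+ q ℕ.^ j) ≡⟨ L.^-homo-* y (T j) _ ⟩
      mul (y L.^ T j) (φ^ j y) ≡⟨ cong₂ mul (y^T j) (φ^-y j) ⟩
      mul (mul A Y) (mul B y) ≡⟨ mul-assoc A Y _ ⟩
      mul A (mul Y (mul B y)) ≡⟨ cong (mul A) (trans (sym (mul-assoc Y B y)) (trans (cong (λ z → mul z y) (mul-comm Y B)) (mul-assoc B Y y))) ⟩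
      mul A (mul B (mul Y y)) ≡⟨ mul-assoc A B _ ⟨
      mul (mul A B) (mul Y y) ≡⟨ cong₂ mul (trans (sym (embed-mul _ _)) (cong embed (sym (^-homo-* ζ (triangle j) j)))) (mul-comm Y y) ⟩
      mul (embed (ζ ^ triangle (suc j))) (y L.^ suc j) ∎
      where
      A B Y : V
      A = embed (ζ ^ triangle j)
      B = embed (ζ ^ j)
      Y = y L.^ j

    -- The norm of y is `a`, hence y ^ m′ is a ^ m: in the extension y takes over the role of `a`
    -- with the same root of unity. So `root` and `exactOrder` are inherited, and the extension can
    -- be repeated.
    y^m′ : y L.^ m′ ≡ embed ζ
    y^m′ = begin
      y L.^ (m ℕ.* T l) ≡⟨ cong (y L.^_) (ℕ.*-comm m (T l)) ⟩
      y L.^ (T l ℕ.* m) ≡⟨ L.^-assocʳ y (T l) m ⟨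
      (y L.^ T l) L.^ m ≡⟨ cong (L._^ m) norm ⟩
      embed a L.^ m ≡⟨ embed-^ a m ⟩
      embed ζ ∎
      where
      norm : y L.^ T l ≡ embed a
      norm = begin
        y L.^ T l ≡⟨ y^T l ⟩
        mul (embed (ζ ^ triangle l)) (y L.^ l) ≡⟨ cong₂ (λ z w → mul (embed (ζ ^ z)) w) l∣triangle y^l ⟩
        mul (embed (ζ ^ (l ℕ.* t))) (embed a) ≡⟨ cong (λ z → mul (embed z) (embed a)) (sym (^-assocʳ ζ l t)) ⟩
        mul (embed ((ζ ^ l) ^ t)) (embed a) ≡⟨ cong (λ z → mul (embed (z ^ t)) (embed a)) root ⟩
        mul (embed (1# ^ t)) (embed a) ≡⟨ cong (λ z → mul (embed z) (embed a)) (one-^ R t) ⟩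
        mul e₀ (embed a) ≡⟨ mul-identityˡ _ ⟩
        embed a ∎

    cancel-1 : ∀ s x → s ≢ 1# → s * x ≡ x → x ≡ 0#
    cancel-1 s x s≢1 sx = [ (λ z → ⊥-elim (s≢1 (x∙y⁻¹≈ε⇒x≈y s 1# z))) , (λ z → z) ]′ (domain (s - 1#) x (begin
      (s - 1#) * x ≡⟨ [y-z]x≈yx-zx x s 1# ⟩
      s * x - 1# * x ≡⟨ cong₂ _-_ sx (*-identityˡ x) ⟩
      x - x ≡⟨ -‿inverseʳ x ⟩
      0# ∎))
      where
      open import Algebra.Properties.Ring ring using (x∙y⁻¹≈ε⇒x≈y; [y-z]x≈yx-zx)

    -- The coefficient of y^j is multiplied by `ζ ^ j`, which is not 1 for 0 < j < l.
    twist-fixed : ∀ {k} j (u : Vec Carrier k) → 0 < j → j ℕ.+ k ≤ l → twist ζ (ζ ^ j) u ≡ u → u ≡ 𝟎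
    twist-fixed j [] 0<j _ _ = refl
    twist-fixed {suc k} j (x ∷ u) 0<j le eq = cong₂ _∷_
      (cancel-1 (ζ ^ j) x (exactOrder j 0<j (ℕ.≤-trans (ℕ.m<m+n j (s≤s z≤n)) le)) (proj₁ (∷-injective eq)))
      (twist-fixed (suc j) u (s≤s z≤n) (subst (_≤ l) (ℕ.+-suc j k) le)
        (trans (cong (λ s → twist ζ s u) (*-comm ζ (ζ ^ j))) (proj₂ (∷-injective eq))))

    -- An idempotent is fixed by the Frobenius map over K, hence lies in K, hence is 0 or 1.
    idempotentL : ∀ e → mul e e ≡ e → e ≡ 𝟎 ⊎ e ≡ e₀
    idempotentL e@(x ∷ u) ee = [ (λ z → inj₁ (trans e≡x (cong embed z))) , (λ z → inj₂ (trans e≡x (cong embed z))) ]′ x≡0∨1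
      where
      fixed : twist ζ 1# e ≡ e
      fixed = begin
        twist ζ 1# e ≡⟨ cong (λ ω → twist ω 1# e) (*-identityʳ ζ) ⟨
        twist (ζ ^ 1) 1# e ≡⟨ φ^-twist 1 e ⟨
        e L.^ (q ℕ.^ 1) ≡⟨ cong (e L.^_) (q^-T 1) ⟩
        e L.^ suc (l ℕ.* (m ℕ.* T 1)) ≡⟨ idempotent-^ L e ee (l ℕ.* (m ℕ.* T 1)) ⟩
        e ∎
      e≡x : e ≡ embed x
      e≡x = cong (x ∷_) (twist-fixed 1 u (s≤s z≤n) ℕ.≤-refl
        (trans (cong (λ s → twist ζ s u) (trans (*-identityʳ ζ) (sym (*-identityˡ ζ)))) (proj₂ (∷-injective fixed))))
      xx≡x : x * x ≡ x
      xx≡x = proj₁ (∷-injective (trans (embed-mul x x) (trans (cong₂ mul (sym e≡x) (sym e≡x)) (trans ee e≡x))))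
      x≡0∨1 : x ≡ 0# ⊎ x ≡ 1#
      x≡0∨1 with x ≟ 1#
      ... | yes x≡1 = inj₂ x≡1
      ... | no x≢1 = inj₁ (cancel-1 x x x≢1 xx≡x)

    -- By `frobeniusL` the power of u with exponent q^l - 1 is idempotent, hence 0 or 1; accordingly
    -- u is 0 or a unit. A fixed point argument thus takes the place of the irreducibility of the
    -- polynomial.
    domainL : IsDomain L
    domainL u v uv≡0 = go (l ℕ.* m′) (ℕ.*-mono-< (s≤s (z≤n {n})) 0<m′) (trans (cong (u L.^_) (sym (q^-T l))) (frobeniusL u))
      where
      go : ∀ r → 0 < r → u L.^ suc r ≡ u → u ≡ 𝟎 ⊎ v ≡ 𝟎
      go (suc r) _ u^ = case-idem (idempotentL e ee)
        where
        e : V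
        e = u L.^ suc r
        ee : mul e e ≡ e
        ee = begin
          mul e (mul u (u L.^ r)) ≡⟨ mul-assoc e u _ ⟨
          mul (mul e u) (u L.^ r) ≡⟨ cong (λ z → mul z (u L.^ r)) (trans (mul-comm e u) u^) ⟩
          e ∎
        case-idem : e ≡ 𝟎 ⊎ e ≡ e₀ → u ≡ 𝟎 ⊎ v ≡ 𝟎
        case-idem (inj₁ e≡0) = inj₁ (trans (sym u^) (trans (cong (mul u) e≡0) (L.zeroʳ u)))
        case-idem (inj₂ e≡1) = inj₂ (begin
          v ≡⟨ mul-identityˡ v ⟨
          mul e₀ v ≡⟨ cong (λ z → mul z v) e≡1 ⟨
          mul (mul u (u L.^ r)) v ≡⟨ cong (λ z → mul z v) (mul-comm u (u L.^ r)) ⟩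
          mul (mul (u L.^ r) u) v ≡⟨ mul-assoc (u L.^ r) u v ⟩
          mul (u L.^ r) (mul u v) ≡⟨ cong (mul (u L.^ r)) uv≡0 ⟩
          mul (u L.^ r) 𝟎 ≡⟨ L.zeroʳ (u L.^ r) ⟩
          𝟎 ∎)

    h′ : ℕ
    h′ = h ℕ.+ g ℕ.+ 2 ℕ.* h ℕ.* g

    card : q ℕ.^ l ≡ p ℕ.^ suc (2 ℕ.* h′)
    card = trans (ℕ.^-*-assoc p (suc (2 ℕ.* h)) l) (cong (p ℕ.^_) (trans (cong (suc (2 ℕ.* h) ℕ.*_) l-odd) (odd h g)))
      where
      odd : ∀ h g → suc (2 ℕ.* h) ℕ.* suc (2 ℕ.* g) ≡ suc (2 ℕ.* (h ℕ.+ g ℕ.+ 2 ℕ.* h ℕ.* g))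
      odd = solve-∀

    extend : KummerField p l
    extend = record
      { R = L
      ; char = charL
      ; 1≢0 = λ eq → 1≢0 (proj₁ (∷-injective eq))
      ; domain = domainL
      ; h = h′
      ; m = m′
      ; enum = subst (λ z → V ↔ Fin z) card (Vec-↔ enum l)
      ; frobenius = λ u → trans (cong (u L.^_) (sym card)) (frobeniusL u)
      ; 0<m = 0<m′
      ; size = trans (sym card) (q^-T l)
      ; a = y
      ; root = trans (cong (L._^ l) y^m′) (trans (embed-^ ζ l) (cong embed root))
      ; exactOrder = λ i 0<i i<l eq → exactOrder i 0<i i<l
          (proj₁ (∷-injective (trans (sym (trans (cong (L._^ i) y^m′) (embed-^ ζ i))) eq)))
      }

  -- `suc g` makes l at least 3, so each extension raises `h` by at least 1.
  tower : ∀ {p n g t} → Freshman p → suc n ≡ suc (2 ℕ.* suc g) → triangle (suc n) ≡ suc n ℕ.* t →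
          KummerField p (suc n) → ∀ N → Σ (KummerField p (suc n)) λ K → N ≤ KummerField.h K
  tower fresh odd tri K zero = K , z≤n
  tower {g = g} fresh odd tri K (suc N) with tower fresh odd tri K N
  ... | K′ , N≤h = Extend.extend fresh odd tri K′ ,
    ℕ.≤-trans (ℕ.≤-trans (s≤s N≤h) (ℕ.≤-trans (ℕ.≤-reflexive (sym (ℕ.+-comm h 1))) (ℕ.+-monoʳ-≤ h (s≤s (z≤n {g}))))) (ℕ.m≤m+n (h ℕ.+ suc g) _)
    where h = KummerField.h K′

-- The fields with 8 and 27 elements

module BaseFields where
  open PrimeCharacteristic
  open RingExtensions
  open FieldTower
  open import Algebra.Bundles using (RawRing)
  open import Data.Fin as Fin using (Fin)
  import Data.Fin.Properties as Fin
  open import Data.Fin.Properties using (all?)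
  open import Data.Fin.Patterns
  open import Data.Nat as ℕ using (ℕ; zero; suc; pred; _<_; _≤_; s≤s; z≤n; NonZero)
  import Data.Nat.Properties as ℕ
  open import Data.Product using (Σ; _,_; proj₁; proj₂) renaming (_×_ to _∧_)
  open import Data.Sum using (_⊎_; inj₁; inj₂)
  open import Data.Unit using (tt)
  open import Data.Vec using (Vec; []; _∷_)
  open import Data.Vec.Properties using (≡-dec)
  open import Function using (_↔_)
  open import Function.Construct.Identity using (↔-id)
  open import Relation.Binary using (DecidableEquality)
  open import Relation.Binary.PropositionalEquality
  open import Relation.Nullary using (Dec; yes; no)
  open import Relation.Nullary.Decidable using (toWitness; True; _×-dec_; _⊎-dec_; ¬?; map′)

  module ResidueLaws (p : ℕ) .{{_ : NonZero p}} where
    open RawRing (residueRing p)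

    Laws : Set
    Laws = ∀ x y z → (x + (y + z) ≡ (x + y) + z) ∧ (x * (y * z) ≡ (x * y) * z) ∧ (x * (y + z) ≡ x * y + x * z)
           ∧ (x + y ≡ y + x) ∧ (x * y ≡ y * x) ∧ (0# + x ≡ x) ∧ (1# * x ≡ x) ∧ (x + - x ≡ 0#)

    laws? : Dec Laws
    laws? = all? λ x → all? λ y → all? λ z →
      (_ Fin.≟ _) ×-dec (_ Fin.≟ _) ×-dec (_ Fin.≟ _) ×-dec (_ Fin.≟ _) ×-dec (_ Fin.≟ _) ×-dec (_ Fin.≟ _) ×-dec (_ Fin.≟ _) ×-dec (_ Fin.≟ _)

    module _ (laws : Laws) (0̂ : Fin p) where
      law = λ x y z → laws x y z

      cring : CRing
      cring = record
        { isCommutativeRing = record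
          { isRing = record
            { +-isAbelianGroup = record
              { isGroup = record
                { isMonoid = record
                  { isSemigroup = record
                    { isMagma = record { isEquivalence = isEquivalence ; ∙-cong = cong₂ _+_ }
                    ; assoc = λ x y z → sym (proj₁ (law x y z)) }
                  ; identity = +-id , λ x → trans (+-comm x 0#) (+-id x) }
                ; inverse = (λ x → trans (+-comm (- x) x) (+-inv x)) , +-inv
                ; ⁻¹-cong = cong (λ x → - x) }
              ; comm = +-comm }
            ; *-cong = cong₂ _*_
            ; *-assoc = λ x y z → sym (proj₁ (proj₂ (law x y z)))
            ; *-identity = *-id , λ x → trans (*-comm x 1#) (*-id x)
            ; distrib = dist , λ x y z → trans (*-comm (y + z) x) (trans (dist x y z) (cong₂ _+_ (*-comm x y) (*-comm x z)))
            }
          ; *-comm = *-comm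
          } }
        where
        dist : ∀ x y z → x * (y + z) ≡ x * y + x * z
        dist x y z = let (_ , _ , d , _) = law x y z in d
        +-comm : ∀ x y → x + y ≡ y + x
        +-comm x y = let (_ , _ , _ , d , _) = law x y 0̂ in d
        *-comm : ∀ x y → x * y ≡ y * x
        *-comm x y = let (_ , _ , _ , _ , d , _) = law x y 0̂ in d
        +-id : ∀ x → 0# + x ≡ x
        +-id x = let (_ , _ , _ , _ , _ , d , _) = law x 0̂ 0̂ in d
        *-id : ∀ x → 1# * x ≡ x
        *-id x = let (_ , _ , _ , _ , _ , _ , d , _) = law x 0̂ 0̂ in d
        +-inv : ∀ x → x + - x ≡ 0#
        +-inv x = let (_ , _ , _ , _ , _ , _ , _ , d) = law x 0̂ 0̂ in d

  𝔽₂ 𝔽₃ : CRing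
  𝔽₂ = ResidueLaws.cring 2 (toWitness {a? = ResidueLaws.laws? 2} tt) 0F
  𝔽₃ = ResidueLaws.cring 3 (toWitness {a? = ResidueLaws.laws? 3} tt) 0F

  module _ (R : CRing) where
    open CRing R
    open ≡-Reasoning

    domain-from-inverses : ∀ m → (∀ x → x ≡ 0# ⊎ x ^ suc m ≡ 1#) → IsDomain R
    domain-from-inverses m inv x y xy≡0 with inv x
    ... | inj₁ x≡0 = inj₁ x≡0
    ... | inj₂ x^≡1 = inj₂ (begin
      y ≡⟨ *-identityˡ y ⟨
      1# * y ≡⟨ cong (_* y) x^≡1 ⟨
      x * x ^ m * y ≡⟨ cong (_* y) (*-comm x (x ^ m)) ⟩
      x ^ m * x * y ≡⟨ *-assoc (x ^ m) x y ⟩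
      x ^ m * (x * y) ≡⟨ cong (x ^ m *_) xy≡0 ⟩
      x ^ m * 0# ≡⟨ zeroʳ _ ⟩
      0# ∎)

  -- 𝔽₂[y]/(y³ - y - 1) and 𝔽₃[y]/(y³ - y - 1); in both, y generates the multiplicative group
  -- up to a sign.
  𝔽₈ 𝔽₂₇ : CRing
  𝔽₈ = Companion.extension 𝔽₂ 2 (1F ∷ 1F ∷ 0F ∷ [])
  𝔽₂₇ = Companion.extension 𝔽₃ 2 (1F ∷ 1F ∷ 0F ∷ [])

  all-vec? : ∀ {p n} {P : Vec (Fin p) n → Set} → (∀ v → Dec (P v)) → Dec (∀ v → P v)
  all-vec? {n = zero} P? = map′ (λ { p [] → p }) (λ f → f []) (P? [])
  all-vec? {n = suc n} P? = map′ (λ { f (x ∷ v) → f x v }) (λ f x v → f (x ∷ v)) (all? λ x → all-vec? λ v → P? (x ∷ v))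

  order? : ∀ {A : Set} → (∀ (x y : A) → Dec (x ≡ y)) → (f : ℕ → A) (one : A) → ∀ l → Dec (∀ i → 0 < i → i < l → f i ≢ one)
  order? _≟_ f one zero = yes (λ i 0<i ())
  order? _≟_ f one (suc zero) = yes λ { zero () _ ; (suc i) _ (s≤s ()) }
  order? _≟_ f one (suc (suc l)) with f (suc l) ≟ one | order? _≟_ f one (suc l)
  ... | yes e | _ = no λ h → h (suc l) (s≤s z≤n) ℕ.≤-refl e
  ... | no _ | no ne = no λ h → ne λ i 0<i i<l → h i 0<i (ℕ.m<n⇒m<1+n i<l)
  ... | no ne | yes h = yes λ i 0<i i< → case-≤ i 0<i (ℕ.m≤n⇒m<n∨m≡n (ℕ.≤-pred i<))
    where
    case-≤ : ∀ i → 0 < i → i < suc l ⊎ i ≡ suc l → f i ≢ one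
    case-≤ i 0<i (inj₁ lt) = h i 0<i lt
    case-≤ i 0<i (inj₂ refl) = ne

  -- R is a parameter because for a concrete ring the comparison of types would unfold the powers occurring in them.
  module FromDecisions (R : CRing) (_≟_ : DecidableEquality (CRing.Carrier R))
    (all-dec : ∀ {P : CRing.Carrier R → Set} → (∀ x → Dec (P x)) → Dec (∀ x → P x)) where
    open CRing R

    kummerField : ∀ {p l} h m → Carrier ↔ Fin (p ℕ.^ suc (2 ℕ.* h)) → 0 < m → p ℕ.^ suc (2 ℕ.* h) ≡ suc (l ℕ.* m) → ∀ a →
      True ((p × 1#) ≟ 0#) → True (¬? (1# ≟ 0#)) → True (all-dec λ x → (x ≟ 0#) ⊎-dec ((x ^ suc (pred (l ℕ.* m))) ≟ 1#)) →
      True (all-dec λ x → (x ^ (p ℕ.^ suc (2 ℕ.* h))) ≟ x) → True (((a ^ m) ^ l) ≟ 1#) →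
      True (order? _≟_ ((a ^ m) ^_) 1# l) → KummerField p l
    kummerField {p} {l} h m enum 0<m size a char 1≢0 inverses frob root order = record
      { R = R
      ; char = toWitness char
      ; 1≢0 = toWitness 1≢0
      ; domain = domain-from-inverses R (pred (l ℕ.* m)) (toWitness inverses)
      ; h = h
      ; m = m
      ; enum = enum
      ; frobenius = toWitness frob
      ; 0<m = 0<m
      ; size = size
      ; a = a
      ; root = toWitness root
      ; exactOrder = toWitness order
      }

  _≟ᵥ_ : ∀ {p n} → DecidableEquality (Vec (Fin p) n)
  _≟ᵥ_ = ≡-dec Fin._≟_

  K₈ : KummerField 2 7
  K₈ = FromDecisions.kummerField 𝔽₈ _≟ᵥ_ all-vec? 1 1 (Vec-↔ (↔-id (Fin 2)) 3) (s≤s z≤n) refl (0F ∷ 1F ∷ 0F ∷ [])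
    tt tt tt tt tt tt

  -- Here m = 2, since 27 - 1 = 13 · 2: the root of unity is the square of y, which has order 13
  -- whatever the sign of the generator.
  K₂₇ : KummerField 3 13
  K₂₇ = FromDecisions.kummerField 𝔽₂₇ _≟ᵥ_ all-vec? 1 2 (Vec-↔ (↔-id (Fin 3)) 3) (s≤s z≤n) refl (0F ∷ 1F ∷ 0F ∷ [])
    tt tt tt tt tt tt

  bigField₂ : ∀ N → Σ (KummerField 2 7) λ K → N ≤ KummerField.h K
  bigField₂ = tower {g = 2} {t = 3} freshman-2 refl refl K₈

  bigField₃ : ∀ N → Σ (KummerField 3 13) λ K → N ≤ KummerField.h K
  bigField₃ = tower {g = 5} {t = 6} freshman-3 refl refl K₂₇

-- Closed walks in a polarity graph, read as polygons of plane vectors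

module PolarityGeometry where
  open PrimeCharacteristic
  open import Data.Empty using (⊥; ⊥-elim)
  open import Data.List using (List; []; _∷_; foldl)
  open import Data.Nat as ℕ using (ℕ; zero; suc; _<_; _≤_; s≤s; z≤n)
  import Data.Nat.Properties as ℕ
  open import Data.Product using (Σ; _,_; proj₁; proj₂) renaming (_×_ to _∧_)
  open import Data.Sum using (_⊎_; inj₁; inj₂)
  open import Data.Sum.Properties using (inj₁-injective)
  open import Data.Unit using (⊤; tt)
  open import Data.Vec using (Vec; []; _∷_; head)
  open import Relation.Binary.PropositionalEquality

  module Steps (R : CRing) where
    open CRing R

    -- A step leads from one point of a walk to the next one at finite position: `W t d₁ d₂` along the
    -- vector t (d₁ , d₂) through one line, `D t x N` along t (1 , x) through two lines that share
    -- their neighbour at infinity.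
    data Step : Set where
      W D : (t d₁ d₂ : Carrier) → Step

    Valid : Step → Set
    Valid (W t d₁ d₂) = t ≢ 0#
    Valid (D t x N) = N ≢ 0#

    Direction : Set
    Direction = Carrier ∧ Carrier

    direction : Step → Direction
    direction (W t d₁ d₂) = d₁ , d₂
    direction (D t x N) = 1# , x

    det : Direction → Direction → Carrier
    det (a , b) (c , d) = a * d - c * b

    -- A single step covers two edges of the walk and a double step four, so a walk of length 2m
    -- costs m.
    cost : List Step → ℕ
    cost [] = 0
    cost (W _ _ _ ∷ ss) = suc (cost ss)
    cost (D _ _ _ ∷ ss) = suc (suc (cost ss))

    AllW AllValid : List Step → Set
    AllW [] = ⊤
    AllW (W t d₁ d₂ ∷ ss) = t ≢ 0# ∧ AllW ss
    AllW (D _ _ _ ∷ ss) = ⊥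
    AllValid [] = ⊤
    AllValid (s ∷ ss) = Valid s ∧ AllValid ss

    Bent : Direction → List Step → Direction → Set
    Bent d [] e = det d e ≢ 0#
    Bent d (s ∷ ss) e = det d (direction s) ≢ 0# ∧ Bent (direction s) ss e

    StartsAlong : Direction → List Step → Set
    StartsAlong d [] = ⊤
    StartsAlong d (s ∷ _) = direction s ≡ d

  -- `nb u x` is the neighbour of the affine vertex u with first coordinate x, and `inf u` its neighbour at infinity.
  -- `κ` changes coordinates so that passing from one vertex to the next but one is given by `app`.
  record Geometry (R : CRing) (k′ : ℕ) : Set₁ where
    open CRing R
    open Steps R
    Affine : Set
    Affine = Vec Carrier (suc k′)
    Infinite : Set
    Infinite = Vec Carrier k′
    field
      nb : Affine → Carrier → Affine
      head-nb : ∀ u x → head (nb u x) ≡ x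
      nb-involutive : ∀ u x → nb (nb u x) (head u) ≡ u
      inf : Affine → Infinite
      slope : Carrier → Carrier
      slope-injective : ∀ {x y} → slope x ≡ slope y → x ≡ y
      Coords : Set
      κ : Affine → Coords
      app : Coords → Step → Coords
      finite-line : ∀ l a a′ → κ (nb l a′) ≡ app (κ (nb l a)) (W (a′ - a) 1# (slope (head l)))
      infinite-line : ∀ u v → inf u ≡ inf v → u ≢ v → Σ Carrier λ t → t ≢ 0# ∧ κ v ≡ app (κ u) (W t 0# 1#)
      double-line : ∀ l l′ a a′ → inf l ≡ inf l′ → l ≢ l′ → head l ≡ head l′ ∧ (Σ Carrier λ N →
                      N ≢ 0# ∧ κ (nb l′ a′) ≡ app (κ (nb l a)) (D (a′ - a) (slope (head l)) N))
      -- The algebraic core: a short closed walk yields either a closed chain of single steps or,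
      -- read from a suitable vertex, a closed chain ending in a double step. Each geometry refutes
      -- both by polynomial identities.
      no-W : ∀ x s ss → AllW (s ∷ ss) → cost (s ∷ ss) ≤ suc k′ → foldl app x (s ∷ ss) ≡ x →
             Bent (direction s) ss (direction s) → ⊥
      no-D : ∀ x t e N ss → N ≢ 0# → AllValid ss → suc (suc (cost ss)) ≤ suc k′ →
             app (foldl app x ss) (D t e N) ≡ x → Bent (1# , e) ss (1# , e) → ⊥
      -- The keys bound the number of loops by q^k′.
      loopKey : Affine → Infinite
      loopKey-injective : ∀ u v → nb u (head u) ≡ u → nb v (head v) ≡ v → loopKey u ≡ loopKey v → u ≡ v

  module Girth {R : CRing} {k′ : ℕ} (1≢0 : CRing.1# R ≢ CRing.0# R) (G : Geometry R k′) where
    open CRing R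
    open Steps R
    open Geometry G
    open import Algebra.Properties.Ring ring using (x∙y⁻¹≈ε⇒x≈y)

    V : Set
    V = Affine ⊎ Infinite

    Rel : V → V → Set
    Rel (inj₁ u) (inj₁ v) = nb u (head v) ≡ v
    Rel (inj₁ u) (inj₂ i) = inf u ≡ i
    Rel (inj₂ i) (inj₁ u) = inf u ≡ i
    Rel (inj₂ i) (inj₂ j) = ⊥

    Rel-sym : ∀ u v → Rel u v → Rel v u
    Rel-sym (inj₁ u) (inj₁ v) r = trans (cong (λ z → nb z (head u)) (sym r)) (nb-involutive u (head v))
    Rel-sym (inj₁ u) (inj₂ i) r = r
    Rel-sym (inj₂ i) (inj₁ u) r = r

    record Walk : Set where
      field
        v : ℕ → V
        adj : ∀ i → Rel (v i) (v (suc i))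
        bend : ∀ i → v i ≢ v (suc (suc i))
      adj-≡ : ∀ i {x y} → v i ≡ x → v (suc i) ≡ y → Rel x y
      adj-≡ i p q = subst₂ Rel p q (adj i)
      bend-≡ : ∀ i {x y} → v i ≡ x → v (suc (suc i)) ≡ y → x ≢ y
      bend-≡ i p q e = bend i (trans p (trans e (sym q)))
    open Walk

    drop : ℕ → Walk → Walk
    drop j w = record { v = λ i → v w (j ℕ.+ i)
      ; adj = λ i → subst (λ z → Rel (v w (j ℕ.+ i)) (v w z)) (sym (ℕ.+-suc j i)) (adj w (j ℕ.+ i))
      ; bend = λ i e → bend w (j ℕ.+ i) (trans e (cong (v w) (trans (ℕ.+-suc j (suc i)) (cong suc (ℕ.+-suc j i))))) }

    drop₂ : Walk → Walk
    drop₂ w = record { v = λ i → v w (suc (suc i)) ; adj = λ i → adj w (suc (suc i)) ; bend = λ i → bend w (suc (suc i)) }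

    -- Along a walk the odd vertices are read as points and the even ones as lines; the polarity
    -- allows every vertex both readings. Lines at infinity are vertical.
    lineDirection : V → Direction
    lineDirection (inj₁ l) = 1# , slope (head l)
    lineDirection (inj₂ i) = 0# , 1#

    1*1-0*x : ∀ x → 1# * 1# - 0# * x ≡ 1#
    1*1-0*x x = trans (cong₂ _-_ (*-identityˡ 1#) (zeroˡ x)) x-0#
      where
      open import Algebra.Properties.Ring ring using (-0#≈0#)
      x-0# : 1# - 0# ≡ 1#
      x-0# = trans (cong (1# +_) -0#≈0#) (+-identityʳ 1#)

    -- An affine neighbour of p is fixed by its first coordinate, and the only other neighbour is
    -- `inf p`. As `slope` is injective, the lines through p are told apart by their directions.
    bent : ∀ p l l′ → Rel l (inj₁ p) → Rel (inj₁ p) l′ → l ≢ l′ → det (lineDirection l) (lineDirection l′) ≢ 0#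
    bent p (inj₁ l) (inj₁ l′) r r′ ne e = ne (cong inj₁ (trans (sym (Rel-sym (inj₁ l) (inj₁ p) r)) (trans (cong (nb p) heads) r′)))
      where
      heads : head l ≡ head l′
      heads = sym (slope-injective (x∙y⁻¹≈ε⇒x≈y _ _ (trans (sym (cong₂ _-_ (*-identityˡ _) (*-identityˡ _))) e)))
    bent p (inj₁ l) (inj₂ i) r r′ ne e = 1≢0 (trans (sym (1*1-0*x (slope (head l)))) e)
    bent p (inj₂ i) (inj₁ l′) r r′ ne e = 1≢0 (trans (sym (-‿involutive 1#)) (trans (cong -_ minus) -0#≈0#))
      where
      open import Algebra.Properties.Ring ring using (-‿involutive; -0#≈0#)
      minus : - 1# ≡ 0#
      minus = trans (trans (sym (+-identityˡ (- 1#))) (cong₂ _-_ (sym (zeroˡ (slope (head l′)))) (sym (*-identityˡ 1#)))) e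
    bent p (inj₂ i) (inj₂ j) r r′ ne e = ne (cong inj₂ (trans (sym r) r′))

    bentAt : (w : Walk) → ∀ i {p} → v w (suc i) ≡ inj₁ p →
             det (lineDirection (v w i)) (lineDirection (v w (suc (suc i)))) ≢ 0#
    bentAt w i {p} e = bent p _ _ (adj-≡ w i refl e) (adj-≡ w (suc i) e refl) (bend w i)

    single : (w : Walk) → ∀ {p p′} → v w 1 ≡ inj₁ p → v w 3 ≡ inj₁ p′ →
             Σ Carrier λ t → let d = lineDirection (v w 2) in t ≢ 0# ∧ κ p′ ≡ app (κ p) (W t (proj₁ d) (proj₂ d))
    single w {p} {p′} e e′ with v w 2 in eq
    ... | inj₂ i = infinite-line p p′ (trans (adj-≡ w 1 e eq) (sym (adj-≡ w 2 eq e′)))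
                     (λ z → bend-≡ w 1 e e′ (cong inj₁ z))
    ... | inj₁ l = head p′ - head p
        , (λ z → bend-≡ w 1 e e′ (cong inj₁ (trans (sym p≡) (trans (cong (nb l) (sym (x∙y⁻¹≈ε⇒x≈y _ _ z))) p′≡))))
        , trans (cong κ (sym p′≡)) (trans (finite-line l (head p) (head p′)) (cong (λ z → app (κ z) _) p≡))
      where
      p≡ : nb l (head p) ≡ p
      p≡ = Rel-sym (inj₁ p) (inj₁ l) (adj-≡ w 1 e eq)
      p′≡ : nb l (head p′) ≡ p′
      p′≡ = adj-≡ w 2 eq e′

    affine-next : (w : Walk) → ∀ j {i} → v w j ≡ inj₂ i → Σ Affine λ l → v w (suc j) ≡ inj₁ l
    affine-next w j e with v w (suc j) in eq
    ... | inj₁ l = l , refl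
    ... | inj₂ i = ⊥-elim (adj-≡ w j e eq)

    affine-prev : (w : Walk) → ∀ j {i} → v w (suc j) ≡ inj₂ i → Σ Affine λ l → v w j ≡ inj₁ l
    affine-prev w j e with v w j in eq
    ... | inj₁ l = l , refl
    ... | inj₂ i = ⊥-elim (adj-≡ w j eq e)

    -- Distinct vertices at infinity have no common neighbour.
    affine-next₂ : (w : Walk) → ∀ j {i} → v w j ≡ inj₂ i → Σ Affine λ l → v w (suc (suc j)) ≡ inj₁ l
    affine-next₂ w j e with v w (suc (suc j)) in eq
    ... | inj₁ l = l , refl
    ... | inj₂ i = let (l , e₁) = affine-next w j e in
      ⊥-elim (bend-≡ w j e eq (cong inj₂ (trans (sym (adj-≡ w j e e₁)) (adj-≡ w (suc j) e₁ eq))))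

    affine-prev₂ : (w : Walk) → ∀ j {i} → v w (suc (suc j)) ≡ inj₂ i → Σ Affine λ l → v w j ≡ inj₁ l
    affine-prev₂ w j e with v w j in eq
    ... | inj₁ l = l , refl
    ... | inj₂ i = let (l , e₁) = affine-prev w (suc j) e in
      ⊥-elim (bend-≡ w j eq e (cong inj₂ (trans (sym (adj-≡ w j eq e₁)) (adj-≡ w (suc j) e₁ e))))

    -- The point `i` at infinity has no coordinates to compare. The lines before and after it are
    -- parallel, so the passage from `p` to `p′` has one direction, and `N` records the distance
    -- between the two lines.
    double : (w : Walk) → ∀ {i p p′} → v w 3 ≡ inj₂ i → v w 1 ≡ inj₁ p → v w 5 ≡ inj₁ p′ →
             Σ Carrier λ t → Σ Carrier λ x → Σ Carrier λ N → N ≢ 0# ∧ κ p′ ≡ app (κ p) (D t x N) ∧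
             (1# , x) ≡ lineDirection (v w 2) ∧ (1# , x) ≡ lineDirection (v w 4)
    double w {i} {p} {p′} e e₁ e₅ with affine-prev w 2 e | affine-next w 3 e
    ... | l , e₂ | l′ , e₄ with double-line l l′ (head p) (head p′) (trans (adj-≡ w 2 e₂ e) (sym (adj-≡ w 3 e e₄)))
                                 (λ z → bend-≡ w 2 e₂ e₄ (cong inj₁ z))
    ... | heads , N , N≢0 , eq = head p′ - head p , slope (head l) , N , N≢0
        , trans (cong κ (sym (adj-≡ w 4 e₄ e₅))) (trans eq (cong (λ z → app (κ z) _) (Rel-sym (inj₁ p) (inj₁ l) (adj-≡ w 1 e₁ e₂))))
        , sym (cong lineDirection e₂) , sym (trans (cong lineDirection e₄) (cong (λ z → 1# , slope z) (sym heads)))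

    record Parse (w : Walk) (m : ℕ) (p p′ : Affine) (ss : List Step) : Set where
      field
        costs : cost ss ≡ m
        leads : κ p′ ≡ foldl app (κ p) ss
        bends : Bent (lineDirection (v w 0)) ss (lineDirection (v w (suc (suc (m ℕ.* 2)))))
        starts : StartsAlong (lineDirection (v w 2)) ss
    open Parse

    empty : (w : Walk) → ∀ {p p′} → v w 1 ≡ inj₁ p → v w 1 ≡ inj₁ p′ → Parse w 0 p p′ []
    empty w e e′ = record { costs = refl ; leads = cong κ (inj₁-injective (trans (sym e′) e)) ; bends = bentAt w 0 e ; starts = tt }

    consW : (w : Walk) → ∀ {m p p″ p′ ss t d₁ d₂} → v w 1 ≡ inj₁ p → (d₁ , d₂) ≡ lineDirection (v w 2) →
            κ p″ ≡ app (κ p) (W t d₁ d₂) → Parse (drop₂ w) m p″ p′ ss → Parse w (suc m) p p′ (W t d₁ d₂ ∷ ss)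
    consW w {m} {ss = ss} e d≡ step P = record
      { costs = cong suc (costs P)
      ; leads = trans (leads P) (cong (λ z → foldl app z ss) step)
      ; bends = subst (λ z → det (lineDirection (v w 0)) z ≢ 0#) (sym d≡) (bentAt w 0 e)
              , subst (λ z → Bent z ss (lineDirection (v w (suc (suc (suc m ℕ.* 2)))))) (sym d≡) (bends P)
      ; starts = d≡ }

    consD : (w : Walk) → ∀ {m p p″ p′ ss t x N} → v w 1 ≡ inj₁ p → (1# , x) ≡ lineDirection (v w 2) →
            (1# , x) ≡ lineDirection (v w 4) →
            κ p″ ≡ app (κ p) (D t x N) → Parse (drop₂ (drop₂ w)) m p″ p′ ss → Parse w (suc (suc m)) p p′ (D t x N ∷ ss)
    consD w {m} {ss = ss} e d≡ d≡′ step P = record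
      { costs = cong (λ z → suc (suc z)) (costs P)
      ; leads = trans (leads P) (cong (λ z → foldl app z ss) step)
      ; bends = subst (λ z → det (lineDirection (v w 0)) z ≢ 0#) (sym d≡) (bentAt w 0 e)
              , subst (λ z → Bent z ss (lineDirection (v w (suc (suc (suc (suc m) ℕ.* 2)))))) (sym d≡′) (bends P)
      ; starts = d≡ }

    -- Consecutive odd vertices are never both at infinity (`affine-next₂`), so each infinite point
    -- is absorbed by one double step.
    parse : ∀ m (w : Walk) {p p′} → v w 1 ≡ inj₁ p → v w (suc (m ℕ.* 2)) ≡ inj₁ p′ →
            Σ (List Step) λ ss → AllValid ss ∧ Parse w m p p′ ss
    parse zero w e e′ = [] , tt , empty w e e′
    parse (suc m) w e e′ with v w 3 in eq
    parse (suc m) w e e′ | inj₁ p″ with single w e eq | parse m (drop₂ w) eq e′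
    ... | t , t≢0 , step | ss , valid , P = W t _ _ ∷ ss , (t≢0 , valid) , consW w e refl step P
    parse (suc zero) w e e′ | inj₂ i = ⊥-elim (contra (trans (sym eq) e′))
      where
      contra : ∀ {i p} → inj₂ i ≢ inj₁ p
      contra ()
    parse (suc (suc m)) w e e′ | inj₂ i with affine-next₂ w 3 eq
    ... | p″ , e₅ with double w eq e e₅ | parse m (drop₂ (drop₂ w)) e₅ e′
    ... | t , x , N , N≢0 , step , d , d′ | ss , valid , P = D t x N ∷ ss , (N≢0 , valid) , consD w e d d′ step P

    scan : ∀ m (w : Walk) {p p′} → v w 1 ≡ inj₁ p → v w (suc (m ℕ.* 2)) ≡ inj₁ p′ →
           (Σ (List Step) λ ss → AllW ss ∧ Parse w m p p′ ss) ⊎ (Σ ℕ λ j → Σ Infinite λ i → v w (suc j) ≡ inj₂ i)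
    scan zero w e e′ = inj₁ ([] , tt , empty w e e′)
    scan (suc m) w e e′ with v w 3 in eq
    ... | inj₂ i = inj₂ (2 , i , eq)
    ... | inj₁ p″ with scan m (drop₂ w) eq e′
    ... | inj₂ (j , i , eq′) = inj₂ (suc (suc j) , i , eq′)
    ... | inj₁ (ss , allW , P) = let (t , t≢0 , step) = single w e eq in
      inj₁ (W t _ _ ∷ ss , (t≢0 , allW) , consW w e refl step P)

    Closed : Walk → ℕ → Set
    Closed w m = ∀ i → v w (m ℕ.* 2 ℕ.+ i) ≡ v w i

    Closed-drop : ∀ m j {w} → Closed w m → Closed (drop j w) m
    Closed-drop m j {w} c i = trans (cong (v w) swap) (c (j ℕ.+ i))
      where
      swap : j ℕ.+ (m ℕ.* 2 ℕ.+ i) ≡ m ℕ.* 2 ℕ.+ (j ℕ.+ i)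
      swap = trans (sym (ℕ.+-assoc j (m ℕ.* 2) i)) (trans (cong (ℕ._+ i) (ℕ.+-comm j (m ℕ.* 2))) (ℕ.+-assoc (m ℕ.* 2) j i))

    period : ∀ m w → Closed w m → ∀ j → v w (j ℕ.+ m ℕ.* 2) ≡ v w j
    period m w c j = trans (cong (v w) (ℕ.+-comm j (m ℕ.* 2))) (c j)

    -- The walk is read from the second vertex after the infinite one, so that its last step is double.
    no-infinite : ∀ m (w : Walk) {i} → m ≤ suc k′ → Closed w m → 0 < m → v w 1 ≡ inj₂ i → ⊥
    no-infinite (suc zero) w m≤ c _ e = bend w 0 (sym (c 0))
    no-infinite (suc (suc m)) w {i} m≤ c _ e =
      no-D (κ p) t x N ss N≢0 valid (ℕ.≤-trans (ℕ.≤-reflexive (cong (λ z → suc (suc z)) (costs P))) m≤)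
        (trans (cong (λ z → app z (D t x N)) (sym (leads P))) (sym step))
        (subst₂ (λ d d′ → Bent d ss d′) (sym (trans d₄ (cong lineDirection (period (suc (suc m)) w c 2)))) (sym d₂) (bends P))
      where
      T : ℕ
      T = suc (suc m) ℕ.* 2
      next = affine-next₂ w 1 e
      prev = affine-prev₂ w (suc (suc (suc (m ℕ.* 2)))) (trans (period (suc (suc m)) w c 1) e)
      p p′ : Affine
      p = proj₁ next
      p′ = proj₁ prev
      read = parse m (drop₂ w) (proj₂ next) (proj₂ prev)
      ss = proj₁ read
      valid = proj₁ (proj₂ read)
      P = proj₂ (proj₂ read)
      -- `w′` begins three places before the infinite vertex of the next period, so that its double
      -- step leads from `p′` back to `p`.
      w′ : Walk
      w′ = record { v = λ i → v w (i ℕ.+ (suc (suc (m ℕ.* 2)))) ; adj = λ i → adj w _ ; bend = λ i → bend w _ }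
      last = double w′ {i} {p′} {p} (trans (period (suc (suc m)) w c 1) e) (proj₂ prev) (trans (period (suc (suc m)) w c 3) (proj₂ next))
      t = proj₁ last
      x = proj₁ (proj₂ last)
      N = proj₁ (proj₂ (proj₂ last))
      N≢0 = proj₁ (proj₂ (proj₂ (proj₂ last)))
      step = proj₁ (proj₂ (proj₂ (proj₂ (proj₂ last))))
      d₂ = proj₁ (proj₂ (proj₂ (proj₂ (proj₂ (proj₂ last)))))
      d₄ = proj₂ (proj₂ (proj₂ (proj₂ (proj₂ (proj₂ last)))))

    no-closed-affine : ∀ m (w : Walk) {p} → suc m ≤ suc k′ → Closed w (suc m) → v w 1 ≡ inj₁ p → ⊥
    no-closed-affine m w {p} m≤ c e with scan (suc m) w e (trans (period (suc m) w c 1) e)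
    ... | inj₂ (j , i , eq) = no-infinite (suc m) (drop j w) m≤ (Closed-drop (suc m) j {w} c) (s≤s z≤n) (trans (cong (v w) (ℕ.+-comm j 1)) eq)
    ... | inj₁ (s ∷ ss , allW , P) = no-W (κ p) s ss allW (ℕ.≤-trans (ℕ.≤-reflexive (costs P)) m≤) (sym (leads P))
      -- After one period the line of the first step returns, so the last bend is taken against
      -- `direction s`.
      (subst (Bent (direction s) ss) (trans (cong lineDirection (period (suc m) w c 2)) (sym (starts P))) (proj₂ (bends P)))

    no-closed-walk : ∀ m (w : Walk) → 0 < m → m ≤ suc k′ → Closed w m → ⊥
    no-closed-walk (suc m) w _ m≤ c with v w 1 in eq
    ... | inj₁ p = no-closed-affine m w m≤ c eq
    ... | inj₂ i = no-infinite (suc m) w m≤ c (s≤s z≤n) eq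

-- Powers and remainders of natural numbers

module Arithmetic where
  open import Data.Nat as ℕ using (ℕ; zero; suc; _+_; _*_; _^_; _≤_)
  open import Data.Nat.Properties
  open import Data.Nat.DivMod using (_%_; %-distribˡ-+; m%n%n≡m%n)
  open import Data.Nat.Tactic.RingSolver using (solve-∀)
  open import Relation.Binary.PropositionalEquality
  open import Relation.Nullary using (yes; no; contradiction)

  ^-distrib-*ℕ : ∀ j a b → (a * b) ^ j ≡ a ^ j * b ^ j
  ^-distrib-*ℕ zero a b = refl
  ^-distrib-*ℕ (suc j) a b = trans (cong (a * b *_) (^-distrib-*ℕ j a b)) (interchange a b (a ^ j) (b ^ j))
    where
    interchange : ∀ a b x y → a * b * (x * y) ≡ a * x * (b * y)
    interchange = solve-∀

  -- Bernoulli's inequality for 1 + 1/x, multiplied by x^(j+1).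
  bernoulli : ∀ x j → x ^ suc j + suc j * x ^ j ≤ suc x ^ suc j
  bernoulli x zero = ≤-reflexive (base x)
    where
    base : ∀ x → x * 1 + 1 * 1 ≡ suc x * 1
    base = solve-∀
  bernoulli x (suc j) = begin
    x * X + suc (suc j) * X ≤⟨ m≤m+n _ _ ⟩
    x * X + suc (suc j) * X + suc j * x ^ j ≡⟨ expand x (x ^ j) j ⟩
    suc x * (X + suc j * x ^ j) ≤⟨ *-monoʳ-≤ (suc x) (bernoulli x j) ⟩
    suc x * suc x ^ suc j ∎
    where
    open ≤-Reasoning
    X : ℕ
    X = x ^ suc j
    expand : ∀ x y j → x * (x * y) + suc (suc j) * (x * y) + suc j * y ≡ suc x * (x * y + suc j * y)
    expand = solve-∀

  ^-cancelˡ-≤ : ∀ j {a b} → a ^ suc j ≤ b ^ suc j → a ≤ b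
  ^-cancelˡ-≤ j {a} {b} h with a ≤? b
  ... | yes a≤b = a≤b
  ... | no a≰b = contradiction h (<⇒≱ (^-monoˡ-< (suc j) (≰⇒> a≰b)))


  +-%-absorb : ∀ a i T → (a + i) % suc T ≡ (a + i % suc T) % suc T
  +-%-absorb a i T = trans (%-distribˡ-+ a i (suc T)) (trans (cong (λ z → (a % suc T + z) % suc T) (sym (m%n%n≡m%n i (suc T))))
    (sym (%-distribˡ-+ a (i % suc T) (suc T))))

-- From a geometry to a graph: freeness and the number of edges

module PolarityGraphs where
  open import Defs hiding (sym)
  open PrimeCharacteristic
  open FieldTower using (Vec-↔)
  open PolarityGeometry
  open Arithmetic using (+-%-absorb)
  open import Data.Bool using (Bool; true; false)
  open import Data.Empty using (⊥; ⊥-elim)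
  open import Data.Fin as Fin using (Fin; toℕ)
  import Data.Fin.Properties as Fin
  open import Data.List using (List; _++_; map; length; lookup; allFin)
  open import Data.List.Properties using (length-++; length-map)
  open import Data.List.Membership.Propositional using (_∈_; lose)
  open import Data.List.Membership.Propositional.Properties
    using (∈-concatMap⁺; ∈-map⁺; ∈-filter⁺; ∈-allFin; ∈-++⁺ˡ; ∈-++⁺ʳ)
  open import Data.List.Relation.Unary.Any as Any using (Any)
  open import Data.List.Relation.Unary.Any.Properties using (lookup-index)
  open import Data.Nat as ℕ using (ℕ; suc; _<_; _≤_; s≤s; z≤n)
  import Data.Nat.Properties as ℕ
  open import Data.Nat.DivMod using (_%_; m%n<n; [m+kn]%n≡m%n; m<n⇒m%n≡m; m≤n⇒[n∸m]%m≡n%m)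
  open import Data.Product using (Σ; _,_; proj₁; proj₂; swap) renaming (_×_ to _∧_)
  open import Data.Product.Properties using (,-injective)
  open import Data.Product.Function.NonDependent.Propositional using (_×-↔_)
  open import Data.Sum using (_⊎_; inj₁; inj₂; [_,_]′)
  import Data.Sum.Properties as Sum
  open import Data.Sum.Properties using (inj₁-injective; inj₂-injective)
  open import Data.Sum.Function.Propositional using (_⊎-↔_)
  open import Data.Vec using (Vec; head)
  open import Data.Vec.Properties using (≡-dec)
  open import Function using (_↔_; Injective; Inverse; mk⇔)
  open import Function.Properties.Inverse using (↔-trans; ↔-sym; ↔⇒↣)
  open import Function.Bundles using (Injection)
  open import Relation.Binary using (DecidableEquality)
  open import Relation.Binary.Definitions using (tri<; tri≈; tri>)
  open import Relation.Binary.PropositionalEquality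
  open import Relation.Nullary using (Dec; yes; no; does)
  open import Relation.Nullary.Decidable using (_×-dec_; ¬?; does-⇔; dec-true; dec-false)

  from-does : ∀ {P : Set} (d : Dec P) → does d ≡ true → P
  from-does (yes p) _ = p

  module _ {n : ℕ} (G : Graph n) where

    ∈-edgePairs : ∀ {i j} → toℕ i < toℕ j → adj G i j ≡ true → (i , j) ∈ edgePairs G
    ∈-edgePairs {i} {j} i<j a = ∈-concatMap⁺ _ {xs = allFin n}
      (lose (∈-allFin i) (∈-map⁺ (i ,_) (∈-filter⁺ _ (∈-allFin j) (i<j , a))))

    arcs : List (Fin n ∧ Fin n)
    arcs = edgePairs G ++ map swap (edgePairs G)

    length-arcs : length arcs ≡ edges G ℕ.+ edges G
    length-arcs = trans (length-++ (edgePairs G)) (cong (edges G ℕ.+_) (length-map swap (edgePairs G)))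

    ∈-arcs : ∀ {i j} → adj G i j ≡ true → (i , j) ∈ arcs
    ∈-arcs {i} {j} a with ℕ.<-cmp (toℕ i) (toℕ j)
    ... | tri< i<j _ _ = ∈-++⁺ˡ (∈-edgePairs i<j a)
    ... | tri> _ _ j<i = ∈-++⁺ʳ (edgePairs G) (∈-map⁺ swap (∈-edgePairs j<i (trans (Graph.sym G j i) a)))
    ... | tri≈ _ i≡j _ = ⊥-elim (false≢true (trans (sym (irrefl G i)) (trans (cong (adj G i) (Fin.toℕ-injective i≡j)) a)))
      where
      false≢true : false ≢ true
      false≢true ()

    -- Counting arcs by an injection, loops being charged to Z.
    arc-count : ∀ {M r} (Z : Set) → Z ↔ Fin r → (S : Set) → S ↔ Fin M →
      (f : S → (Σ (Fin n ∧ Fin n) λ { (i , j) → adj G i j ≡ true }) ⊎ Z) →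
      (∀ s t → [ (λ a → inj₁ (proj₁ a)) , inj₂ ]′ (f s) ≡ [ (λ a → inj₁ (proj₁ a)) , inj₂ ]′ (f t) → s ≡ t) →
      M ≤ edges G ℕ.+ edges G ℕ.+ r
    arc-count {M} {r} Z Z↔ S S↔ f f-inj = subst (λ z → M ≤ z ℕ.+ r) length-arcs (Fin.injective⇒≤ {f = h} h-injective)
      where
      code : (Σ (Fin n ∧ Fin n) λ { (i , j) → adj G i j ≡ true }) ⊎ Z → Fin (length arcs) ⊎ Fin r
      code = [ (λ a → inj₁ (Any.index (∈-arcs (proj₂ a)))) , (λ z → inj₂ (Inverse.to Z↔ z)) ]′
      decode : Fin (length arcs) ⊎ Fin r → (Fin n ∧ Fin n) ⊎ Z
      decode = [ (λ i → inj₁ (lookup arcs i)) , (λ i → inj₂ (Inverse.from Z↔ i)) ]′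
      decode-code : ∀ x → decode (code x) ≡ [ (λ a → inj₁ (proj₁ a)) , inj₂ ]′ x
      decode-code (inj₁ (_ , a)) = cong inj₁ (sym (lookup-index (∈-arcs a)))
      decode-code (inj₂ z) = cong inj₂ (Inverse.strictlyInverseʳ Z↔ z)
      h : Fin M → Fin (length arcs ℕ.+ r)
      h i = Inverse.from Fin.+↔⊎ (code (f (Inverse.from S↔ i)))
      h-injective : Injective _≡_ _≡_ h
      h-injective {i} {j} e = Injection.injective (↔⇒↣ (↔-sym S↔)) (f-inj _ _ (trans
        (sym (decode-code (f (Inverse.from S↔ i))))
        (trans (cong decode (Injection.injective (↔⇒↣ (↔-sym Fin.+↔⊎)) {code (f (Inverse.from S↔ i))} {code (f (Inverse.from S↔ j))} e)) (decode-code (f (Inverse.from S↔ j))))))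

  module Cycle {n : ℕ} (G : Graph n) {L′ : ℕ} (3≤L : 3 ≤ suc L′) (C : HasCycle G (suc L′)) where
    L : ℕ
    L = suc L′
    c : Fin L → Fin n
    c = proj₁ C

    residue : ℕ → Fin L
    residue i = Fin.fromℕ< (m%n<n i L)

    toℕ-residue : ∀ i → toℕ (residue i) ≡ i % L
    toℕ-residue i = Fin.toℕ-fromℕ< (m%n<n i L)

    next-residue : ∀ i → next (residue i) ≡ residue (suc i)
    next-residue i = Fin.toℕ-injective (trans (Fin.toℕ-fromℕ< _) (trans (cong (λ z → suc z % L) (toℕ-residue i))
      (trans (sym (+-%-absorb 1 i L′)) (sym (toℕ-residue (suc i))))))

    -- Wrapping round would force L = 2. This is what makes the walk around a cycle
    -- non-backtracking.
    +2-moves : ∀ i → i % L ≢ (2 ℕ.+ i) % L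
    +2-moves i e = go (2 ℕ.+ x ℕ.<? L)
      where
      x : ℕ
      x = i % L
      x<L : x < L
      x<L = m%n<n i L
      e′ : x ≡ (2 ℕ.+ x) % L
      e′ = trans e (+-%-absorb 2 i L′)
      go : Dec (2 ℕ.+ x < L) → ⊥
      go (yes lt) = ℕ.m≢1+n+m x (trans e′ (m<n⇒m%n≡m lt))
      go (no ¬lt) = ℕ.<⇒≢ 3≤L (ℕ.+-cancelʳ-≡ x 2 L (trans (sym (ℕ.m+[n∸m]≡n L≤)) (cong (L ℕ.+_) x≡)))
        where
        L≤ : L ≤ 2 ℕ.+ x
        L≤ = ℕ.≮⇒≥ ¬lt
        x≡ : 2 ℕ.+ x ℕ.∸ L ≡ x
        x≡ = sym (trans e′ (trans (sym (m≤n⇒[n∸m]%m≡n%m L≤))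
          (m<n⇒m%n≡m (ℕ.+-cancelʳ-< L _ L (subst (_< L ℕ.+ L) (sym (ℕ.m∸n+n≡m L≤)) (ℕ.+-mono-<-≤ {2} 3≤L (ℕ.<⇒≤ x<L)))))))

    walk : ℕ → Fin n
    walk i = c (residue i)

    walk-adj : ∀ i → adj G (walk i) (walk (suc i)) ≡ true
    walk-adj i = subst (λ z → adj G (walk i) (c z) ≡ true) (next-residue i) (proj₂ (proj₂ C) (residue i))

    walk-bends : ∀ i → walk i ≢ walk (2 ℕ.+ i)
    walk-bends i e = +2-moves i (trans (sym (toℕ-residue i)) (trans (cong toℕ (proj₁ (proj₂ C) e)) (toℕ-residue (2 ℕ.+ i))))

    walk-periodic : ∀ r i → walk (r ℕ.* L ℕ.+ i) ≡ walk i
    walk-periodic r i = cong c (Fin.toℕ-injective (trans (toℕ-residue (r ℕ.* L ℕ.+ i)) (trans (cong (_% L) (ℕ.+-comm (r ℕ.* L) i))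
      (trans ([m+kn]%n≡m%n i r L) (sym (toℕ-residue i))))))

  module PolarityGraph {R : CRing} {k′ : ℕ} (1≢0 : CRing.1# R ≢ CRing.0# R) (Γ : Geometry R k′)
                       (_≟_ : DecidableEquality (CRing.Carrier R)) {q : ℕ} (enum : CRing.Carrier R ↔ Fin q) where
    open CRing R using (Carrier)
    open Geometry Γ
    open Girth 1≢0 Γ

    k n : ℕ
    k = suc k′
    n = q ℕ.^ k ℕ.+ q ℕ.^ k′

    V↔ : V ↔ Fin n
    V↔ = ↔-trans (Vec-↔ enum k ⊎-↔ Vec-↔ enum k′) (↔-sym Fin.+↔⊎)

    vertex : Fin n → V
    vertex = Inverse.from V↔

    index : V → Fin n
    index = Inverse.to V↔

    vertex-index : ∀ v → vertex (index v) ≡ v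
    vertex-index = Inverse.strictlyInverseʳ V↔

    vertex-injective : ∀ {i j} → vertex i ≡ vertex j → i ≡ j
    vertex-injective = Injection.injective (↔⇒↣ (↔-sym V↔))

    Rel? : ∀ u v → Dec (Rel u v)
    Rel? (inj₁ u) (inj₁ v) = ≡-dec _≟_ _ _
    Rel? (inj₁ u) (inj₂ i) = ≡-dec _≟_ _ _
    Rel? (inj₂ i) (inj₁ u) = ≡-dec _≟_ _ _
    Rel? (inj₂ i) (inj₂ j) = no λ ()

    adj? : ∀ i j → Dec (Rel (vertex i) (vertex j) ∧ i ≢ j)
    adj? i j = Rel? (vertex i) (vertex j) ×-dec ¬? (i Fin.≟ j)

    graph : Graph n
    graph = record
      { adj = λ i j → does (adj? i j)
      ; sym = λ i j → does-⇔ (mk⇔ (flip i j) (flip j i)) (adj? i j) (adj? j i)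
      ; irrefl = λ i → dec-false (adj? i i) (λ { (_ , i≢i) → i≢i refl })
      }
      where
      flip : ∀ i j → Rel (vertex i) (vertex j) ∧ i ≢ j → Rel (vertex j) (vertex i) ∧ j ≢ i
      flip i j (r , i≢j) = Rel-sym _ _ r , λ e → i≢j (sym e)

    free : Free k graph
    free L family cycle = absurd L family cycle
      where
      module _ {L′ : ℕ} (3≤L : 3 ≤ suc L′) (C : HasCycle graph (suc L′)) where
        open Cycle graph 3≤L C
        closedWalk : ∀ r m → r ℕ.* suc L′ ≡ m ℕ.* 2 → 0 < m → m ≤ k → ⊥
        closedWalk r m e 0<m m≤k = no-closed-walk m w 0<m m≤k (λ i → trans (cong (λ z → vertex (walk (z ℕ.+ i))) (sym e)) (cong vertex (walk-periodic r i)))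
          where
          w : Walk
          w = record { v = λ i → vertex (walk i)
            ; adj = λ i → proj₁ (from-does (adj? (walk i) (walk (suc i))) (walk-adj i))
            ; bend = λ i e → walk-bends i (vertex-injective e) }
      absurd : ∀ L → InFamily k L → HasCycle graph L → ⊥
      -- A cycle of length at most k is run through twice, because only closed walks of even length
      -- are read as polygons; L ≤ k stands for 2L ≤ 2k.
      absurd (suc L′) (inj₁ (3≤L , L≤k)) C = closedWalk 3≤L C 2 (suc L′) (ℕ.*-comm 2 (suc L′)) (s≤s z≤n) L≤k
      absurd (suc L′) (inj₂ (4≤L , L≤2k , m , L≡2m)) C = closedWalk (ℕ.<⇒≤ 4≤L) C 1 m
        (trans (ℕ.*-identityˡ (suc L′)) (trans L≡2m (ℕ.*-comm 2 m)))
        (ℕ.n≢0⇒n>0 λ { refl → ℕ.1+n≢0 L≡2m })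
        (ℕ.*-cancelˡ-≤ 2 (subst (_≤ 2 ℕ.* k) L≡2m L≤2k))

    -- Ordered pairs of related vertices, loops included: q^(k+1) between affine vertices and q^k in
    -- either direction between affine and infinite ones.
    Arc : Set
    Arc = (Affine ∧ Carrier) ⊎ (Affine ⊎ Affine)

    arc : Arc → V ∧ V
    arc (inj₁ (u , x)) = inj₁ u , inj₁ (nb u x)
    arc (inj₂ (inj₁ u)) = inj₁ u , inj₂ (inf u)
    arc (inj₂ (inj₂ u)) = inj₂ (inf u) , inj₁ u

    arc-Rel : ∀ s → Rel (proj₁ (arc s)) (proj₂ (arc s))
    arc-Rel (inj₁ (u , x)) = cong (nb u) (head-nb u x)
    arc-Rel (inj₂ (inj₁ u)) = refl
    arc-Rel (inj₂ (inj₂ u)) = refl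

    arc-injective : ∀ s t → arc s ≡ arc t → s ≡ t
    arc-injective (inj₁ (u , x)) (inj₁ (v , y)) e = cong inj₁ (cong₂ _,_ (inj₁-injective (proj₁ (,-injective e)))
      (trans (sym (head-nb u x)) (trans (cong head (inj₁-injective (proj₂ (,-injective e)))) (head-nb v y))))
    arc-injective (inj₂ (inj₁ u)) (inj₂ (inj₁ v)) e = cong (λ z → inj₂ (inj₁ z)) (inj₁-injective (proj₁ (,-injective e)))
    arc-injective (inj₂ (inj₂ u)) (inj₂ (inj₂ v)) e = cong (λ z → inj₂ (inj₂ z)) (inj₁-injective (proj₂ (,-injective e)))
    arc-injective (inj₁ _) (inj₂ (inj₁ _)) e = ⊥-elim (absurd (proj₂ (,-injective e)))
      where absurd : ∀ {a b} → inj₁ a ≡ inj₂ b → ⊥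
            absurd ()
    arc-injective (inj₁ _) (inj₂ (inj₂ _)) e = ⊥-elim (absurd (proj₁ (,-injective e)))
      where absurd : ∀ {a b} → inj₁ a ≡ inj₂ b → ⊥
            absurd ()
    arc-injective (inj₂ (inj₁ _)) (inj₁ _) e = ⊥-elim (absurd (proj₂ (,-injective e)))
      where absurd : ∀ {a b} → inj₂ a ≡ inj₁ b → ⊥
            absurd ()
    arc-injective (inj₂ (inj₂ _)) (inj₁ _) e = ⊥-elim (absurd (proj₁ (,-injective e)))
      where absurd : ∀ {a b} → inj₂ a ≡ inj₁ b → ⊥
            absurd ()
    arc-injective (inj₂ (inj₁ _)) (inj₂ (inj₂ _)) e = ⊥-elim (absurd (proj₁ (,-injective e)))
      where absurd : ∀ {a b} → inj₁ a ≡ inj₂ b → ⊥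
            absurd ()
    arc-injective (inj₂ (inj₂ _)) (inj₂ (inj₁ _)) e = ⊥-elim (absurd (proj₁ (,-injective e)))
      where absurd : ∀ {a b} → inj₂ a ≡ inj₁ b → ⊥
            absurd ()

    Target : Set
    Target = (Σ (Fin n ∧ Fin n) λ { (i , j) → adj graph i j ≡ true }) ⊎ Infinite

    proper : ∀ u v → Rel u v → u ≢ v → Σ (Fin n ∧ Fin n) λ { (i , j) → adj graph i j ≡ true }
    proper u v r u≢v = (index u , index v) , dec-true (adj? (index u) (index v))
      (subst₂ Rel (sym (vertex-index u)) (sym (vertex-index v)) r
      , λ e → u≢v (trans (sym (vertex-index u)) (trans (cong vertex e) (vertex-index v))))

    place : ∀ s → Dec (proj₁ (arc s) ≡ proj₂ (arc s)) → Target
    place s (no ne) = inj₁ (proper _ _ (arc-Rel s) ne)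
    place (inj₁ (u , x)) (yes _) = inj₂ (loopKey u)
    place (inj₂ (inj₁ u)) (yes ())
    place (inj₂ (inj₂ u)) (yes ())

    visible : Target → (Fin n ∧ Fin n) ⊎ Infinite
    visible = [ (λ a → inj₁ (proj₁ a)) , inj₂ ]′

    place-injective : ∀ s t d d′ → visible (place s d) ≡ visible (place t d′) → s ≡ t
    place-injective s t (no _) (no _) e = arc-injective s t (cong₂ _,_
        (index-injective (proj₁ (,-injective (inj₁-injective e)))) (index-injective (proj₂ (,-injective (inj₁-injective e)))))
      where
      index-injective : ∀ {u v} → index u ≡ index v → u ≡ v
      index-injective {u} {v} e = trans (sym (vertex-index u)) (trans (cong vertex e) (vertex-index v))
    place-injective (inj₁ (u , x)) (inj₁ (v , y)) (yes p) (yes p′) e =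
      cong inj₁ (cong₂ _,_ u≡v (trans x≡ (trans (cong head u≡v) (sym y≡))))
      where
      x≡ : x ≡ head u
      x≡ = trans (sym (head-nb u x)) (cong head (sym (inj₁-injective p)))
      y≡ : y ≡ head v
      y≡ = trans (sym (head-nb v y)) (cong head (sym (inj₁-injective p′)))
      u≡v : u ≡ v
      u≡v = loopKey-injective u v (trans (cong (nb u) (sym x≡)) (sym (inj₁-injective p)))
        (trans (cong (nb v) (sym y≡)) (sym (inj₁-injective p′))) (inj₂-injective e)
    place-injective (inj₁ _) t (yes _) (no _) ()
    place-injective s (inj₁ _) (no _) (yes _) ()
    place-injective (inj₂ (inj₁ _)) t (yes ()) d′ e
    place-injective (inj₂ (inj₂ _)) t (yes ()) d′ e
    place-injective s (inj₂ (inj₁ _)) d (yes ()) e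
    place-injective s (inj₂ (inj₂ _)) d (yes ()) e

    _≟V_ : DecidableEquality V
    _≟V_ = Sum.≡-dec (≡-dec _≟_) (≡-dec _≟_)

    many-edges : q ℕ.^ k ℕ.* q ℕ.+ (q ℕ.^ k ℕ.+ q ℕ.^ k) ≤ edges graph ℕ.+ edges graph ℕ.+ q ℕ.^ k′
    many-edges = arc-count graph Infinite (Vec-↔ enum k′) Arc
      (↔-trans (↔-trans (A↔ ×-↔ enum) (↔-sym Fin.*↔×) ⊎-↔ ↔-trans (A↔ ⊎-↔ A↔) (↔-sym Fin.+↔⊎)) (↔-sym Fin.+↔⊎))
      (λ s → place s (proj₁ (arc s) ≟V proj₂ (arc s))) (λ s t → place-injective s t (proj₁ (arc s) ≟V proj₂ (arc s)) (proj₁ (arc t) ≟V proj₂ (arc t)))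
      where
      A↔ : Affine ↔ Fin (q ℕ.^ k)
      A↔ = Vec-↔ enum k

-- The three polarities, for k = 2, 3 and 5

module Polygons where
  open PrimeCharacteristic
  open FieldTower
  open PolarityGeometry
  open import Data.Empty using (⊥; ⊥-elim)
  open import Data.List using (List; []; _∷_; foldl)
  open import Data.Nat as ℕ using (ℕ; zero; suc; _≤_; s≤s)
  import Data.Nat.Properties as ℕ
  open import Data.Nat.Tactic.RingSolver using (solve-∀)
  open import Data.Product using (_,_; proj₁; proj₂) renaming (_×_ to _∧_)
  open import Data.Sum using ([_,_]′)
  open import Data.Vec using (Vec; []; _∷_; head)
  open import Data.Vec.Properties using (∷-injectiveˡ; ∷-injectiveʳ)
  open import Relation.Nullary using (yes; no)
  open import Relation.Binary.PropositionalEquality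

  module DomainFacts (R : CRing) (domain : IsDomain R) where
    open CRing R
    open import Algebra.Properties.Ring ring using (x∙y⁻¹≈ε⇒x≈y; +-cancelˡ)

    nonzero-* : ∀ {x y} → x ≢ 0# → y ≢ 0# → x * y ≢ 0#
    nonzero-* x≢0 y≢0 e = [ x≢0 , y≢0 ]′ (domain _ _ e)

    cancel-nonzero : ∀ {x y} → x * y ≡ 0# → x ≢ 0# → y ≡ 0#
    cancel-nonzero e x≢0 = [ (λ z → ⊥-elim (x≢0 z)) , (λ z → z) ]′ (domain _ _ e)

    -≡0 : ∀ {x y} → x ≡ y → x - y ≡ 0#
    -≡0 {x} refl = -‿inverseʳ x

    ≡-from-≡0 : ∀ {x y} → x - y ≡ 0# → x ≡ y
    ≡-from-≡0 = x∙y⁻¹≈ε⇒x≈y _ _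

  -- The endomorphism x ↦ x ^ p ^ (h + 1), whose square is the Frobenius map.
  module Tits {p l : ℕ} (fresh : Freshman p) (K : KummerField p l) where
    open KummerField K
    open DomainFacts R domain public
    open ≡-Reasoning

    σ : Carrier → Carrier
    σ x = x ^ (p ℕ.^ suc h)

    σσ : ∀ x → σ (σ x) ≡ x ^ p
    σσ x = begin
      (x ^ (p ℕ.^ suc h)) ^ (p ℕ.^ suc h) ≡⟨ ^-assocʳ x (p ℕ.^ suc h) (p ℕ.^ suc h) ⟩
      x ^ (p ℕ.^ suc h ℕ.* p ℕ.^ suc h) ≡⟨ cong (x ^_) (ℕ.^-distribˡ-+-* p (suc h) (suc h)) ⟨
      x ^ (p ℕ.^ (suc h ℕ.+ suc h)) ≡⟨ cong (λ z → x ^ (p ℕ.^ z)) (exponent h) ⟩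
      x ^ (p ℕ.* p ℕ.^ suc (2 ℕ.* h)) ≡⟨ cong (x ^_) (ℕ.*-comm p q) ⟩
      x ^ (q ℕ.* p) ≡⟨ ^-assocʳ x q p ⟨
      (x ^ q) ^ p ≡⟨ cong (_^ p) (frobenius x) ⟩
      x ^ p ∎
      where
      exponent : ∀ h → suc h ℕ.+ suc h ≡ suc (suc (2 ℕ.* h))
      exponent = solve-∀

    σ-+ : ∀ x y → σ (x + y) ≡ σ x + σ y
    σ-+ = freshman-^ {p} fresh R char (suc h)

    σ-* : ∀ x y → σ (x * y) ≡ σ x * σ y
    σ-* x y = ^-distrib-* x y (p ℕ.^ suc h)

    open import Algebra.Properties.Ring ring using (+-cancelˡ; +-identityʳ-unique)

    σ-0 : σ 0# ≡ 0#
    σ-0 = +-identityʳ-unique (σ 0#) (σ 0#) (trans (sym (σ-+ 0# 0#)) (cong σ (+-identityˡ 0#)))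

    σ-neg : ∀ x → σ (- x) ≡ - σ x
    σ-neg x = +-cancelˡ (σ x) _ _ (trans (sym (σ-+ x (- x))) (trans (cong σ (-‿inverseʳ x)) (trans σ-0 (sym (-‿inverseʳ (σ x))))))

    σ-- : ∀ x y → σ (x - y) ≡ σ x - σ y
    σ-- x y = trans (σ-+ x (- y)) (cong (σ x +_) (σ-neg y))

    ^≢0 : ∀ {x} → x ≢ 0# → ∀ i → x ^ i ≢ 0#
    ^≢0 x≢0 zero = 1≢0
    ^≢0 x≢0 (suc i) = nonzero-* x≢0 (^≢0 x≢0 i)

    σ-injective-0 : ∀ {x} → σ x ≡ 0# → x ≡ 0#
    σ-injective-0 {x} e with x ≟ 0#
    ... | yes x≡0 = x≡0
    ... | no x≢0 = ⊥-elim (^≢0 x≢0 (p ℕ.^ suc h) e)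

    σ-injective : ∀ {x y} → σ x ≡ σ y → x ≡ y
    σ-injective {x} {y} e = ≡-from-≡0 (σ-injective-0 (trans (σ-- x y) (-≡0 e)))

  module Plane {l : ℕ} (K : KummerField 2 l) where
    open Tits freshman-2 K
    open KummerField K
    open Steps R
    open CharSolver R 2 char
    open import Data.Fin.Patterns using (0F; 1F)

    app : Carrier ∧ Carrier → Step → Carrier ∧ Carrier
    app (a , b) (W t d₁ d₂) = a + t * d₁ , b + t * d₂
    app (a , b) (D t x N) = a + t , b + (t * x + N)

    -- A polarity of the projective plane: (a, b) and (x, y) are related when b + y = a x.
    nb : Vec Carrier 2 → Carrier → Vec Carrier 2
    nb (a ∷ b ∷ []) x = x ∷ a * x - b ∷ []

    κ : Vec Carrier 2 → Carrier ∧ Carrier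
    κ (a ∷ b ∷ []) = a , b

    inf : Vec Carrier 2 → Vec Carrier 1
    inf (a ∷ b ∷ []) = a ∷ []

    no-W : ∀ x s ss → AllW (s ∷ ss) → cost (s ∷ ss) ≤ 2 → foldl app x (s ∷ ss) ≡ x →
           Bent (direction s) ss (direction s) → ⊥
    no-W x (W t d₁ d₂) [] _ _ _ ne = ne (-‿inverseʳ _)
    no-W (a , b) (W t d₁ d₂) (W t′ e₁ e₂ ∷ []) (t≢0 , t′≢0 , _) _ e (ne , _) =
      nonzero-* (nonzero-* t≢0 t′≢0) ne (trans
        (solve 8 (λ a b t d₁ d₂ t′ e₁ e₂ → (t :* t′) :* (d₁ :* e₂ :- e₁ :* d₂) :=
          (t :* d₁) :* ((b :+ t :* d₂ :+ t′ :* e₂) :- b) :- (t :* d₂) :* ((a :+ t :* d₁ :+ t′ :* e₁) :- a)) refl a b t d₁ d₂ t′ e₁ e₂)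
        (trans (cong₂ (λ u v → (t * d₁) * u - (t * d₂) * v) (-≡0 (cong proj₂ e)) (-≡0 (cong proj₁ e)))
          (solve 2 (λ u v → u :* con 0F :- v :* con 0F := con 0F) refl (t * d₁) (t * d₂))))
    no-W x (W _ _ _) (W _ _ _ ∷ W _ _ _ ∷ _) _ (s≤s (s≤s ())) _ _

    no-D : ∀ x t e N ss → N ≢ 0# → AllValid ss → suc (suc (cost ss)) ≤ 2 →
           app (foldl app x ss) (D t e N) ≡ x → Bent (1# , e) ss (1# , e) → ⊥
    no-D _ t e N [] _ _ _ _ ne = ne (-‿inverseʳ _)
    no-D _ t e N (W _ _ _ ∷ _) _ _ (s≤s (s≤s ())) _ _
    no-D _ t e N (D _ _ _ ∷ _) _ _ (s≤s (s≤s ())) _ _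

    geometry : Geometry R 1
    geometry = record
      { nb = nb
      ; head-nb = λ { (a ∷ b ∷ []) x → refl }
      ; nb-involutive = λ { (a ∷ b ∷ []) x → cong (λ z → a ∷ z ∷ [])
          (solve 3 (λ a b x → x :* a :- (a :* x :- b) := b) refl a b x) }
      ; inf = inf
      ; slope = λ x → x
      ; slope-injective = λ e → e
      ; Coords = Carrier ∧ Carrier
      ; κ = κ
      ; app = app
      ; finite-line = λ { (x ∷ y ∷ []) a a′ → cong₂ _,_
          (solve 2 (λ a a′ → a′ := a :+ (a′ :- a) :* con 1F) refl a a′)
          (solve 4 (λ x y a a′ → x :* a′ :- y := (x :* a :- y) :+ (a′ :- a) :* x) refl x y a a′) }
      ; infinite-line = λ { (a ∷ b ∷ []) (a′ ∷ b′ ∷ []) e ne → b′ - b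
          , (λ z → ne (cong₂ (λ u v → u ∷ v ∷ []) (∷-injectiveˡ e) (sym (≡-from-≡0 z))))
          , cong₂ _,_ (trans (sym (∷-injectiveˡ e)) (solve 2 (λ a t → a := a :+ t :* con 0F) refl a (b′ - b)))
              (solve 2 (λ b b′ → b′ := b :+ (b′ :- b) :* con 1F) refl b b′) }
      ; double-line = λ { (x ∷ y ∷ []) (x′ ∷ y′ ∷ []) a a′ e ne → ∷-injectiveˡ e , y - y′
          , (λ z → ne (cong₂ (λ u v → u ∷ v ∷ []) (∷-injectiveˡ e) (≡-from-≡0 z)))
          , cong₂ _,_ (solve 2 (λ a a′ → a′ := a :+ (a′ :- a)) refl a a′)
              (trans (cong (λ z → z * a′ - y′) (sym (∷-injectiveˡ e)))
                (solve 5 (λ x y y′ a a′ → x :* a′ :- y′ := (x :* a :- y) :+ ((a′ :- a) :* x :+ (y :- y′))) refl x y y′ a a′)) }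
      ; no-W = no-W
      ; no-D = no-D
      ; loopKey = λ { (a ∷ b ∷ []) → b ∷ [] }
      ; loopKey-injective = λ { (a ∷ b ∷ []) (a′ ∷ b′ ∷ []) e e′ k → cong₂ (λ u v → u ∷ v ∷ [])
          (trans (loop a b e) (sym (loop a′ b′ e′))) (∷-injectiveˡ k) }
      }
      where
      -- The loop condition is a² = 2 b, and 2 = 0.
      loop : ∀ a b → nb (a ∷ b ∷ []) a ≡ a ∷ b ∷ [] → a ≡ 0#
      loop a b e = [ (λ z → z) , (λ z → z) ]′ (domain a a (trans
        (solve 2 (λ a b → a :* a := (a :* a :- b) :- b) refl a b) (-≡0 (∷-injectiveˡ (∷-injectiveʳ e)))))

  module Quadrangle {l : ℕ} (K : KummerField 2 l) where
    open Tits freshman-2 K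
    open KummerField K
    open Steps R
    open CharSolver R 2 char
    open import Data.Fin.Patterns using (0F; 1F)

    Point : Set
    Point = Carrier ∧ Carrier ∧ Carrier

    move : Point → Carrier → Carrier → Point
    move (a , b , c) m β = a + m , b + β , c + β * m

    app : Point → Step → Point
    app x (W t d₁ d₂) = move x (t * d₁) (t * d₂)
    app (a , b , c) (D t x N) = a + t , b + t * x , c + ((t * x) * t + N)

    -- The vertices (a, b, c) and (x, y, z) are related when y + c = x σ(a) and z + b = a σ(x);
    -- exchanging the vertices exchanges the equations.
    nb : Vec Carrier 3 → Carrier → Vec Carrier 3
    nb (a ∷ b ∷ c ∷ []) x = x ∷ x * σ a - c ∷ a * σ x - b ∷ []

    -- Applying `σ` to the last coordinate turns σ(a) into a², so that the coordinates of the points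
    -- on a line become polynomials in a.
    κ : Vec Carrier 3 → Point
    κ (a ∷ b ∷ c ∷ []) = a , b , σ c

    triple : ∀ {a a′ b b′ c c′ : Carrier} → a ≡ a′ → b ≡ b′ → c ≡ c′ → (a , b , c) ≡ (a′ , b′ , c′)
    triple refl refl refl = refl

    κ-nb : ∀ x y z a → κ (nb (x ∷ y ∷ z ∷ []) a) ≡ (a , a * σ x - z , σ x * (a * a) - σ y)
    κ-nb x y z a = triple refl refl (trans (σ-- (x * σ a) y) (cong (_- σ y) (trans (σ-* x (σ a))
      (cong (σ x *_) (trans (σσ a) (cong (a *_) (*-identityʳ a)))))))

    -- As 2 = 0, the third vector is the sum of the first two, and the sum of the products `β * m`
    -- then becomes their determinant.
    det-vanishes : ∀ a b c m₀ β₀ m₁ β₁ m₂ β₂ → move (move (move (a , b , c) m₀ β₀) m₁ β₁) m₂ β₂ ≡ (a , b , c) →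
                   m₀ * β₁ - m₁ * β₀ ≡ 0#
    det-vanishes a b c m₀ β₀ m₁ β₁ m₂ β₂ e = trans
      (solve 9 (λ a b c m₀ β₀ m₁ β₁ m₂ β₂ → m₀ :* β₁ :- m₁ :* β₀ :=
        ((c :+ β₀ :* m₀ :+ β₁ :* m₁ :+ β₂ :* m₂) :- c) :+ β₂ :* ((a :+ m₀ :+ m₁ :+ m₂) :- a)
          :+ (m₀ :+ m₁) :* ((b :+ β₀ :+ β₁ :+ β₂) :- b)) refl a b c m₀ β₀ m₁ β₁ m₂ β₂)
      (trans (cong₂ _+_ (cong₂ (λ u v → u + β₂ * v) (-≡0 (cong (λ z → proj₂ (proj₂ z)) e)) (-≡0 (cong proj₁ e)))
          (cong ((m₀ + m₁) *_) (-≡0 (cong (λ z → proj₁ (proj₂ z)) e))))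
        (solve 2 (λ u v → con 0F :+ u :* con 0F :+ v :* con 0F := con 0F) refl β₂ (m₀ + m₁)))

    bent-contradiction : ∀ {t t′ d₁ d₂ e₁ e₂} → t ≢ 0# → t′ ≢ 0# → d₁ * e₂ - e₁ * d₂ ≢ 0# →
                         (t * d₁) * (t′ * e₂) - (t′ * e₁) * (t * d₂) ≡ 0# → ⊥
    bent-contradiction {t} {t′} {d₁} {d₂} {e₁} {e₂} t≢0 t′≢0 ne e = nonzero-* (nonzero-* t≢0 t′≢0) ne (trans
      (solve 6 (λ t t′ d₁ d₂ e₁ e₂ → (t :* t′) :* (d₁ :* e₂ :- e₁ :* d₂) := (t :* d₁) :* (t′ :* e₂) :- (t′ :* e₁) :* (t :* d₂)) refl t t′ d₁ d₂ e₁ e₂) e)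

    move-0 : ∀ x → move x 0# 0# ≡ x
    move-0 (a , b , c) = triple (+-identityʳ a) (+-identityʳ b) (solve 1 (λ c → c :+ con 0F :* con 0F := c) refl c)

    no-W : ∀ x s ss → AllW (s ∷ ss) → cost (s ∷ ss) ≤ 3 → foldl app x (s ∷ ss) ≡ x →
           Bent (direction s) ss (direction s) → ⊥
    no-W x (W t d₁ d₂) [] _ _ _ ne = ne (-‿inverseʳ _)
    no-W (a , b , c) (W t d₁ d₂) (W t′ e₁ e₂ ∷ []) (t≢0 , t′≢0 , _) _ e (ne , _) =
      bent-contradiction t≢0 t′≢0 ne (det-vanishes a b c _ _ _ _ 0# 0# (trans (move-0 _) e))
    no-W (a , b , c) (W t d₁ d₂) (W t′ e₁ e₂ ∷ W _ _ _ ∷ []) (t≢0 , t′≢0 , _) _ e (ne , _) =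
      bent-contradiction t≢0 t′≢0 ne (det-vanishes a b c _ _ _ _ _ _ e)
    no-W x (W _ _ _) (W _ _ _ ∷ W _ _ _ ∷ W _ _ _ ∷ _) _ (s≤s (s≤s (s≤s ()))) _ _

    no-D : ∀ x t e N ss → N ≢ 0# → AllValid ss → suc (suc (cost ss)) ≤ 3 →
           app (foldl app x ss) (D t e N) ≡ x → Bent (1# , e) ss (1# , e) → ⊥
    no-D _ t e N [] _ _ _ _ ne = ne (-‿inverseʳ _)
    no-D (a , b , c) t x N (W t′ d₁ d₂ ∷ []) N≢0 (t′≢0 , _) _ e (ne , _) = nonzero-* t′≢0 ne (trans
      (solve 7 (λ a b t x t′ d₁ d₂ → t′ :* (con 1F :* d₂ :- d₁ :* x) :=
        ((b :+ t′ :* d₂ :+ t :* x) :- b) :- x :* ((a :+ t′ :* d₁ :+ t) :- a)) refl a b t x t′ d₁ d₂)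
      (trans (cong₂ (λ u v → u - x * v) (-≡0 (cong (λ z → proj₁ (proj₂ z)) e)) (-≡0 (cong proj₁ e)))
        (solve 1 (λ x → con 0F :- x :* con 0F := con 0F) refl x)))
    no-D _ _ _ _ (W _ _ _ ∷ W _ _ _ ∷ _) _ _ (s≤s (s≤s (s≤s ()))) _ _
    no-D _ _ _ _ (W _ _ _ ∷ D _ _ _ ∷ _) _ _ (s≤s (s≤s (s≤s ()))) _ _
    no-D _ _ _ _ (D _ _ _ ∷ _) _ _ (s≤s (s≤s (s≤s ()))) _ _

    geometry : Geometry R 2
    geometry = record
      { nb = nb
      ; head-nb = λ { (a ∷ b ∷ c ∷ []) x → refl }
      ; nb-involutive = λ { (a ∷ b ∷ c ∷ []) x → cong₂ (λ u v → a ∷ u ∷ v ∷ [])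
          (solve 2 (λ p b → p :- (p :- b) := b) refl (a * σ x) b) (solve 2 (λ p b → p :- (p :- b) := b) refl (x * σ a) c) }
      ; inf = λ { (a ∷ b ∷ c ∷ []) → a ∷ c ∷ [] }
      ; slope = σ
      ; slope-injective = σ-injective
      ; Coords = Point
      ; κ = κ
      ; app = app
      ; finite-line = λ { (x ∷ y ∷ z ∷ []) a a′ → trans (κ-nb x y z a′) (trans (triple
          (solve 2 (λ a a′ → a′ := a :+ (a′ :- a) :* con 1F) refl a a′)
          (solve 4 (λ X z a a′ → a′ :* X :- z := (a :* X :- z) :+ (a′ :- a) :* X) refl (σ x) z a a′)
          (solve 4 (λ X Y a a′ → X :* (a′ :* a′) :- Y := (X :* (a :* a) :- Y) :+ ((a′ :- a) :* X) :* ((a′ :- a) :* con 1F)) refl (σ x) (σ y) a a′))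
          (cong (λ p → app p (W (a′ - a) 1# (σ x))) (sym (κ-nb x y z a)))) }
      ; infinite-line = λ { (a ∷ b ∷ c ∷ []) (a′ ∷ b′ ∷ c′ ∷ []) refl ne → b′ - b
          , (λ z → ne (cong (λ u → a ∷ u ∷ c ∷ []) (sym (≡-from-≡0 z))))
          , triple (solve 2 (λ a t → a := a :+ t :* con 0F) refl a (b′ - b))
              (solve 2 (λ b b′ → b′ := b :+ (b′ :- b) :* con 1F) refl b b′)
              (solve 2 (λ c t → c := c :+ (t :* con 1F) :* (t :* con 0F)) refl (σ c) (b′ - b)) }
      ; double-line = λ { (x ∷ y ∷ z ∷ []) (x′ ∷ y′ ∷ z′ ∷ []) a a′ refl ne → refl , σ y - σ y′
          , (λ e → ne (cong (λ u → x ∷ u ∷ z ∷ []) (σ-injective (≡-from-≡0 e))))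
          , trans (κ-nb x y′ z a′) (trans (triple
              (solve 2 (λ a a′ → a′ := a :+ (a′ :- a)) refl a a′)
              (solve 4 (λ X z a a′ → a′ :* X :- z := (a :* X :- z) :+ (a′ :- a) :* X) refl (σ x) z a a′)
              (solve 5 (λ X Y Y′ a a′ → X :* (a′ :* a′) :- Y′ := (X :* (a :* a) :- Y) :+ (((a′ :- a) :* X) :* (a′ :- a) :+ (Y :- Y′)))
                refl (σ x) (σ y) (σ y′) a a′))
              (cong (λ p → app p (D (a′ - a) (σ x) (σ y - σ y′))) (sym (κ-nb x y z a)))) }
      ; no-W = no-W
      ; no-D = no-D
      ; loopKey = λ { (a ∷ b ∷ c ∷ []) → a ∷ b ∷ [] }
      ; loopKey-injective = λ { (a ∷ b ∷ c ∷ []) (a′ ∷ b′ ∷ c′ ∷ []) e e′ refl → cong (λ u → a ∷ b ∷ u ∷ [])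
          (trans (sym (∷-injectiveˡ (∷-injectiveʳ (∷-injectiveʳ e)))) (∷-injectiveˡ (∷-injectiveʳ (∷-injectiveʳ e′)))) }
      }

  module Hexagon {l : ℕ} (K : KummerField 3 l) where
    open Tits freshman-3 K
    open KummerField K
    open Steps R
    open CharSolver R 3 char
    open import Data.Fin.Patterns using (0F; 1F)

    Point : Set
    Point = Carrier ∧ Carrier ∧ Carrier ∧ Carrier ∧ Carrier

    quintuple : ∀ {a a′ b b′ c c′ d d′ e e′ : Carrier} → a ≡ a′ → b ≡ b′ → c ≡ c′ → d ≡ d′ → e ≡ e′ →
                (a , b , c , d , e) ≡ (a′ , b′ , c′ , d′ , e′)
    quintuple refl refl refl refl refl = refl

    -- Coordinates (a , b , d - a b , σ c , σ e) make all lines act alike.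
    move : Point → Carrier → Carrier → Point
    move (a , b , g , c , e) m β = a + m , b + β , g + (a + (a + m)) * β , c + β * (m * m) , e + m * (β * β)

    -- (x, x²) are the cubic moments of the vector (1, x), and the double step adds to the moments
    -- `N` times the derivative (1, 2x).
    app : Point → Step → Point
    app x (W t d₁ d₂) = move x (t * d₁) (t * d₂)
    app (a , b , g , c , e) (D t x N) = a + t , b + t * x , g + (a + (a + t)) * (t * x)
      , c + (t * x * (t * t) + N) , e + (t * (t * x * (t * x)) + (x * N + x * N))

    nb : Vec Carrier 5 → Carrier → Vec Carrier 5
    nb (a ∷ b ∷ c ∷ d ∷ e ∷ []) x =
      x ∷ y ∷ z ∷ x * (c - y) - e ∷ a * (z - b) - d ∷ []
      where
      y z : Carrier
      y = x * σ a - c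
      z = a * σ x - b

    κ : Vec Carrier 5 → Point
    κ (a ∷ b ∷ c ∷ d ∷ e ∷ []) = a , b , d - a * b , σ c , σ e

    κ-nb : ∀ x y z w v a → κ (nb (x ∷ y ∷ z ∷ w ∷ v ∷ []) a) ≡
      (a , a * σ x - z , a * (z - (a * σ x - z)) - v - a * (a * σ x - z)
      , σ x * (a * (a * a)) - σ y , σ x * ((σ x * (a * (a * a)) - σ y) - σ y) - σ w)
    κ-nb x y z w v a = quintuple refl refl refl σc
      (trans (σ-- (x * (x * σ a - y - y)) w) (cong (_- σ w) (trans (σ-* x _) (cong (σ x *_) (trans (σ-- _ y) (cong (_- σ y) σc))))))
      where
      σc : σ (x * σ a - y) ≡ σ x * (a * (a * a)) - σ y
      σc = trans (σ-- (x * σ a) y) (cong (_- σ y) (trans (σ-* x (σ a))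
        (cong (σ x *_) (trans (σσ a) (cong (λ z → a * (a * z)) (*-identityʳ a))))))

    π₁ π₂ π₃ π₄ π₅ : Point → Carrier
    π₁ (a , b , g , c , e) = a
    π₂ (a , b , g , c , e) = b
    π₃ (a , b , g , c , e) = g
    π₄ (a , b , g , c , e) = c
    π₅ (a , b , g , c , e) = e

    -- For vectors wⱼ = (mⱼ , βⱼ) summing to 0, with vanishing area ∑_{i<j} det wᵢ wⱼ and vanishing
    -- cubic moments, det w₄ w₀ * det w₀ w₁ = 0.
    pentagon : ∀ a b g c e m₀ β₀ m₁ β₁ m₂ β₂ m₃ β₃ m₄ β₄ → m₄ ≡ - (m₀ + m₁ + m₂ + m₃) → β₄ ≡ - (β₀ + β₁ + β₂ + β₃) →
      move (move (move (move (move (a , b , g , c , e) m₀ β₀) m₁ β₁) m₂ β₂) m₃ β₃) m₄ β₄ ≡ (a , b , g , c , e) →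
      (m₄ * β₀ - m₀ * β₄) * (m₀ * β₁ - m₁ * β₀) ≡ 0#
    pentagon a b g c e m₀ β₀ m₁ β₁ m₂ β₂ m₃ β₃ _ _ refl refl closed = trans
      (solve 8 (λ m₀ m₁ m₂ m₃ b₀ b₁ b₂ b₃ →
        let m₄ = :- (m₀ :+ m₁ :+ m₂ :+ m₃) ; b₄ = :- (b₀ :+ b₁ :+ b₂ :+ b₃)
            S₁ = b₀ :* (m₀ :* m₀) :+ b₁ :* (m₁ :* m₁) :+ b₂ :* (m₂ :* m₂) :+ b₃ :* (m₃ :* m₃) :+ b₄ :* (m₄ :* m₄)
            S₂ = m₀ :* (b₀ :* b₀) :+ m₁ :* (b₁ :* b₁) :+ m₂ :* (b₂ :* b₂) :+ m₃ :* (b₃ :* b₃) :+ m₄ :* (b₄ :* b₄)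
            area = (m₀ :* b₁ :- m₁ :* b₀) :+ (m₀ :* b₂ :- m₂ :* b₀) :+ (m₀ :* b₃ :- m₃ :* b₀)
               :+ (m₁ :* b₂ :- m₂ :* b₁) :+ (m₁ :* b₃ :- m₃ :* b₁) :+ (m₂ :* b₃ :- m₃ :* b₂)
            Q = m₀ :* (b₁ :+ b₂ :+ b₃) :+ m₁ :* (b₂ :+ b₃ :- b₀) :- m₂ :* (b₀ :+ b₁ :+ b₃) :+ m₃ :* (b₂ :- b₀ :- b₁)
        in (m₄ :* b₀ :- m₀ :* b₄) :* (m₀ :* b₁ :- m₁ :* b₀) := (m₂ :+ m₃) :* S₂ :+ (b₂ :+ b₃) :* S₁ :+ Q :* area)
        refl m₀ m₁ m₂ m₃ β₀ β₁ β₂ β₃)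
      (trans (cong₂ (λ u v → (m₂ + m₃) * proj₂ u + (β₂ + β₃) * proj₁ u + (m₀ * (β₁ + β₂ + β₃) + m₁ * (β₂ + β₃ - β₀) - m₂ * (β₀ + β₁ + β₃) + m₃ * (β₂ - β₀ - β₁)) * v)
          (cong₂ _,_ S₁≡0 S₂≡0) area≡0)
        (solve 3 (λ u v w → u :* con 0F :+ v :* con 0F :+ w :* con 0F := con 0F) refl (m₂ + m₃) (β₂ + β₃) (m₀ * (β₁ + β₂ + β₃) + m₁ * (β₂ + β₃ - β₀) - m₂ * (β₀ + β₁ + β₃) + m₃ * (β₂ - β₀ - β₁))))
      where
      m₄ β₄ : Carrier
      m₄ = - (m₀ + m₁ + m₂ + m₃)
      β₄ = - (β₀ + β₁ + β₂ + β₃)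
      S₁≡0 : β₀ * (m₀ * m₀) + β₁ * (m₁ * m₁) + β₂ * (m₂ * m₂) + β₃ * (m₃ * m₃) + β₄ * (m₄ * m₄) ≡ 0#
      S₁≡0 = trans (solve 6 (λ c s₀ s₁ s₂ s₃ s₄ → s₀ :+ s₁ :+ s₂ :+ s₃ :+ s₄ := c :+ s₀ :+ s₁ :+ s₂ :+ s₃ :+ s₄ :- c) refl c (β₀ * (m₀ * m₀)) (β₁ * (m₁ * m₁)) (β₂ * (m₂ * m₂)) (β₃ * (m₃ * m₃)) (β₄ * (m₄ * m₄)))
        (-≡0 (cong π₄ closed))
      S₂≡0 : m₀ * (β₀ * β₀) + m₁ * (β₁ * β₁) + m₂ * (β₂ * β₂) + m₃ * (β₃ * β₃) + m₄ * (β₄ * β₄) ≡ 0#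
      S₂≡0 = trans (solve 6 (λ c s₀ s₁ s₂ s₃ s₄ → s₀ :+ s₁ :+ s₂ :+ s₃ :+ s₄ := c :+ s₀ :+ s₁ :+ s₂ :+ s₃ :+ s₄ :- c) refl e (m₀ * (β₀ * β₀)) (m₁ * (β₁ * β₁)) (m₂ * (β₂ * β₂)) (m₃ * (β₃ * β₃)) (m₄ * (β₄ * β₄)))
        (-≡0 (cong π₅ closed))
      -- The coordinate g adds up the trapezium formula for twice the area of the polygon, which is
      -- the sum of all determinants of two sides.
      area≡0 : (m₀ * β₁ - m₁ * β₀) + (m₀ * β₂ - m₂ * β₀) + (m₀ * β₃ - m₃ * β₀)
               + (m₁ * β₂ - m₂ * β₁) + (m₁ * β₃ - m₃ * β₁) + (m₂ * β₃ - m₃ * β₂) ≡ 0#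
      area≡0 = trans (solve 10 (λ a g m₀ m₁ m₂ m₃ b₀ b₁ b₂ b₃ →
        let m₄ = :- (m₀ :+ m₁ :+ m₂ :+ m₃) ; b₄ = :- (b₀ :+ b₁ :+ b₂ :+ b₃)
            a₁ = a :+ m₀ ; a₂ = a₁ :+ m₁ ; a₃ = a₂ :+ m₂ ; a₄ = a₃ :+ m₃ ; a₅ = a₄ :+ m₄
        in (m₀ :* b₁ :- m₁ :* b₀) :+ (m₀ :* b₂ :- m₂ :* b₀) :+ (m₀ :* b₃ :- m₃ :* b₀)
               :+ (m₁ :* b₂ :- m₂ :* b₁) :+ (m₁ :* b₃ :- m₃ :* b₁) :+ (m₂ :* b₃ :- m₃ :* b₂)
           := g :+ (a :+ a₁) :* b₀ :+ (a₁ :+ a₂) :* b₁ :+ (a₂ :+ a₃) :* b₂ :+ (a₃ :+ a₄) :* b₃ :+ (a₄ :+ a₅) :* b₄ :- g)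
        refl a g m₀ m₁ m₂ m₃ β₀ β₁ β₂ β₃) (-≡0 (cong π₃ closed))

    last-vector : ∀ a m₀ m₁ m₂ m₃ m₄ → a + m₀ + m₁ + m₂ + m₃ + m₄ ≡ a → m₄ ≡ - (m₀ + m₁ + m₂ + m₃)
    last-vector a m₀ m₁ m₂ m₃ m₄ e = ≡-from-≡0 (trans
      (solve 6 (λ a m₀ m₁ m₂ m₃ m₄ → m₄ :- :- (m₀ :+ m₁ :+ m₂ :+ m₃) := a :+ m₀ :+ m₁ :+ m₂ :+ m₃ :+ m₄ :- a) refl a m₀ m₁ m₂ m₃ m₄) (-≡0 e))

    closed-pentagon : ∀ x m₀ β₀ m₁ β₁ m₂ β₂ m₃ β₃ m₄ β₄ →
      move (move (move (move (move x m₀ β₀) m₁ β₁) m₂ β₂) m₃ β₃) m₄ β₄ ≡ x →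
      (m₄ * β₀ - m₀ * β₄) * (m₀ * β₁ - m₁ * β₀) ≡ 0#
    closed-pentagon (a , b , g , c , e) m₀ β₀ m₁ β₁ m₂ β₂ m₃ β₃ m₄ β₄ closed =
      pentagon a b g c e m₀ β₀ m₁ β₁ m₂ β₂ m₃ β₃ m₄ β₄
        (last-vector a m₀ m₁ m₂ m₃ m₄ (cong π₁ closed)) (last-vector b β₀ β₁ β₂ β₃ β₄ (cong π₂ closed)) closed

    move-0 : ∀ x → move x 0# 0# ≡ x
    move-0 (a , b , g , c , e) = quintuple (+-identityʳ a) (+-identityʳ b)
      (solve 2 (λ g a → g :+ a :* con 0F := g) refl g (a + (a + 0#)))
      (solve 1 (λ c → c :+ con 0F :* (con 0F :* con 0F) := c) refl c)
      (solve 1 (λ c → c :+ con 0F :* (con 0F :* con 0F) := c) refl e)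

    det-≢0 : ∀ {t t′ d₁ d₂ e₁ e₂} → t ≢ 0# → t′ ≢ 0# → d₁ * e₂ - e₁ * d₂ ≢ 0# →
             (t * d₁) * (t′ * e₂) - (t′ * e₁) * (t * d₂) ≢ 0#
    det-≢0 {t} {t′} {d₁} {d₂} {e₁} {e₂} t≢0 t′≢0 ne e = nonzero-* (nonzero-* t≢0 t′≢0) ne (trans
      (solve 6 (λ t t′ d₁ d₂ e₁ e₂ → (t :* t′) :* (d₁ :* e₂ :- e₁ :* d₂) := (t :* d₁) :* (t′ :* e₂) :- (t′ :* e₁) :* (t :* d₂)) refl t t′ d₁ d₂ e₁ e₂) e)

    no-pentagon : ∀ {t₀ t₁ t₄ d₀ e₀ d₁ e₁ d₄ e₄} → t₀ ≢ 0# → t₁ ≢ 0# → t₄ ≢ 0# → d₄ * e₀ - d₀ * e₄ ≢ 0# → d₀ * e₁ - d₁ * e₀ ≢ 0# →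
      (((t₄ * d₄) * (t₀ * e₀) - (t₀ * d₀) * (t₄ * e₄)) * ((t₀ * d₀) * (t₁ * e₁) - (t₁ * d₁) * (t₀ * e₀)) ≡ 0#) → ⊥
    no-pentagon t₀ t₁ t₄ ne ne′ = nonzero-* (det-≢0 t₄ t₀ ne) (det-≢0 t₀ t₁ ne′)

    opposite : ∀ {a b m₀ β₀ m₁ β₁} → a + m₀ + m₁ ≡ a → b + β₀ + β₁ ≡ b → m₀ * β₁ - m₁ * β₀ ≡ 0#
    opposite {a} {b} {m₀} {β₀} {m₁} {β₁} e e′ = trans
      (solve 6 (λ a b m₀ β₀ m₁ β₁ → m₀ :* β₁ :- m₁ :* β₀ := m₀ :* (b :+ β₀ :+ β₁ :- b) :- β₀ :* (a :+ m₀ :+ m₁ :- a)) refl a b m₀ β₀ m₁ β₁)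
      (trans (cong₂ (λ u v → m₀ * u - β₀ * v) (-≡0 e′) (-≡0 e)) (solve 2 (λ u v → u :* con 0F :- v :* con 0F := con 0F) refl m₀ β₀))

    -- The first vector is w₀ of the pentagon, its cyclic neighbours are w₁ and w₄. Triangles and
    -- quadrilaterals get zero vectors in the places between these two, so both determinants at w₀
    -- remain nonzero.
    no-W : ∀ x s ss → AllW (s ∷ ss) → cost (s ∷ ss) ≤ 5 → foldl app x (s ∷ ss) ≡ x →
           Bent (direction s) ss (direction s) → ⊥
    no-W x (W t d₁ d₂) [] _ _ _ ne = ne (-‿inverseʳ _)
    no-W (a , b , g , c , e) (W t d₁ d₂) (W t′ e₁ e₂ ∷ []) (t≢0 , t′≢0 , _) _ closed (ne , _) =
      det-≢0 t≢0 t′≢0 ne (opposite (cong π₁ closed) (cong π₂ closed))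
    no-W x (W t₀ _ _) (W t₁ _ _ ∷ W t₄ _ _ ∷ []) (p₀ , p₁ , p₄ , _) _ closed (ne₀₁ , _ , ne₄₀) =
      no-pentagon p₀ p₁ p₄ ne₄₀ ne₀₁ (closed-pentagon x _ _ _ _ 0# 0# 0# 0# _ _
        (trans (cong (λ z → move z _ _) (trans (move-0 _) (move-0 _))) closed))
    no-W x (W t₀ _ _) (W t₁ _ _ ∷ W _ _ _ ∷ W t₄ _ _ ∷ []) (p₀ , p₁ , _ , p₄ , _) _ closed (ne₀₁ , _ , _ , ne₄₀) =
      no-pentagon p₀ p₁ p₄ ne₄₀ ne₀₁ (closed-pentagon x _ _ _ _ _ _ 0# 0# _ _
        (trans (cong (λ z → move z _ _) (move-0 _)) closed))
    no-W x (W t₀ _ _) (W t₁ _ _ ∷ W _ _ _ ∷ W _ _ _ ∷ W t₄ _ _ ∷ []) (p₀ , p₁ , _ , _ , p₄ , _) _ closed (ne₀₁ , _ , _ , _ , ne₄₀) =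
      no-pentagon p₀ p₁ p₄ ne₄₀ ne₀₁ (closed-pentagon x _ _ _ _ _ _ _ _ _ _ closed)
    no-W x (W _ _ _) (W _ _ _ ∷ W _ _ _ ∷ W _ _ _ ∷ W _ _ _ ∷ W _ _ _ ∷ _) _ (s≤s (s≤s (s≤s (s≤s (s≤s ()))))) _ _

    -- The shear (m , β) ↦ (m , β - X m) makes the double step horizontal.
    sheared : ∀ a b g c e X m₁ β₁ m₂ β₂ m₃ β₃ t N → t ≡ - (m₁ + m₂ + m₃) → β₂ ≡ - (β₁ + β₃ + t * X) →
      N ≡ - (β₁ * (m₁ * m₁) + β₂ * (m₂ * m₂) + β₃ * (m₃ * m₃) + t * X * (t * t)) →
      app (move (move (move (a , b , g , c , e) m₁ β₁) m₂ β₂) m₃ β₃) (D t X N) ≡ (a , b , g , c , e) →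
      (β₁ - X * m₁) * (β₃ - X * m₃) * (m₁ + m₂ + m₃) ≡ 0# ∧ (m₁ + m₂ + m₃ ≡ 0# → m₁ * β₂ - m₂ * β₁ ≡ 0#)
    sheared a b g c e X m₁ β₁ m₂ _ m₃ β₃ _ _ refl refl refl closed =
      trans (solve 8 (λ a X m₁ m₂ m₃ β₁ β₃ ge →
        let t = :- (m₁ :+ m₂ :+ m₃) ; β₂ = :- (β₁ :+ β₃ :+ t :* X)
            N = :- (β₁ :* (m₁ :* m₁) :+ β₂ :* (m₂ :* m₂) :+ β₃ :* (m₃ :* m₃) :+ t :* X :* (t :* t))
            a₁ = a :+ m₁ ; a₂ = a₁ :+ m₂ ; a₃ = a₂ :+ m₃ ; a₄ = a₃ :+ t
        in (β₁ :- X :* m₁) :* (β₃ :- X :* m₃) :* (m₁ :+ m₂ :+ m₃) :=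
           (ge :+ m₁ :* (β₁ :* β₁) :+ m₂ :* (β₂ :* β₂) :+ m₃ :* (β₃ :* β₃) :+ (t :* (t :* X :* (t :* X)) :+ (X :* N :+ X :* N)) :- ge)
           :+ ((β₁ :- X :* m₁) :- (β₃ :- X :* m₃)) :*
              (ge :+ (a :+ a₁) :* β₁ :+ (a₁ :+ a₂) :* β₂ :+ (a₂ :+ a₃) :* β₃ :+ (a₃ :+ a₄) :* (t :* X) :- ge))
        refl a X m₁ m₂ m₃ β₁ β₃ 0#)
        (trans (cong₂ (λ u v → u + ((β₁ - X * m₁) - (β₃ - X * m₃)) * v) (rebase e (cong π₅ closed)) (rebase g (cong π₃ closed)))
          (solve 1 (λ u → con 0F :+ u :* con 0F := con 0F) refl ((β₁ - X * m₁) - (β₃ - X * m₃))))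
      , λ m≡0 → trans (solve 7 (λ a X m₁ m₂ m₃ β₁ β₃ →
        let t = :- (m₁ :+ m₂ :+ m₃) ; β₂ = :- (β₁ :+ β₃ :+ t :* X)
            a₁ = a :+ m₁ ; a₂ = a₁ :+ m₂ ; a₃ = a₂ :+ m₃ ; a₄ = a₃ :+ t
        in m₁ :* β₂ :- m₂ :* β₁ :=
           (con 0F :+ (a :+ a₁) :* β₁ :+ (a₁ :+ a₂) :* β₂ :+ (a₂ :+ a₃) :* β₃ :+ (a₃ :+ a₄) :* (t :* X) :- con 0F)
           :+ (m₁ :+ m₂ :+ m₃) :* (X :* m₃ :- β₃))
        refl a X m₁ m₂ m₃ β₁ β₃)
        (trans (cong₂ (λ u v → u + v * (X * m₃ - β₃)) (rebase g (cong π₃ closed)) m≡0) (solve 1 (λ u → con 0F :+ con 0F :* u := con 0F) refl (X * m₃ - β₃)))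
      where
      rebase : ∀ z {s₁ s₂ s₃ s₄} → z + s₁ + s₂ + s₃ + s₄ ≡ z → 0# + s₁ + s₂ + s₃ + s₄ - 0# ≡ 0#
      rebase z {s₁} {s₂} {s₃} {s₄} h = trans (solve 5 (λ z s₁ s₂ s₃ s₄ →
        con 0F :+ s₁ :+ s₂ :+ s₃ :+ s₄ :- con 0F := z :+ s₁ :+ s₂ :+ s₃ :+ s₄ :- z) refl z s₁ s₂ s₃ s₄) (-≡0 h)

    -- The double step is not parallel to its neighbours, so the product in `sheared` can vanish
    -- only through its last factor. This makes t = 0, and the two steps after the double one become
    -- parallel.
    closed-sheared : ∀ x X m₁ β₁ m₂ β₂ m₃ β₃ t N →
      app (move (move (move x m₁ β₁) m₂ β₂) m₃ β₃) (D t X N) ≡ x → β₁ - X * m₁ ≢ 0# → β₃ - X * m₃ ≢ 0# →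
      m₁ + m₂ + m₃ ≡ 0# ∧ m₁ * β₂ - m₂ * β₁ ≡ 0#
    closed-sheared (a , b , g , c , e) X m₁ β₁ m₂ β₂ m₃ β₃ t N closed ne₁ ne₃ = m≡0 , proj₂ both m≡0
      where
      last-of-four : ∀ z s₁ s₂ s₃ s₄ → z + s₁ + s₂ + s₃ + s₄ ≡ z → s₄ ≡ - (s₁ + s₂ + s₃)
      last-of-four z s₁ s₂ s₃ s₄ h = ≡-from-≡0 (trans
        (solve 5 (λ z s₁ s₂ s₃ s₄ → s₄ :- :- (s₁ :+ s₂ :+ s₃) := z :+ s₁ :+ s₂ :+ s₃ :+ s₄ :- z) refl z s₁ s₂ s₃ s₄) (-≡0 h))
      second-of-four : ∀ z s₁ s₂ s₃ s₄ → z + s₁ + s₂ + s₃ + s₄ ≡ z → s₂ ≡ - (s₁ + s₃ + s₄)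
      second-of-four z s₁ s₂ s₃ s₄ h = last-of-four z s₁ s₃ s₄ s₂ (trans
        (solve 5 (λ z s₁ s₂ s₃ s₄ → z :+ s₁ :+ s₃ :+ s₄ :+ s₂ := z :+ s₁ :+ s₂ :+ s₃ :+ s₄) refl z s₁ s₂ s₃ s₄) h)
      split-last : ∀ z s₁ s₂ s₃ s₄ n → z + s₁ + s₂ + s₃ + (s₄ + n) ≡ z → n ≡ - (s₁ + s₂ + s₃ + s₄)
      split-last z s₁ s₂ s₃ s₄ n h = ≡-from-≡0 (trans
        (solve 6 (λ z s₁ s₂ s₃ s₄ n → n :- :- (s₁ :+ s₂ :+ s₃ :+ s₄) := z :+ s₁ :+ s₂ :+ s₃ :+ (s₄ :+ n) :- z) refl z s₁ s₂ s₃ s₄ n) (-≡0 h))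
      both = sheared a b g c e X m₁ β₁ m₂ β₂ m₃ β₃ t N (last-of-four a m₁ m₂ m₃ t (cong π₁ closed))
        (second-of-four b β₁ β₂ β₃ (t * X) (cong π₂ closed))
        (split-last c (β₁ * (m₁ * m₁)) (β₂ * (m₂ * m₂)) (β₃ * (m₃ * m₃)) (t * X * (t * t)) N (cong π₄ closed)) closed
      m≡0 : m₁ + m₂ + m₃ ≡ 0#
      m≡0 = cancel-nonzero (proj₁ both) (nonzero-* ne₁ ne₃)

    slanted : ∀ {u d₁ d₂ X} → u ≢ 0# → 1# * d₂ - d₁ * X ≢ 0# → u * d₂ - X * (u * d₁) ≢ 0#
    slanted {u} {d₁} {d₂} {X} u≢0 ne z = nonzero-* u≢0 ne (trans
      (solve 4 (λ u d₁ d₂ X → u :* (con 1F :* d₂ :- d₁ :* X) := u :* d₂ :- X :* (u :* d₁)) refl u d₁ d₂ X) z)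

    slanted′ : ∀ {u d₁ d₂ X} → u ≢ 0# → d₁ * X - 1# * d₂ ≢ 0# → u * d₂ - X * (u * d₁) ≢ 0#
    slanted′ {u} {d₁} {d₂} {X} u≢0 ne z = nonzero-* u≢0 ne (trans
      (solve 4 (λ u d₁ d₂ X → u :* (d₁ :* X :- con 1F :* d₂) := :- (u :* d₂ :- X :* (u :* d₁))) refl u d₁ d₂ X)
      (trans (cong (λ w → - w) z) (solve 0 (:- con 0F := con 0F) refl)))

    third : ∀ {z s₁ s₂ s₃} → z + s₁ + s₂ + s₃ ≡ z → s₁ + s₂ + s₃ ≡ 0#
    third {z} {s₁} {s₂} {s₃} h = trans (solve 4 (λ z s₁ s₂ s₃ → s₁ :+ s₂ :+ s₃ := z :+ s₁ :+ s₂ :+ s₃ :- z) refl z s₁ s₂ s₃) (-≡0 h)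

    -- Two double steps and a single one close up to a triangle, whose area, up to sign t₁ t (x₁ -
    -- X), has to vanish. So t₁ or t is 0, and the single step is parallel to the other double step,
    -- against the bends. `s` is the sign given by the order of the steps.
    two-doubles : ∀ {t₁ x₁ t X m β G s} → t₁ + m + t ≡ 0# → t₁ * x₁ + β + t * X ≡ 0# → x₁ - X ≢ 0# →
      β - x₁ * m ≢ 0# → β - X * m ≢ 0# → G ≡ 0# → s * (t₁ * t * (x₁ - X)) ≡ G → s ≢ 0# → ⊥
    two-doubles {t₁} {x₁} {t} {X} {m} {β} e₁ e₂ ne ne₁ ne₂ G≡0 eq s≢0 =
      nonzero-* s≢0 (nonzero-* (nonzero-* (λ z → ne₂ (vanish₁ z)) (λ z → ne₁ (vanish z))) ne) (trans eq G≡0)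
      where
      vanish : t ≡ 0# → β - x₁ * m ≡ 0#
      vanish z = trans (solve 6 (λ t₁ x₁ t X m β → β :- x₁ :* m := (t₁ :* x₁ :+ β :+ t :* X) :- x₁ :* (t₁ :+ m :+ t) :+ t :* (x₁ :- X)) refl t₁ x₁ t X m β)
        (trans (cong₂ _+_ (cong₂ (λ u v → u - x₁ * v) e₂ e₁) (cong (_* (x₁ - X)) z))
          (solve 2 (λ u v → con 0F :- u :* con 0F :+ con 0F :* v := con 0F) refl x₁ (x₁ - X)))
      vanish₁ : t₁ ≡ 0# → β - X * m ≡ 0#
      vanish₁ z = trans (solve 6 (λ t₁ x₁ t X m β → β :- X :* m := (t₁ :* x₁ :+ β :+ t :* X) :- X :* (t₁ :+ m :+ t) :- t₁ :* (x₁ :- X)) refl t₁ x₁ t X m β)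
        (trans (cong₂ _-_ (cong₂ (λ u v → u - X * v) e₂ e₁) (cong (_* (x₁ - X)) z))
          (solve 2 (λ u v → con 0F :- u :* con 0F :- con 0F :* v := con 0F) refl X (x₁ - X)))

    DWD-area : ∀ a g t₁ x₁ t X m β → t₁ + m + t ≡ 0# → t₁ * x₁ + β + t * X ≡ 0# → 1# * (t₁ * t * (x₁ - X)) ≡
      g + (a + (a + t₁)) * (t₁ * x₁) + (a + t₁ + (a + t₁ + m)) * β + (a + t₁ + m + (a + t₁ + m + t)) * (t * X) - g
    DWD-area a g t₁ x₁ t X m β e₁ e₂ = ≡-from-≡0 (trans
      (solve 8 (λ a g t₁ x₁ t X m β → con 1F :* (t₁ :* t :* (x₁ :- X)) :-
         (g :+ (a :+ (a :+ t₁)) :* (t₁ :* x₁) :+ (a :+ t₁ :+ (a :+ t₁ :+ m)) :* β :+ (a :+ t₁ :+ m :+ (a :+ t₁ :+ m :+ t)) :* (t :* X) :- g)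
         := (t₁ :+ m :+ t) :* (t₁ :* x₁ :- t :* X) :+ (a :+ t₁ :- m) :* (t₁ :* x₁ :+ β :+ t :* X)) refl a g t₁ x₁ t X m β)
      (trans (cong₂ (λ u v → u * (t₁ * x₁ - t * X) + (a + t₁ - m) * v) e₁ e₂)
        (solve 2 (λ u v → con 0F :* u :+ v :* con 0F := con 0F) refl (t₁ * x₁ - t * X) (a + t₁ - m))))

    WDD-area : ∀ a g t₁ x₁ t X m β → t₁ + m + t ≡ 0# → t₁ * x₁ + β + t * X ≡ 0# → - 1# * (t₁ * t * (x₁ - X)) ≡
      g + (a + (a + m)) * β + (a + m + (a + m + t₁)) * (t₁ * x₁) + (a + m + t₁ + (a + m + t₁ + t)) * (t * X) - g
    WDD-area a g t₁ x₁ t X m β e₁ e₂ = ≡-from-≡0 (trans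
      (solve 8 (λ a g t₁ x₁ t X m β → :- con 1F :* (t₁ :* t :* (x₁ :- X)) :-
         (g :+ (a :+ (a :+ m)) :* β :+ (a :+ m :+ (a :+ m :+ t₁)) :* (t₁ :* x₁) :+ (a :+ m :+ t₁ :+ (a :+ m :+ t₁ :+ t)) :* (t :* X) :- g)
         := (t₁ :+ m :+ t) :* (:- (t₁ :* x₁) :- t :* X) :+ (a :- m) :* (t₁ :* x₁ :+ β :+ t :* X)) refl a g t₁ x₁ t X m β)
      (trans (cong₂ (λ u v → u * (- (t₁ * x₁) - t * X) + (a - m) * v) e₁ e₂)
        (solve 2 (λ u v → con 0F :* u :+ v :* con 0F := con 0F) refl (- (t₁ * x₁) - t * X) (a - m))))

    -1≢0 : - 1# ≢ 0#
    -1≢0 e = 1≢0 (trans (solve 0 (con 1F := :- (:- con 1F)) refl) (trans (cong (λ w → - w) e) (solve 0 (:- con 0F := con 0F) refl)))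

    slope-differs : ∀ {x₁ X} → 1# * x₁ - 1# * X ≢ 0# → x₁ - X ≢ 0#
    slope-differs {x₁} {X} ne e = ne (trans (cong₂ _-_ (*-identityˡ x₁) (*-identityˡ X)) e)

    slope-differs′ : ∀ {x₁ X} → 1# * X - 1# * x₁ ≢ 0# → x₁ - X ≢ 0#
    slope-differs′ {x₁} {X} ne e = ne (-≡0 (cong (1# *_) (sym (≡-from-≡0 e))))

    -- With t₁ = t = 0 only the parts with `N` remain: N₁ + N = 0 and 2 (x₁ N₁ + X N) = 0.
    DD-absurd : ∀ {c e x₁ N₁ X N t₁ t} → t₁ ≡ 0# → t ≡ 0# → c + (t₁ * x₁ * (t₁ * t₁) + N₁) + (t * X * (t * t) + N) ≡ c →
      e + (t₁ * (t₁ * x₁ * (t₁ * x₁)) + (x₁ * N₁ + x₁ * N₁)) + (t * (t * X * (t * X)) + (X * N + X * N)) ≡ e → N * (x₁ - X) ≡ 0#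
    DD-absurd {c} {e} {x₁} {N₁} {X} {N} refl refl ec ee = trans
      (solve 6 (λ c e x₁ N₁ X N → N :* (x₁ :- X) :=
        (e :+ (con 0F :* (con 0F :* x₁ :* (con 0F :* x₁)) :+ (x₁ :* N₁ :+ x₁ :* N₁)) :+ (con 0F :* (con 0F :* X :* (con 0F :* X)) :+ (X :* N :+ X :* N)) :- e)
        :+ x₁ :* (c :+ (con 0F :* x₁ :* (con 0F :* con 0F) :+ N₁) :+ (con 0F :* X :* (con 0F :* con 0F) :+ N) :- c)) refl c e x₁ N₁ X N)
      (trans (cong₂ (λ u v → u + x₁ * v) (-≡0 ee) (-≡0 ec)) (solve 1 (λ u → con 0F :+ u :* con 0F := con 0F) refl x₁))

    -- Within cost 5 the final double step leaves 3 for `ss`: at most three single steps, or a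
    -- double step with at most one single step before or after it.
    no-D : ∀ x t e N ss → N ≢ 0# → AllValid ss → suc (suc (cost ss)) ≤ 5 →
           app (foldl app x ss) (D t e N) ≡ x → Bent (1# , e) ss (1# , e) → ⊥
    no-D _ t e N [] _ _ _ _ ne = ne (-‿inverseʳ _)
    no-D (a , b , g , c , e) t X N (W u d₁ d₂ ∷ []) _ (u≢0 , _) _ closed (ne , _) = slanted u≢0 ne (trans
      (solve 6 (λ a b t X m β → β :- X :* m := (b :+ β :+ t :* X :- b) :- X :* (a :+ m :+ t :- a)) refl a b t X (u * d₁) (u * d₂))
      (trans (cong₂ (λ p q → p - X * q) (-≡0 (cong π₂ closed)) (-≡0 (cong π₁ closed)))
        (solve 1 (λ x → con 0F :- x :* con 0F := con 0F) refl X)))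
    no-D x@(a , b , g , c , e) t X N (W u d₁ d₂ ∷ W u′ e₁ e₂ ∷ []) _ (u≢0 , u′≢0 , _) _ closed (ne , ne₁₂ , ne′) =
      -- With a zero vector in the middle, `closed-sheared` is used for t = 0 only; the two single
      -- steps are then opposite vectors.
      det-≢0 u≢0 u′≢0 ne₁₂ (trans
        (solve 6 (λ b μ β μ′ β′ s → μ :* β′ :- μ′ :* β := μ :* (b :+ β :+ β′ :+ s :- b) :- β :* (μ :+ con 0F :+ μ′) :- μ :* s) refl b μ β μ′ β′ (t * X))
        (trans (cong₂ (λ p q → μ * p - β * q - μ * (t * X)) (-≡0 (cong π₂ closed)) μ≡0)
          (trans (cong (λ z → μ * 0# - β * 0# - μ * (z * X)) t≡0)
            (solve 3 (λ μ β X → μ :* con 0F :- β :* con 0F :- μ :* (con 0F :* X) := con 0F) refl μ β X))))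
      where
      μ β μ′ β′ : Carrier
      μ = u * d₁
      β = u * d₂
      μ′ = u′ * e₁
      β′ = u′ * e₂
      μ≡0 : μ + 0# + μ′ ≡ 0#
      μ≡0 = proj₁ (closed-sheared x X μ β 0# 0# μ′ β′ t N
        (trans (cong (λ z → app (move z _ _) (D t X N)) (move-0 _)) closed) (slanted u≢0 ne) (slanted′ u′≢0 ne′))
      t≡0 : t ≡ 0#
      t≡0 = trans (solve 4 (λ a μ μ′ t → t := (a :+ μ :+ μ′ :+ t :- a) :- (μ :+ con 0F :+ μ′)) refl a μ μ′ t)
        (trans (cong₂ _-_ (-≡0 (cong π₁ closed)) μ≡0) (solve 0 (con 0F :- con 0F := con 0F) refl))
    no-D x t X N (W u d₁ d₂ ∷ W u′ e₁ e₂ ∷ W u″ f₁ f₂ ∷ []) _ (u≢0 , u′≢0 , u″≢0 , _) _ closed (ne , ne₁₂ , _ , ne′) =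
      det-≢0 u≢0 u′≢0 ne₁₂ (proj₂ (closed-sheared x X _ _ _ _ _ _ t N closed (slanted u≢0 ne) (slanted′ u″≢0 ne′)))
    no-D (a , b , g , c , e) t X N (D t₁ x₁ N₁ ∷ []) N≢0 _ _ closed (ne , _) =
      nonzero-* N≢0 (slope-differs ne) (DD-absurd t₁≡0 t≡0 (cong π₄ closed) (cong π₅ closed))
      where
      t₁≡0 : t₁ ≡ 0#
      t₁≡0 = cancel-nonzero (trans
        (solve 6 (λ a b t X t₁ x₁ → (x₁ :- X) :* t₁ := (b :+ t₁ :* x₁ :+ t :* X :- b) :- X :* (a :+ t₁ :+ t :- a)) refl a b t X t₁ x₁)
        (trans (cong₂ (λ p q → p - X * q) (-≡0 (cong π₂ closed)) (-≡0 (cong π₁ closed)))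
          (solve 1 (λ x → con 0F :- x :* con 0F := con 0F) refl X))) (slope-differs ne)
      t≡0 : t ≡ 0#
      t≡0 = trans (solve 3 (λ a t₁ t → t := (a :+ t₁ :+ t :- a) :- t₁) refl a t₁ t)
        (trans (cong₂ _-_ (-≡0 (cong π₁ closed)) t₁≡0) (solve 0 (con 0F :- con 0F := con 0F) refl))
    no-D (a , b , g , c , e) t X N (D t₁ x₁ N₁ ∷ W u d₁ d₂ ∷ []) _ (_ , u≢0 , _) _ closed (ne , ne₁ , ne₂) =
      two-doubles e₁ e₂ (slope-differs ne) (slanted u≢0 ne₁) (slanted′ u≢0 ne₂) (-≡0 (cong π₃ closed))
        (DWD-area a g t₁ x₁ t X (u * d₁) (u * d₂) e₁ e₂) 1≢0
      where
      e₁ = third (cong π₁ closed)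
      e₂ = third (cong π₂ closed)
    no-D (a , b , g , c , e) t X N (W u d₁ d₂ ∷ D t₁ x₁ N₁ ∷ []) _ (u≢0 , _) _ closed (ne , ne₁ , ne₂) =
      two-doubles e₁ e₂ (slope-differs′ ne₂) (slanted′ u≢0 ne₁) (slanted u≢0 ne) (-≡0 (cong π₃ closed))
        (WDD-area a g t₁ x₁ t X (u * d₁) (u * d₂) e₁ e₂) -1≢0
      where
      swap₁₂ : ∀ {x y z} → x + y + z ≡ 0# → y + x + z ≡ 0#
      swap₁₂ {x} {y} {z} h = trans (cong (_+ z) (+-comm y x)) h
      e₁ = swap₁₂ (third (cong π₁ closed))
      e₂ = swap₁₂ (third (cong π₂ closed))
    no-D _ _ _ _ (W _ _ _ ∷ W _ _ _ ∷ W _ _ _ ∷ W _ _ _ ∷ _) _ _ (s≤s (s≤s (s≤s (s≤s (s≤s ()))))) _ _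
    no-D _ _ _ _ (W _ _ _ ∷ W _ _ _ ∷ W _ _ _ ∷ D _ _ _ ∷ _) _ _ (s≤s (s≤s (s≤s (s≤s (s≤s ()))))) _ _
    no-D _ _ _ _ (W _ _ _ ∷ W _ _ _ ∷ D _ _ _ ∷ _) _ _ (s≤s (s≤s (s≤s (s≤s (s≤s ()))))) _ _
    no-D _ _ _ _ (W _ _ _ ∷ D _ _ _ ∷ W _ _ _ ∷ _) _ _ (s≤s (s≤s (s≤s (s≤s (s≤s ()))))) _ _
    no-D _ _ _ _ (W _ _ _ ∷ D _ _ _ ∷ D _ _ _ ∷ _) _ _ (s≤s (s≤s (s≤s (s≤s (s≤s ()))))) _ _
    no-D _ _ _ _ (D _ _ _ ∷ W _ _ _ ∷ W _ _ _ ∷ _) _ _ (s≤s (s≤s (s≤s (s≤s (s≤s ()))))) _ _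
    no-D _ _ _ _ (D _ _ _ ∷ W _ _ _ ∷ D _ _ _ ∷ _) _ _ (s≤s (s≤s (s≤s (s≤s (s≤s ()))))) _ _
    no-D _ _ _ _ (D _ _ _ ∷ D _ _ _ ∷ _) _ _ (s≤s (s≤s (s≤s (s≤s (s≤s ()))))) _ _

    nb-involutive : ∀ u x → nb (nb u x) (head u) ≡ u
    nb-involutive (a ∷ b ∷ c ∷ d ∷ e ∷ []) x = begin
      a ∷ b′ ∷ c′ ∷ d′ ∷ e′ ∷ [] ≡⟨ cong₂ (λ β γ → a ∷ β ∷ γ ∷ a * ((a * σ x - b) - β) - (a * ((a * σ x - b) - b) - d)
                                                         ∷ x * (γ - (x * σ a - c)) - (x * (c - (x * σ a - c)) - e) ∷ []) (undo (a * σ x) b) (undo (x * σ a) c) ⟩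
      a ∷ b ∷ c ∷ a * ((a * σ x - b) - b) - (a * ((a * σ x - b) - b) - d) ∷ x * (c - (x * σ a - c)) - (x * (c - (x * σ a - c)) - e) ∷ []
                                     ≡⟨ cong₂ (λ δ ε → a ∷ b ∷ c ∷ δ ∷ ε ∷ []) (undo _ d) (undo _ e) ⟩
      a ∷ b ∷ c ∷ d ∷ e ∷ [] ∎
      where
      open ≡-Reasoning
      undo : ∀ p b → p - (p - b) ≡ b
      undo = solve 2 (λ p b → p :- (p :- b) := b) refl
      b′ c′ d′ e′ : Carrier
      b′ = a * σ x - (a * σ x - b)
      c′ = x * σ a - (x * σ a - c)
      d′ = a * ((a * σ x - b) - b′) - (a * ((a * σ x - b) - b) - d)
      e′ = x * (c′ - (x * σ a - c)) - (x * (c - (x * σ a - c)) - e)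

    loop-determined : ∀ a b c d e → nb (a ∷ b ∷ c ∷ d ∷ e ∷ []) a ≡ a ∷ b ∷ c ∷ d ∷ e ∷ [] →
                      c ≡ a * σ a - b ∧ e ≡ a * ((a * σ a - b) - b) - d
    loop-determined a b c d e h = sym (∷-injectiveˡ (∷-injectiveʳ (∷-injectiveʳ h)))
      , sym (∷-injectiveˡ (∷-injectiveʳ (∷-injectiveʳ (∷-injectiveʳ (∷-injectiveʳ h)))))

    geometry : Geometry R 4
    geometry = record
      { nb = nb
      ; head-nb = λ { (a ∷ b ∷ c ∷ d ∷ e ∷ []) x → refl }
      ; nb-involutive = nb-involutive
      ; inf = λ { (a ∷ b ∷ c ∷ d ∷ e ∷ []) → a ∷ c ∷ d ∷ e ∷ [] }
      ; slope = σ
      ; slope-injective = σ-injective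
      ; Coords = Point
      ; κ = κ
      ; app = app
      ; finite-line = λ { (x ∷ y ∷ z ∷ w ∷ v ∷ []) a a′ → trans (κ-nb x y z w v a′) (trans (quintuple
          (solve 2 (λ a a′ → a′ := a :+ (a′ :- a) :* con 1F) refl a a′)
          (solve 4 (λ X z a a′ → a′ :* X :- z := (a :* X :- z) :+ (a′ :- a) :* X) refl (σ x) z a a′)
          (solve 5 (λ X z v a a′ → a′ :* (z :- (a′ :* X :- z)) :- v :- a′ :* (a′ :* X :- z) :=
            (a :* (z :- (a :* X :- z)) :- v :- a :* (a :* X :- z)) :+ (a :+ (a :+ (a′ :- a) :* con 1F)) :* ((a′ :- a) :* X)) refl (σ x) z v a a′)
          (solve 4 (λ X Y a a′ → X :* (a′ :* (a′ :* a′)) :- Y := (X :* (a :* (a :* a)) :- Y)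
            :+ ((a′ :- a) :* X) :* (((a′ :- a) :* con 1F) :* ((a′ :- a) :* con 1F))) refl (σ x) (σ y) a a′)
          (solve 5 (λ X Y V a a′ → X :* ((X :* (a′ :* (a′ :* a′)) :- Y) :- Y) :- V := (X :* ((X :* (a :* (a :* a)) :- Y) :- Y) :- V)
            :+ ((a′ :- a) :* con 1F) :* (((a′ :- a) :* X) :* ((a′ :- a) :* X))) refl (σ x) (σ y) (σ w) a a′))
          (cong (λ p → app p (W (a′ - a) 1# (σ x))) (sym (κ-nb x y z w v a)))) }
      ; infinite-line = λ { (a ∷ b ∷ c ∷ d ∷ e ∷ []) (a′ ∷ b′ ∷ c′ ∷ d′ ∷ e′ ∷ []) refl ne → b′ - b
          , (λ z → ne (cong (λ u → a ∷ u ∷ c ∷ d ∷ e ∷ []) (sym (≡-from-≡0 z))))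
          , quintuple (solve 2 (λ a t → a := a :+ t :* con 0F) refl a (b′ - b))
              (solve 2 (λ b b′ → b′ := b :+ (b′ :- b) :* con 1F) refl b b′)
              (solve 4 (λ a b b′ d → d :- a :* b′ := (d :- a :* b) :+ (a :+ (a :+ (b′ :- b) :* con 0F)) :* ((b′ :- b) :* con 1F)) refl a b b′ d)
              (solve 2 (λ c t → c := c :+ (t :* con 1F) :* ((t :* con 0F) :* (t :* con 0F))) refl (σ c) (b′ - b))
              (solve 2 (λ c t → c := c :+ (t :* con 0F) :* ((t :* con 1F) :* (t :* con 1F))) refl (σ e) (b′ - b)) }
      ; double-line = λ { (x ∷ y ∷ z ∷ w ∷ v ∷ []) (x′ ∷ y′ ∷ z′ ∷ w′ ∷ v′ ∷ []) a a′ refl ne → refl , σ y - σ y′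
          , (λ h → ne (cong (λ u → x ∷ u ∷ z ∷ w ∷ v ∷ []) (σ-injective (≡-from-≡0 h))))
          , trans (κ-nb x y′ z w v a′) (trans (quintuple
              (solve 2 (λ a a′ → a′ := a :+ (a′ :- a)) refl a a′)
              (solve 4 (λ X z a a′ → a′ :* X :- z := (a :* X :- z) :+ (a′ :- a) :* X) refl (σ x) z a a′)
              (solve 5 (λ X z v a a′ → a′ :* (z :- (a′ :* X :- z)) :- v :- a′ :* (a′ :* X :- z) :=
                (a :* (z :- (a :* X :- z)) :- v :- a :* (a :* X :- z)) :+ (a :+ (a :+ (a′ :- a))) :* ((a′ :- a) :* X)) refl (σ x) z v a a′)
              (solve 5 (λ X Y Y′ a a′ → X :* (a′ :* (a′ :* a′)) :- Y′ := (X :* (a :* (a :* a)) :- Y)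
                :+ ((a′ :- a) :* X :* ((a′ :- a) :* (a′ :- a)) :+ (Y :- Y′))) refl (σ x) (σ y) (σ y′) a a′)
              (solve 6 (λ X Y Y′ V a a′ → X :* ((X :* (a′ :* (a′ :* a′)) :- Y′) :- Y′) :- V := (X :* ((X :* (a :* (a :* a)) :- Y) :- Y) :- V)
                :+ ((a′ :- a) :* ((a′ :- a) :* X :* ((a′ :- a) :* X)) :+ (X :* (Y :- Y′) :+ X :* (Y :- Y′)))) refl (σ x) (σ y) (σ y′) (σ w) a a′))
              (cong (λ p → app p (D (a′ - a) (σ x) (σ y - σ y′))) (sym (κ-nb x y z w v a)))) }
      ; no-W = no-W
      ; no-D = no-D
      -- Three coordinates determine a loop; `0#` fills up the length.
      ; loopKey = λ { (a ∷ b ∷ c ∷ d ∷ e ∷ []) → a ∷ b ∷ d ∷ 0# ∷ [] }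
      ; loopKey-injective = λ { (a ∷ b ∷ c ∷ d ∷ e ∷ []) (a′ ∷ b′ ∷ c′ ∷ d′ ∷ e′ ∷ []) h h′ refl →
          let (c≡ , e≡) = loop-determined a b c d e h ; (c′≡ , e′≡) = loop-determined a b c′ d e′ h′ in
          cong₂ (λ γ ε → a ∷ b ∷ γ ∷ d ∷ ε ∷ []) (trans c≡ (sym c′≡)) (trans e≡ (sym e′≡)) }
      }

-- Clearing denominators in the two bounds

module ClearedBounds where
  open import Defs using (ℕtoℚ; posQ; invPosQ; midTerm; half; upperAt; lowerAt; _^ℚ_)
  open import Data.Nat as ℕ using (ℕ; zero; suc)
  import Data.Nat.Properties as ℕ
  open import Data.Integer as ℤ using (ℤ; +_)
  import Data.Integer.Properties as ℤ
  open import Data.Rational as ℚ using (ℚ; toℚᵘ; fromℚᵘ)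
  import Data.Rational.Properties as ℚ
  open import Data.Rational.Unnormalised as ℚᵘ using (mkℚᵘ; *≡*; *≤*)
  import Data.Rational.Unnormalised.Properties as ℚᵘ
  open import Data.Rational.Solver using (module +-*-Solver)
  open import Relation.Binary.PropositionalEquality

  frac-cancel : ∀ a b → + a ℚ./ suc b ℚ.* ℕtoℚ (suc b) ≡ ℕtoℚ a
  frac-cancel a b = ℚ.toℚᵘ-injective (begin
    toℚᵘ (fromℚᵘ (mkℚᵘ (+ a) b) ℚ.* fromℚᵘ (mkℚᵘ (+ suc b) 0))
      ≈⟨ ℚ.toℚᵘ-homo-* (fromℚᵘ (mkℚᵘ (+ a) b)) (fromℚᵘ (mkℚᵘ (+ suc b) 0)) ⟩
    toℚᵘ (fromℚᵘ (mkℚᵘ (+ a) b)) ℚᵘ.* toℚᵘ (fromℚᵘ (mkℚᵘ (+ suc b) 0))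
      ≈⟨ ℚᵘ.*-cong (ℚ.toℚᵘ-fromℚᵘ (mkℚᵘ (+ a) b)) (ℚ.toℚᵘ-fromℚᵘ (mkℚᵘ (+ suc b) 0)) ⟩
    mkℚᵘ (+ a) b ℚᵘ.* mkℚᵘ (+ suc b) 0
      ≈⟨ *≡* (ℤ.*-assoc (+ a) (+ suc b) (+ 1)) ⟩
    mkℚᵘ (+ a) 0
      ≈⟨ ℚ.toℚᵘ-fromℚᵘ (mkℚᵘ (+ a) 0) ⟨
    toℚᵘ (fromℚᵘ (mkℚᵘ (+ a) 0)) ∎)
    where
    open ℚᵘ.≃-Reasoning

  ℕtoℚ-+ : ∀ a b → ℕtoℚ (a ℕ.+ b) ≡ ℕtoℚ a ℚ.+ ℕtoℚ b
  ℕtoℚ-+ a b = ℚ.toℚᵘ-injective (begin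
    toℚᵘ (fromℚᵘ (mkℚᵘ (+ (a ℕ.+ b)) 0)) ≈⟨ ℚ.toℚᵘ-fromℚᵘ (mkℚᵘ (+ (a ℕ.+ b)) 0) ⟩
    mkℚᵘ (+ (a ℕ.+ b)) 0 ≈⟨ *≡* (cong (ℤ._* + 1) (cong₂ ℤ._+_ (sym (ℤ.*-identityʳ (+ a))) (sym (ℤ.*-identityʳ (+ b))))) ⟩
    mkℚᵘ (+ a) 0 ℚᵘ.+ mkℚᵘ (+ b) 0
      ≈⟨ ℚᵘ.+-cong (ℚ.toℚᵘ-fromℚᵘ (mkℚᵘ (+ a) 0)) (ℚ.toℚᵘ-fromℚᵘ (mkℚᵘ (+ b) 0)) ⟨
    toℚᵘ (ℕtoℚ a) ℚᵘ.+ toℚᵘ (ℕtoℚ b) ≈⟨ ℚ.toℚᵘ-homo-+ (ℕtoℚ a) (ℕtoℚ b) ⟨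
    toℚᵘ (ℕtoℚ a ℚ.+ ℕtoℚ b) ∎)
    where
    open ℚᵘ.≃-Reasoning

  ℕtoℚ-* : ∀ a b → ℕtoℚ (a ℕ.* b) ≡ ℕtoℚ a ℚ.* ℕtoℚ b
  ℕtoℚ-* a b = ℚ.toℚᵘ-injective (begin
    toℚᵘ (fromℚᵘ (mkℚᵘ (+ (a ℕ.* b)) 0)) ≈⟨ ℚ.toℚᵘ-fromℚᵘ (mkℚᵘ (+ (a ℕ.* b)) 0) ⟩
    mkℚᵘ (+ (a ℕ.* b)) 0 ≈⟨ *≡* (cong (ℤ._* + 1) (ℤ.pos-* a b)) ⟩
    mkℚᵘ (+ a) 0 ℚᵘ.* mkℚᵘ (+ b) 0
      ≈⟨ ℚᵘ.*-cong (ℚ.toℚᵘ-fromℚᵘ (mkℚᵘ (+ a) 0)) (ℚ.toℚᵘ-fromℚᵘ (mkℚᵘ (+ b) 0)) ⟨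
    toℚᵘ (ℕtoℚ a) ℚᵘ.* toℚᵘ (ℕtoℚ b) ≈⟨ ℚ.toℚᵘ-homo-* (ℕtoℚ a) (ℕtoℚ b) ⟨
    toℚᵘ (ℕtoℚ a ℚ.* ℕtoℚ b) ∎)
    where
    open ℚᵘ.≃-Reasoning

  ℕtoℚ-mono-≤ : ∀ {a b} → a ℕ.≤ b → ℕtoℚ a ℚ.≤ ℕtoℚ b
  ℕtoℚ-mono-≤ {a} {b} a≤b = ℚ.toℚᵘ-cancel-≤ (begin
    toℚᵘ (ℕtoℚ a) ≃⟨ ℚ.toℚᵘ-fromℚᵘ (mkℚᵘ (+ a) 0) ⟩
    mkℚᵘ (+ a) 0 ≤⟨ *≤* (ℤ.*-monoʳ-≤-nonNeg (+ 1) (ℤ.+≤+ a≤b)) ⟩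
    mkℚᵘ (+ b) 0 ≃⟨ ℚ.toℚᵘ-fromℚᵘ (mkℚᵘ (+ b) 0) ⟨
    toℚᵘ (ℕtoℚ b) ∎)
    where
    open ℚᵘ.≤-Reasoning

  ℕtoℚ-cancel-≤ : ∀ {a b} → ℕtoℚ a ℚ.≤ ℕtoℚ b → a ℕ.≤ b
  ℕtoℚ-cancel-≤ {a} {b} le = unwrap (begin
    mkℚᵘ (+ a) 0 ≃⟨ ℚ.toℚᵘ-fromℚᵘ (mkℚᵘ (+ a) 0) ⟨
    toℚᵘ (ℕtoℚ a) ≤⟨ ℚ.toℚᵘ-mono-≤ le ⟩
    toℚᵘ (ℕtoℚ b) ≃⟨ ℚ.toℚᵘ-fromℚᵘ (mkℚᵘ (+ b) 0) ⟩
    mkℚᵘ (+ b) 0 ∎)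
    where
    open ℚᵘ.≤-Reasoning
    unwrap : mkℚᵘ (+ a) 0 ℚᵘ.≤ mkℚᵘ (+ b) 0 → a ℕ.≤ b
    unwrap (*≤* h) = ℤ.drop‿+≤+ (subst₂ ℤ._≤_ (ℤ.*-identityʳ (+ a)) (ℤ.*-identityʳ (+ b)) h)

  ℕtoℚ-positive : ∀ a → ℚ.Positive (ℕtoℚ (suc a))
  ℕtoℚ-positive a = ℚ.positive (ℚ.toℚᵘ-cancel-< (begin-strict
    ℚᵘ.0ℚᵘ ≃⟨ *≡* refl ⟩
    mkℚᵘ (+ 0) 0 <⟨ ℚᵘ.*<* (ℤ.+<+ (ℕ.s≤s ℕ.z≤n)) ⟩
    mkℚᵘ (+ suc a) 0 ≃⟨ ℚ.toℚᵘ-fromℚᵘ (mkℚᵘ (+ suc a) 0) ⟨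
    toℚᵘ (ℕtoℚ (suc a)) ∎))
    where
    open ℚᵘ.≤-Reasoning

  posQ-^ : ∀ p q k → posQ p q ^ℚ k ℚ.* ℕtoℚ (suc q ℕ.^ k) ≡ ℕtoℚ (suc p ℕ.^ k)
  posQ-^ p q zero = refl
  posQ-^ p q (suc k) = begin
    posQ p q ℚ.* posQ p q ^ℚ k ℚ.* ℕtoℚ (suc q ℕ.* suc q ℕ.^ k)
      ≡⟨ cong (posQ p q ℚ.* posQ p q ^ℚ k ℚ.*_) (ℕtoℚ-* (suc q) (suc q ℕ.^ k)) ⟩
    posQ p q ℚ.* posQ p q ^ℚ k ℚ.* (ℕtoℚ (suc q) ℚ.* ℕtoℚ (suc q ℕ.^ k))
      ≡⟨ solve 4 (λ a b c d → a :* b :* (c :* d) := (a :* c) :* (b :* d)) refl (posQ p q) (posQ p q ^ℚ k) (ℕtoℚ (suc q)) (ℕtoℚ (suc q ℕ.^ k)) ⟩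
    (posQ p q ℚ.* ℕtoℚ (suc q)) ℚ.* (posQ p q ^ℚ k ℚ.* ℕtoℚ (suc q ℕ.^ k))
      ≡⟨ cong₂ ℚ._*_ (frac-cancel (suc p) q) (posQ-^ p q k) ⟩
    ℕtoℚ (suc p) ℚ.* ℕtoℚ (suc p ℕ.^ k)
      ≡⟨ ℕtoℚ-* (suc p) (suc p ℕ.^ k) ⟨
    ℕtoℚ (suc p ℕ.* suc p ℕ.^ k) ∎
    where
    open ≡-Reasoning
    open +-*-Solver

  posQ-^-≤ : ∀ p q k n → posQ p q ^ℚ k ℚ.≤ ℕtoℚ n → suc p ℕ.^ k ℕ.≤ n ℕ.* suc q ℕ.^ k
  posQ-^-≤ p q k n le = ℕtoℚ-cancel-≤ (begin
    ℕtoℚ (suc p ℕ.^ k) ≡⟨ posQ-^ p q k ⟨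
    posQ p q ^ℚ k ℚ.* ℕtoℚ (suc q ℕ.^ k) ≤⟨ ℚ.*-monoʳ-≤-nonNeg (ℕtoℚ (suc q ℕ.^ k)) {{ℚ.nonNegative (ℕtoℚ-mono-≤ {0} {suc q ℕ.^ k} ℕ.z≤n)}} le ⟩
    ℕtoℚ n ℚ.* ℕtoℚ (suc q ℕ.^ k) ≡⟨ ℕtoℚ-* n (suc q ℕ.^ k) ⟨
    ℕtoℚ (n ℕ.* suc q ℕ.^ k) ∎)
    where
    open ℚ.≤-Reasoning

  posQ-^-≥ : ∀ p q k n → ℕtoℚ n ℚ.≤ posQ p q ^ℚ k → n ℕ.* suc q ℕ.^ k ℕ.≤ suc p ℕ.^ k
  posQ-^-≥ p q k n le = ℕtoℚ-cancel-≤ (begin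
    ℕtoℚ (n ℕ.* suc q ℕ.^ k) ≡⟨ ℕtoℚ-* n (suc q ℕ.^ k) ⟩
    ℕtoℚ n ℚ.* ℕtoℚ (suc q ℕ.^ k) ≤⟨ ℚ.*-monoʳ-≤-nonNeg (ℕtoℚ (suc q ℕ.^ k)) {{ℚ.nonNegative (ℕtoℚ-mono-≤ {0} {suc q ℕ.^ k} ℕ.z≤n)}} le ⟩
    posQ p q ^ℚ k ℚ.* ℕtoℚ (suc q ℕ.^ k) ≡⟨ posQ-^ p q k ⟩
    ℕtoℚ (suc p ℕ.^ k) ∎)
    where
    open ℚ.≤-Reasoning

  -- Everything is multiplied by `M`, a common denominator for half of t = P / Q, for 1 / t and for
  -- (k - 1) / (2k). `main` collects the first two terms of the bounds and `minor` is the term n /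
  -- t.
  module Cleared (k′ n e p q : ℕ) where
    private
      k P Q M main minor : ℕ
      k = suc k′
      P = suc p
      Q = suc q
      M = 2 ℕ.* k ℕ.* P ℕ.* Q
      main = n ℕ.* k ℕ.* P ℕ.* P ℕ.+ k′ ℕ.* n ℕ.* P ℕ.* Q
      minor = 2 ℕ.* k ℕ.* n ℕ.* Q ℕ.* Q

    open ≡-Reasoning
    open +-*-Solver

    main-cleared : (half ℚ.* ℕtoℚ n ℚ.* posQ p q ℚ.+ midTerm k n) ℚ.* ℕtoℚ M ≡ ℕtoℚ main
    main-cleared = begin
      (half ℚ.* ℕtoℚ n ℚ.* posQ p q ℚ.+ midTerm k n) ℚ.* ℕtoℚ M
        ≡⟨ cong ((half ℚ.* ℕtoℚ n ℚ.* posQ p q ℚ.+ midTerm k n) ℚ.*_) M-split ⟩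
      (half ℚ.* ℕtoℚ n ℚ.* posQ p q ℚ.+ c ℚ.* ℕtoℚ n) ℚ.* (ℕtoℚ 2 ℚ.* ℕtoℚ k ℚ.* ℕtoℚ P ℚ.* ℕtoℚ Q)
        ≡⟨ solve 8 (λ h n t c w k P Q → (h :* n :* t :+ c :* n) :* (w :* k :* P :* Q)
             := (h :* w) :* n :* k :* P :* (t :* Q) :+ (c :* (w :* k)) :* n :* P :* Q) refl
             half (ℕtoℚ n) (posQ p q) c (ℕtoℚ 2) (ℕtoℚ k) (ℕtoℚ P) (ℕtoℚ Q) ⟩
      (half ℚ.* ℕtoℚ 2) ℚ.* ℕtoℚ n ℚ.* ℕtoℚ k ℚ.* ℕtoℚ P ℚ.* (posQ p q ℚ.* ℕtoℚ Q)
        ℚ.+ (c ℚ.* (ℕtoℚ 2 ℚ.* ℕtoℚ k)) ℚ.* ℕtoℚ n ℚ.* ℕtoℚ P ℚ.* ℕtoℚ Q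
        ≡⟨ cong₂ (λ x y → ℚ.1ℚ ℚ.* ℕtoℚ n ℚ.* ℕtoℚ k ℚ.* ℕtoℚ P ℚ.* x ℚ.+ y ℚ.* ℕtoℚ n ℚ.* ℕtoℚ P ℚ.* ℕtoℚ Q) (frac-cancel P q) c-cancel ⟩
      ℚ.1ℚ ℚ.* ℕtoℚ n ℚ.* ℕtoℚ k ℚ.* ℕtoℚ P ℚ.* ℕtoℚ P ℚ.+ ℕtoℚ k′ ℚ.* ℕtoℚ n ℚ.* ℕtoℚ P ℚ.* ℕtoℚ Q
        ≡⟨ cong₂ ℚ._+_ (trans (cong (λ z → z ℚ.* ℕtoℚ k ℚ.* ℕtoℚ P ℚ.* ℕtoℚ P) (ℚ.*-identityˡ (ℕtoℚ n))) (sym (prod₄ n k P P))) (sym (prod₄ k′ n P Q)) ⟩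
      ℕtoℚ (n ℕ.* k ℕ.* P ℕ.* P) ℚ.+ ℕtoℚ (k′ ℕ.* n ℕ.* P ℕ.* Q)
        ≡⟨ ℕtoℚ-+ (n ℕ.* k ℕ.* P ℕ.* P) (k′ ℕ.* n ℕ.* P ℕ.* Q) ⟨
      ℕtoℚ main ∎
      where
      c : ℚ
      c = + k′ ℚ./ suc (2 ℕ.* k ℕ.∸ 1)
      prod₄ : ∀ a b c d → ℕtoℚ (a ℕ.* b ℕ.* c ℕ.* d) ≡ ℕtoℚ a ℚ.* ℕtoℚ b ℚ.* ℕtoℚ c ℚ.* ℕtoℚ d
      prod₄ a b c d = trans (ℕtoℚ-* (a ℕ.* b ℕ.* c) d) (cong (ℚ._* ℕtoℚ d) (trans (ℕtoℚ-* (a ℕ.* b) c) (cong (ℚ._* ℕtoℚ c) (ℕtoℚ-* a b))))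
      M-split : ℕtoℚ M ≡ ℕtoℚ 2 ℚ.* ℕtoℚ k ℚ.* ℕtoℚ P ℚ.* ℕtoℚ Q
      M-split = prod₄ 2 k P Q
      c-cancel : c ℚ.* (ℕtoℚ 2 ℚ.* ℕtoℚ k) ≡ ℕtoℚ k′
      c-cancel = trans (cong (c ℚ.*_) (sym (ℕtoℚ-* 2 k))) (frac-cancel k′ (2 ℕ.* k ℕ.∸ 1))

    minor-cleared : ℕtoℚ n ℚ.* invPosQ p q ℚ.* ℕtoℚ M ≡ ℕtoℚ minor
    minor-cleared = begin
      ℕtoℚ n ℚ.* i ℚ.* ℕtoℚ (2 ℕ.* k ℕ.* P ℕ.* Q)
        ≡⟨ cong (ℕtoℚ n ℚ.* i ℚ.*_) (trans (ℕtoℚ-* (2 ℕ.* k ℕ.* P) Q) (cong (ℚ._* ℕtoℚ Q) (ℕtoℚ-* (2 ℕ.* k) P))) ⟩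
      ℕtoℚ n ℚ.* i ℚ.* (ℕtoℚ (2 ℕ.* k) ℚ.* ℕtoℚ P ℚ.* ℕtoℚ Q)
        ≡⟨ solve 5 (λ n i K P Q → n :* i :* (K :* P :* Q) := K :* n :* (i :* P) :* Q) refl (ℕtoℚ n) i (ℕtoℚ (2 ℕ.* k)) (ℕtoℚ P) (ℕtoℚ Q) ⟩
      ℕtoℚ (2 ℕ.* k) ℚ.* ℕtoℚ n ℚ.* (i ℚ.* ℕtoℚ P) ℚ.* ℕtoℚ Q
        ≡⟨ cong (λ z → ℕtoℚ (2 ℕ.* k) ℚ.* ℕtoℚ n ℚ.* z ℚ.* ℕtoℚ Q) (frac-cancel Q p) ⟩
      ℕtoℚ (2 ℕ.* k) ℚ.* ℕtoℚ n ℚ.* ℕtoℚ Q ℚ.* ℕtoℚ Q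
        ≡⟨ cong (λ z → z ℚ.* ℕtoℚ Q ℚ.* ℕtoℚ Q) (ℕtoℚ-* (2 ℕ.* k) n) ⟨
      ℕtoℚ (2 ℕ.* k ℕ.* n) ℚ.* ℕtoℚ Q ℚ.* ℕtoℚ Q
        ≡⟨ trans (ℕtoℚ-* (2 ℕ.* k ℕ.* n ℕ.* Q) Q) (cong (ℚ._* ℕtoℚ Q) (ℕtoℚ-* (2 ℕ.* k ℕ.* n) Q)) ⟨
      ℕtoℚ minor ∎
      where
      i : ℚ
      i = invPosQ p q

    private
      M-positive : ℚ.Positive (ℕtoℚ M)
      M-positive = ℕtoℚ-positive (ℕ.pred M)

    upper-cleared : e ℕ.* M ℕ.≤ main ℕ.+ minor → ℕtoℚ e ℚ.≤ upperAt k n p q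
    upper-cleared le = ℚ.*-cancelʳ-≤-pos (ℕtoℚ M) {{M-positive}} (ℚ.≤-trans (ℚ.≤-reflexive (sym (ℕtoℚ-* e M)))
      (ℚ.≤-trans (ℕtoℚ-mono-≤ {e ℕ.* M} {main ℕ.+ minor} le) (ℚ.≤-reflexive (begin
        ℕtoℚ (main ℕ.+ minor) ≡⟨ ℕtoℚ-+ main minor ⟩
        ℕtoℚ main ℚ.+ ℕtoℚ minor ≡⟨ cong₂ ℚ._+_ main-cleared minor-cleared ⟨
        (half ℚ.* ℕtoℚ n ℚ.* posQ p q ℚ.+ midTerm k n) ℚ.* ℕtoℚ M ℚ.+ ℕtoℚ n ℚ.* invPosQ p q ℚ.* ℕtoℚ M
                                       ≡⟨ ℚ.*-distribʳ-+ (ℕtoℚ M) (half ℚ.* ℕtoℚ n ℚ.* posQ p q ℚ.+ midTerm k n) (ℕtoℚ n ℚ.* invPosQ p q) ⟨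
        upperAt k n p q ℚ.* ℕtoℚ M ∎))))

    lower-cleared : main ℕ.≤ e ℕ.* M ℕ.+ minor → lowerAt k n p q ℚ.≤ ℕtoℚ e
    lower-cleared le = ℚ.*-cancelʳ-≤-pos (ℕtoℚ M) {{M-positive}} (ℚ.≤-trans (ℚ.≤-reflexive (begin
        lowerAt k n p q ℚ.* ℕtoℚ M
          ≡⟨ solve 3 (λ a b M → (a :- b) :* M := a :* M :- b :* M) refl (half ℚ.* ℕtoℚ n ℚ.* posQ p q ℚ.+ midTerm k n) (ℕtoℚ n ℚ.* invPosQ p q) (ℕtoℚ M) ⟩
        (half ℚ.* ℕtoℚ n ℚ.* posQ p q ℚ.+ midTerm k n) ℚ.* ℕtoℚ M ℚ.- ℕtoℚ n ℚ.* invPosQ p q ℚ.* ℕtoℚ M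
          ≡⟨ cong₂ ℚ._-_ main-cleared minor-cleared ⟩
        ℕtoℚ main ℚ.- ℕtoℚ minor ∎))
      (ℚ.≤-trans (ℚ.+-monoˡ-≤ (ℚ.- ℕtoℚ minor) (ℕtoℚ-mono-≤ {main} {e ℕ.* M ℕ.+ minor} le)) (ℚ.≤-reflexive (begin
        ℕtoℚ (e ℕ.* M ℕ.+ minor) ℚ.- ℕtoℚ minor
          ≡⟨ cong (ℚ._- ℕtoℚ minor) (trans (ℕtoℚ-+ (e ℕ.* M) minor) (cong (ℚ._+ ℕtoℚ minor) (ℕtoℚ-* e M))) ⟩
        ℕtoℚ e ℚ.* ℕtoℚ M ℚ.+ ℕtoℚ minor ℚ.- ℕtoℚ minor
          ≡⟨ solve 2 (λ a b → a :+ b :- b := a) refl (ℕtoℚ e ℚ.* ℕtoℚ M) (ℕtoℚ minor) ⟩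
        ℕtoℚ e ℚ.* ℕtoℚ M ∎))))

-- The lower bound

module LowerBounds where
  open import Defs hiding (sym)
  open ClearedBounds
  open Arithmetic
  open FieldTower
  open BaseFields
  open PolarityGeometry
  open PolarityGraphs
  open Polygons
  open import Data.Nat as ℕ using (ℕ; zero; suc; _+_; _*_; _^_; _<_; _≤_; s≤s; z≤n; >-nonZero)
  open import Data.Nat.Properties hiding (_≟_)
  open import Data.Nat.Tactic.RingSolver using (solve-∀)
  open import Data.Product using (Σ; _,_; _×_)
  open import Data.Sum using (_⊎_; inj₁; inj₂)
  open import Relation.Binary.PropositionalEquality

  m≤p^m : ∀ p m → 1 < p → m ≤ p ^ m
  m≤p^m p zero 1<p = z≤n
  m≤p^m p (suc m) 1<p = begin
    suc m ≤⟨ s≤s (m≤p^m p m 1<p) ⟩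
    suc (p ^ m) ≤⟨ +-monoˡ-≤ (p ^ m) (m^n>0 p {{>-nonZero (<⇒≤ 1<p)}} m) ⟩
    p ^ m + p ^ m ≡⟨ cong (p ^ m +_) (sym (+-identityʳ (p ^ m))) ⟩
    2 * p ^ m ≤⟨ *-monoˡ-≤ (p ^ m) 1<p ⟩
    p * p ^ m ∎
    where
    open ≤-Reasoning

  -- With x = n^(1/k) we have x ≤ q + 1/k, and at t = q + 1/k the bound equals (n (q + 1)) / 2 - n / t.
  lower-bound : ∀ q k′ e → q ^ suc k′ * q + (q ^ suc k′ + q ^ suc k′) ≤ e + e + q ^ k′ →
                LowerBound (suc k′) (q ^ suc k′ + q ^ k′) e
  lower-bound q k′ e many p r le = Cleared.lower-cleared k′ n e p r (begin
    n * k * P * P + k′ * n * P * Q ≡⟨ eq₁ n k P Q k′ ⟩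
    n * P * (k * P) + k′ * n * P * Q ≤⟨ +-monoˡ-≤ (k′ * n * P * Q) (*-monoʳ-≤ (n * P) kP≤) ⟩
    -- k q + 1 + (k - 1) = k (q + 1), and n (q + 1) = q^(k+1) + 2 q^k + q^(k-1): the counted arcs
    -- and q^(k-1) more.
    n * P * (suc (k * q) * Q) + k′ * n * P * Q ≡⟨ eq₂ z P Q k′ q ⟩
    k * P * Q * (q * z * q + (q * z + q * z) + z) ≤⟨ *-monoʳ-≤ (k * P * Q) (+-monoˡ-≤ z many) ⟩
    k * P * Q * (e + e + z + z) ≡⟨ eq₃ e k P Q z ⟩
    e * (2 * k * P * Q) + 2 * k * z * Q * P ≤⟨ +-monoʳ-≤ (e * (2 * k * P * Q)) (*-monoʳ-≤ (2 * k * z * Q) P≤) ⟩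
    e * (2 * k * P * Q) + 2 * k * z * Q * (suc q * Q) ≡⟨ cong (e * (2 * k * P * Q) +_) (eq₄ k z q Q) ⟩
    e * (2 * k * P * Q) + 2 * k * n * Q * Q ∎)
    where
    open ≤-Reasoning
    k z n P Q : ℕ
    k = suc k′
    z = q ^ k′
    n = q ^ suc k′ + q ^ k′
    P = suc p
    Q = suc r
    eq₁ : ∀ n k P Q k′ → n * k * P * P + k′ * n * P * Q ≡ n * P * (k * P) + k′ * n * P * Q
    eq₁ = solve-∀
    eq₂ : ∀ z P Q k′ q → (q * z + z) * P * (suc (suc k′ * q) * Q) + k′ * (q * z + z) * P * Q
          ≡ suc k′ * P * Q * (q * z * q + (q * z + q * z) + z)
    eq₂ = solve-∀
    eq₃ : ∀ e k P Q z → k * P * Q * (e + e + z + z) ≡ e * (2 * k * P * Q) + 2 * k * z * Q * P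
    eq₃ = solve-∀
    eq₄ : ∀ k z q Q → 2 * k * z * Q * (suc q * Q) ≡ 2 * k * (q * z + z) * Q * Q
    eq₄ = solve-∀
    -- k^k n = (k q)^k + k (k q)^(k-1) consists of the first two terms of (k q + 1)^k.
    kP≤ : k * P ≤ suc (k * q) * Q
    kP≤ = ^-cancelˡ-≤ k′ (begin
      (k * P) ^ k ≡⟨ ^-distrib-*ℕ k k P ⟩
      k ^ k * P ^ k ≤⟨ *-monoʳ-≤ (k ^ k) (posQ-^-≤ p r k n le) ⟩
      k ^ k * (n * Q ^ k) ≡⟨ *-assoc (k ^ k) n (Q ^ k) ⟨
      k ^ k * n * Q ^ k ≡⟨ cong (_* Q ^ k) (*-distribˡ-+ (k ^ k) (q ^ k) z) ⟩
      (k ^ k * q ^ k + k * k ^ k′ * z) * Q ^ k ≡⟨ cong (λ u → (u + k * k ^ k′ * z) * Q ^ k) (sym (^-distrib-*ℕ k k q)) ⟩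
      ((k * q) ^ k + k * k ^ k′ * z) * Q ^ k ≡⟨ cong (λ u → ((k * q) ^ k + u) * Q ^ k)
                                                          (trans (*-assoc k (k ^ k′) z) (cong (k *_) (sym (^-distrib-*ℕ k′ k q)))) ⟩
      ((k * q) ^ k + k * (k * q) ^ k′) * Q ^ k ≤⟨ *-monoˡ-≤ (Q ^ k) (bernoulli (k * q) k′) ⟩
      suc (k * q) ^ k * Q ^ k ≡⟨ ^-distrib-*ℕ k (suc (k * q)) Q ⟨
      (suc (k * q) * Q) ^ k ∎)
    -- That is t ≤ q + 1, so q^(k-1) = n / (q + 1) is at most n / t.
    P≤ : P ≤ suc q * Q
    P≤ = *-cancelˡ-≤ k (begin
      k * P ≤⟨ kP≤ ⟩
      suc (k * q) * Q ≤⟨ *-monoˡ-≤ Q (+-monoˡ-≤ (k * q) (s≤s (z≤n {k′}))) ⟩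
      (k + k * q) * Q ≡⟨ eq₅ k q Q ⟩
      k * (suc q * Q) ∎)
      where
      eq₅ : ∀ k q Q → (k + k * q) * Q ≡ k * (suc q * Q)
      eq₅ = solve-∀

  dense : ∀ {p l k′} → 1 < p → (K : KummerField p l) → Geometry (KummerField.R K) k′ → ∀ N → N ≤ KummerField.h K →
          Σ ℕ λ n → N ≤ n × Σ (Graph n) λ G → Free (suc k′) G × LowerBound (suc k′) n (edges G)
  dense {p} {l} {k′} 1<p K Γ N N≤h = n , N≤n , graph , free , lower-bound q k′ (edges graph) many-edges
    where
    open KummerField K using (1≢0; _≟_; enum; h; q)
    open PolarityGraph 1≢0 Γ _≟_ enum
    open ≤-Reasoning
    N≤n : N ≤ n
    N≤n = begin
      N ≤⟨ N≤h ⟩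
      h ≤⟨ m≤n*m h 2 ⟩
      2 * h ≤⟨ n≤1+n (2 * h) ⟩
      suc (2 * h) ≤⟨ m≤p^m p (suc (2 * h)) 1<p ⟩
      q ≡⟨ *-identityʳ q ⟨
      q * 1 ≤⟨ *-monoʳ-≤ q (m^n>0 q {{>-nonZero (m^n>0 p {{>-nonZero (<⇒≤ 1<p)}} (suc (2 * h)))}} k′) ⟩
      q * q ^ k′ ≤⟨ m≤m+n _ _ ⟩
      n ∎

  lower : (k : ℕ) → (k ≡ 2 ⊎ k ≡ 3 ⊎ k ≡ 5) → (N : ℕ) →
          Σ ℕ λ n → N ≤ n × Σ (Graph n) λ G → Free k G × LowerBound k n (edges G)
  lower _ (inj₁ refl) N = let (K , N≤h) = bigField₂ N in dense (s≤s (s≤s z≤n)) K (Plane.geometry K) N N≤h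
  lower _ (inj₂ (inj₁ refl)) N = let (K , N≤h) = bigField₂ N in dense (s≤s (s≤s z≤n)) K (Quadrangle.geometry K) N N≤h
  lower _ (inj₂ (inj₂ refl)) N = let (K , N≤h) = bigField₃ N in dense (s≤s (s≤s z≤n)) K (Hexagon.geometry K) N N≤h

-- AM-GM and logarithmic convexity in natural numbers

module MeanInequalities where
  open Arithmetic
  open import Data.Fin as Fin using (Fin; zero; suc)
  open import Data.Nat as ℕ using (ℕ; zero; suc; _+_; _*_; _^_; _∸_; _<_; _≤_; s≤s; z≤n; >-nonZero)
  open import Data.Nat.Properties
  open import Data.Nat.Tactic.RingSolver using (solve-∀)
  open import Data.Product using (Σ; _,_)
  open import Data.Sum using (_⊎_; inj₁; inj₂)
  open import Relation.Binary.PropositionalEquality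
  open import Relation.Nullary using (no)
  import Algebra.Properties.CommutativeMonoid.Sum as MonoidSum
  import Algebra.Properties.Semiring.Sum as SemiringSum

  module ∑ = MonoidSum +-0-commutativeMonoid
  module ∏ = MonoidSum *-1-commutativeMonoid
  open SemiringSum +-*-semiring public using (*-distribˡ-sum; *-distribʳ-sum)

  ∑ ∏ : ∀ {n} → (Fin n → ℕ) → ℕ
  ∑ = ∑.sum
  ∏ = ∏.sum

  ∑-mono-≤ : ∀ {n} {f g : Fin n → ℕ} → (∀ i → f i ≤ g i) → ∑ f ≤ ∑ g
  ∑-mono-≤ {zero} h = z≤n
  ∑-mono-≤ {suc n} h = +-mono-≤ (h zero) (∑-mono-≤ (λ i → h (suc i)))

  ∏-mono-≤ : ∀ {n} {f g : Fin n → ℕ} → (∀ i → f i ≤ g i) → ∏ f ≤ ∏ g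
  ∏-mono-≤ {zero} h = ≤-refl
  ∏-mono-≤ {suc n} h = *-mono-≤ (h zero) (∏-mono-≤ (λ i → h (suc i)))

  ∏-^ : ∀ {n} (f : Fin n → ℕ) j → ∏ (λ i → f i ^ j) ≡ ∏ f ^ j
  ∏-^ {zero} f j = sym (^-zeroˡ j)
  ∏-^ {suc n} f j = trans (cong (f zero ^ j *_) (∏-^ (λ i → f (suc i)) j)) (sym (^-distrib-*ℕ j (f zero) _))

  ^-∑ : ∀ {n} x (a : Fin n → ℕ) → ∏ (λ i → x ^ a i) ≡ x ^ ∑ a
  ^-∑ {zero} x a = refl
  ^-∑ {suc n} x a = trans (cong (x ^ a zero *_) (^-∑ x (λ i → a (suc i)))) (sym (^-distribˡ-+-* x (a zero) _))

  ∑-const : ∀ n c → ∑ {n} (λ _ → c) ≡ n * c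
  ∑-const zero c = refl
  ∑-const (suc n) c = cong (c +_) (∑-const n c)

  -- The difference of the two sides is (x - y) (x^m - y^m).
  rearrangement : ∀ x y m → x ^ m * y + x * y ^ m ≤ x ^ suc m + y ^ suc m
  rearrangement x y m with ≤-total x y
  ... | inj₁ x≤y = ordered x y x≤y
    where
    ordered : ∀ x y → x ≤ y → x ^ m * y + x * y ^ m ≤ x ^ suc m + y ^ suc m
    ordered x y x≤y with m≤n⇒∃[o]m+o≡n x≤y
    ... | d , refl = begin
      x ^ m * (x + d) + x * (x + d) ^ m ≡⟨ e₁ x d (x ^ m) ((x + d) ^ m) ⟩
      x * x ^ m + x * (x + d) ^ m + d * x ^ m ≤⟨ +-monoʳ-≤ (x * x ^ m + x * (x + d) ^ m) (*-monoʳ-≤ d (^-monoˡ-≤ m x≤y)) ⟩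
      x * x ^ m + x * (x + d) ^ m + d * (x + d) ^ m ≡⟨ e₂ x d (x ^ m) ((x + d) ^ m) ⟩
      x * x ^ m + (x + d) * (x + d) ^ m ∎
      where
      open ≤-Reasoning
      e₁ : ∀ x d u v → u * (x + d) + x * v ≡ x * u + x * v + d * u
      e₁ = solve-∀
      e₂ : ∀ x d u v → x * u + x * v + d * v ≡ x * u + (x + d) * v
      e₂ = solve-∀
  ... | inj₂ y≤x with m≤n⇒∃[o]m+o≡n y≤x
  ... | d , refl = begin
      (y + d) ^ m * y + (y + d) * y ^ m ≡⟨ e₁ y d (y ^ m) ((y + d) ^ m) ⟩
      y * (y + d) ^ m + y * y ^ m + d * y ^ m ≤⟨ +-monoʳ-≤ (y * (y + d) ^ m + y * y ^ m) (*-monoʳ-≤ d (^-monoˡ-≤ m y≤x)) ⟩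
      y * (y + d) ^ m + y * y ^ m + d * (y + d) ^ m ≡⟨ e₂ y d (y ^ m) ((y + d) ^ m) ⟩
      (y + d) * (y + d) ^ m + y * y ^ m ∎
      where
      open ≤-Reasoning
      e₁ : ∀ y d u v → v * y + (y + d) * u ≡ y * v + y * u + d * u
      e₁ = solve-∀
      e₂ : ∀ y d u v → y * v + y * u + d * v ≡ (y + d) * v + y * u
      e₂ = solve-∀

  -- AM-GM for two numbers with weights m and 1. The induction multiplies by x and repairs the mixed
  -- term with `rearrangement`.
  young : ∀ m x y → suc m * x ^ m * y ≤ m * x ^ suc m + y ^ suc m
  young zero x y = ≤-reflexive (base y)
    where
    base : ∀ y → 1 * 1 * y ≡ 0 + y * 1
    base = solve-∀
  young (suc m) x y = +-cancelʳ-≤ (x * y ^ suc m) _ _ (begin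
    suc (suc m) * (x * x ^ m) * y + x * y ^ suc m ≡⟨ e₁ m x y (x ^ m) (y ^ suc m) ⟩
    x * (suc m * x ^ m * y) + (x * x ^ m * y + x * y ^ suc m) ≤⟨ +-mono-≤ (*-monoʳ-≤ x (young m x y)) (rearrangement x y (suc m)) ⟩
    x * (m * x ^ suc m + y ^ suc m) + (x ^ suc (suc m) + y ^ suc (suc m)) ≡⟨ e₂ m x (x ^ suc m) (y ^ suc m) (y ^ suc (suc m)) ⟩
    suc m * x ^ suc (suc m) + y ^ suc (suc m) + x * y ^ suc m ∎)
    where
    open ≤-Reasoning
    e₁ : ∀ m x y u v → suc (suc m) * (x * u) * y + x * v ≡ x * (suc m * u * y) + (x * u * y + x * v)
    e₁ = solve-∀
    e₂ : ∀ m x u v w → x * (m * u + v) + (x * u + w) ≡ suc m * (x * u) + w + x * v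
    e₂ = solve-∀

  -- Young's inequality with x = (m + 1) u and y = m (u + f).
  am-gm-two : ∀ m u f → suc m ^ suc m * (u ^ m * f) ≤ m ^ m * (u + f) ^ suc m
  am-gm-two zero u f = begin
    1 * (1 * f) ≡⟨ e f ⟩
    f ≤⟨ m≤n+m f u ⟩
    u + f ≡⟨ e′ (u + f) ⟩
    1 * ((u + f) * 1) ∎
    where
    open ≤-Reasoning
    e : ∀ f → 1 * (1 * f) ≡ f
    e = solve-∀
    e′ : ∀ f → f ≡ 1 * (f * 1)
    e′ = solve-∀
  am-gm-two m@(suc _) u f = *-cancelˡ-≤ m (+-cancelˡ-≤ (m * (M * (u * u ^ m))) _ _ (begin
    m * (M * (u * u ^ m)) + m * (M * (u ^ m * f)) ≡⟨ e₁ m u f (suc m) (suc m ^ m) (u ^ m) ⟩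
    suc m * (suc m ^ m * u ^ m) * (m * (u + f)) ≡⟨ cong (λ z → suc m * z * (m * (u + f))) (sym (^-distrib-*ℕ m (suc m) u)) ⟩
    suc m * (suc m * u) ^ m * (m * (u + f)) ≤⟨ young m (suc m * u) (m * (u + f)) ⟩
    m * (suc m * u) ^ suc m + (m * (u + f)) ^ suc m ≡⟨ cong₂ (λ z w → m * z + w) (^-distrib-*ℕ (suc m) (suc m) u) (^-distrib-*ℕ (suc m) m (u + f)) ⟩
    m * (M * u ^ suc m) + m ^ suc m * (u + f) ^ suc m ≡⟨ cong (m * (M * u ^ suc m) +_) (*-assoc m (m ^ m) _) ⟩
    m * (M * (u * u ^ m)) + m * (m ^ m * (u + f) ^ suc m) ∎))
    where
    open ≤-Reasoning
    M : ℕ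
    M = suc m ^ suc m
    e₁ : ∀ m u f s t v → m * (s * t * (u * v)) + m * (s * t * (v * f)) ≡ s * (t * v) * (m * (u + f))
    e₁ = solve-∀

  0<m^m : ∀ m → 0 < m ^ m
  0<m^m zero = s≤s z≤n
  0<m^m (suc m) = m^n>0 (suc m) (suc m)

  am-gm-step : ∀ m u p f → m ^ m * p ≤ u ^ m → suc m ^ suc m * (p * f) ≤ (u + f) ^ suc m
  am-gm-step m u p f h = *-cancelˡ-≤ (m ^ m) {{>-nonZero (0<m^m m)}} (begin
    m ^ m * (M * (p * f)) ≡⟨ e (m ^ m) M p f ⟩
    M * (m ^ m * p * f) ≤⟨ *-monoʳ-≤ M (*-monoˡ-≤ f h) ⟩
    M * (u ^ m * f) ≤⟨ am-gm-two m u f ⟩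
    m ^ m * (u + f) ^ suc m ∎)
    where
    open ≤-Reasoning
    M : ℕ
    M = suc m ^ suc m
    e : ∀ a M p f → a * (M * (p * f)) ≡ M * (a * p * f)
    e = solve-∀

  am-gm-steps : ∀ l m u p f → m ^ m * p ≤ u ^ m → (l + m) ^ (l + m) * (f ^ l * p) ≤ (l * f + u) ^ (l + m)
  am-gm-steps zero m u p f h = subst (λ z → m ^ m * z ≤ u ^ m) (sym (+-identityʳ p)) h
  am-gm-steps (suc l) m u p f h = begin
    suc (l + m) ^ suc (l + m) * (f * f ^ l * p) ≡⟨ cong (suc (l + m) ^ suc (l + m) *_) (e f (f ^ l) p) ⟩
    suc (l + m) ^ suc (l + m) * (f ^ l * p * f) ≤⟨ am-gm-step (l + m) (l * f + u) (f ^ l * p) f (am-gm-steps l m u p f h) ⟩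
    (l * f + u + f) ^ suc (l + m) ≡⟨ cong (_^ suc (l + m)) (e′ (l * f) u f) ⟩
    (f + l * f + u) ^ suc (l + m) ∎
    where
    open ≤-Reasoning
    e : ∀ f x p → f * x * p ≡ x * p * f
    e = solve-∀
    e′ : ∀ x u f → x + u + f ≡ f + x + u
    e′ = solve-∀

  -- A weight means repetition: the factors are added one at a time, each through `am-gm-two`.
  -- Raising to the total weight avoids roots and quotients.
  am-gm : ∀ {n} (a f : Fin n → ℕ) → ∑ a ^ ∑ a * ∏ (λ i → f i ^ a i) ≤ ∑ (λ i → a i * f i) ^ ∑ a
  am-gm {zero} a f = ≤-refl
  am-gm {suc n} a f = am-gm-steps (a zero) _ _ _ (f zero) (am-gm (λ i → a (suc i)) (λ i → f (suc i)))

  differ : ∀ {n} → Fin n → Fin n → ℕ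
  differ zero zero = 0
  differ zero (suc j) = 1
  differ (suc i) zero = 1
  differ (suc i) (suc j) = differ i j

  differ-sym : ∀ {n} (i j : Fin n) → differ i j ≡ differ j i
  differ-sym zero zero = refl
  differ-sym zero (suc j) = refl
  differ-sym (suc i) zero = refl
  differ-sym (suc i) (suc j) = differ-sym i j

  differ-refl : ∀ {n} (i : Fin n) → differ i i ≡ 0
  differ-refl zero = refl
  differ-refl (suc i) = differ-refl i

  ∑-differ : ∀ {n} (g : Fin n → ℕ) i → ∑ (λ w → g w * differ i w) + g i ≡ ∑ g
  ∑-differ {suc n} g zero = begin
    g zero * 0 + ∑ (λ w → g (suc w) * 1) + g zero ≡⟨ cong₂ (λ x y → x + y + g zero) (*-zeroʳ (g zero)) (∑.sum-cong-≗ (λ w → *-identityʳ (g (suc w)))) ⟩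
    ∑ (λ w → g (suc w)) + g zero ≡⟨ +-comm _ (g zero) ⟩
    g zero + ∑ (λ w → g (suc w)) ∎
    where
    open ≡-Reasoning
  ∑-differ {suc n} g (suc i) = begin
    g zero * 1 + ∑ (λ w → g (suc w) * differ i w) + g (suc i) ≡⟨ cong (λ x → x + ∑ (λ w → g (suc w) * differ i w) + g (suc i)) (*-identityʳ (g zero)) ⟩
    g zero + ∑ (λ w → g (suc w) * differ i w) + g (suc i) ≡⟨ +-assoc (g zero) _ _ ⟩
    g zero + (∑ (λ w → g (suc w) * differ i w) + g (suc i)) ≡⟨ cong (g zero +_) (∑-differ (λ w → g (suc w)) i) ⟩
    g zero + ∑ (λ w → g (suc w)) ∎
    where
    open ≡-Reasoning

  -- AM-GM at each index of weight 1, over the other indices; every factor then occurs ∑ a - 1 times.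
  am-gm-others : ∀ {n} (a f : Fin n → ℕ) r → (∀ i → a i ≡ 0 ⊎ a i ≡ 1) → ∑ a ≡ suc (suc r) →
    suc r ^ ∑ a * ∏ (λ i → f i ^ a i) ≤ ∏ (λ i → ∑ (λ w → a w * differ i w * f w) ^ a i)
  am-gm-others {n} a f r bits ∑a = ^-cancelˡ-≤ r (begin
    (R ^ ∑ a * ∏ (λ i → f i ^ a i)) ^ R
      ≡⟨ ^-distrib-*ℕ R (R ^ ∑ a) _ ⟩
    (R ^ ∑ a) ^ R * ∏ (λ i → f i ^ a i) ^ R
      ≡⟨ cong₂ _*_ (trans (^-*-assoc R (∑ a) R) (trans (cong (R ^_) (*-comm (∑ a) R)) (sym (^-*-assoc R R (∑ a))))) (sym (∏-^ (λ i → f i ^ a i) R)) ⟩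
    (R ^ R) ^ ∑ a * ∏ (λ w → (f w ^ a w) ^ R)
      ≡⟨ cong₂ _*_ (sym (^-∑ (R ^ R) a)) (∏.sum-cong-≗ column) ⟩
    ∏ (λ i → (R ^ R) ^ a i) * ∏ (λ w → ∏ (λ i → (f w ^ (a w * differ i w)) ^ a i))
      ≡⟨ cong (∏ (λ i → (R ^ R) ^ a i) *_) (sym (∏.∑-comm (λ i w → (f w ^ (a w * differ i w)) ^ a i))) ⟩
    ∏ (λ i → (R ^ R) ^ a i) * ∏ (λ i → ∏ (λ w → (f w ^ (a w * differ i w)) ^ a i))
      ≡⟨ ∏.∑-distrib-+ (λ i → (R ^ R) ^ a i) _ ⟨
    ∏ (λ i → (R ^ R) ^ a i * ∏ (λ w → (f w ^ (a w * differ i w)) ^ a i))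
      ≡⟨ ∏.sum-cong-≗ (λ i → trans (cong ((R ^ R) ^ a i *_) (∏-^ (λ w → f w ^ (a w * differ i w)) (a i))) (sym (^-distrib-*ℕ (a i) (R ^ R) _))) ⟩
    ∏ (λ i → (R ^ R * ∏ (λ w → f w ^ (a w * differ i w))) ^ a i)
      ≤⟨ ∏-mono-≤ (λ i → row i (bits i)) ⟩
    ∏ (λ i → (S i ^ a i) ^ R)
      ≡⟨ ∏-^ (λ i → S i ^ a i) R ⟩
    ∏ (λ i → S i ^ a i) ^ R ∎)
    where
    open ≤-Reasoning
    R : ℕ
    R = suc r
    S : Fin n → ℕ
    S i = ∑ (λ w → a w * differ i w * f w)
    others : ∀ i → a i ≡ 1 → ∑ (λ w → a w * differ i w) ≡ R
    others i ai≡1 = +-cancelʳ-≡ 1 _ R (trans (cong (∑ (λ w → a w * differ i w) +_) (sym ai≡1)) (trans (∑-differ a i) (trans ∑a (+-comm 1 R))))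
    row : ∀ i → a i ≡ 0 ⊎ a i ≡ 1 → (R ^ R * ∏ (λ w → f w ^ (a w * differ i w))) ^ a i ≤ (S i ^ a i) ^ R
    row i (inj₁ e) rewrite e = ≤-reflexive (sym (^-zeroˡ R))
    row i (inj₂ e) = subst (λ z → (R ^ R * ∏ (λ w → f w ^ (a w * differ i w))) ^ z ≤ (S i ^ z) ^ R) (sym e) (begin
      (R ^ R * ∏ (λ w → f w ^ (a w * differ i w))) ^ 1 ≡⟨ ^-identityʳ _ ⟩
      R ^ R * ∏ (λ w → f w ^ (a w * differ i w)) ≤⟨ subst (λ z → z ^ z * ∏ (λ w → f w ^ (a w * differ i w)) ≤ S i ^ z) (others i e) (am-gm (λ w → a w * differ i w) f) ⟩
      S i ^ R ≡⟨ cong (_^ R) (^-identityʳ (S i)) ⟨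
      (S i ^ 1) ^ R ∎)
    column : ∀ w → (f w ^ a w) ^ R ≡ ∏ (λ i → (f w ^ (a w * differ i w)) ^ a i)
    column w with bits w
    ... | inj₁ e = trans (trans (cong (λ z → (f w ^ z) ^ R) e) (^-zeroˡ R)) (sym (trans (∏.sum-cong-≗ {n} (λ i →
            trans (cong (λ z → (f w ^ (z * differ i w)) ^ a i) e) (^-zeroˡ (a i)))) (ones n)))
      where
      ones : ∀ n → ∏ {n} (λ _ → 1) ≡ 1
      ones zero = refl
      ones (suc n) = trans (+-identityʳ _) (ones n)
    ... | inj₂ e = begin-equality
      (f w ^ a w) ^ R ≡⟨ cong (λ z → (f w ^ z) ^ R) e ⟩
      (f w ^ 1) ^ R ≡⟨ cong (_^ R) (^-identityʳ (f w)) ⟩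
      f w ^ R ≡⟨ cong (f w ^_) (others w e) ⟨
      f w ^ ∑ (λ i → a i * differ w i) ≡⟨ ^-∑ (f w) (λ i → a i * differ w i) ⟨
      ∏ (λ i → f w ^ (a i * differ w i)) ≡⟨ ∏.sum-cong-≗ (λ i → trans (cong (f w ^_) (trans (*-comm (a i) _) (cong (_* a i) (trans (differ-sym w i) (sym (trans (cong (_* differ i w) e) (+-identityʳ _)))))))
                                                           (sym (^-*-assoc (f w) (a w * differ i w) (a i)))) ⟩
      ∏ (λ i → (f w ^ (a w * differ i w)) ^ a i) ∎

  ≤⇒+ : ∀ {m n} → m ≤ n → Σ ℕ λ o → o + m ≡ n
  ≤⇒+ {m} {n} m≤n = n ∸ m , m∸n+n≡m m≤n

  -- Written with exponents on both sides so that no subtraction occurs: Φ x ≥ A (B / A) ^ (x - r), i.e.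
  -- a logarithmically convex function lies above its secants through consecutive integers.
  module LogConvex (Φ : ℕ → ℕ) (positive : ∀ x → 0 < Φ (2 + x))
                   (convex : ∀ x → Φ (3 + x) * Φ (3 + x) ≤ Φ (2 + x) * Φ (4 + x)) (r : ℕ) where
    A B : ℕ
    A = Φ (2 + r)
    B = Φ (3 + r)
    open ≤-Reasoning

    right-ratio : ∀ i → Φ (2 + (i + r)) * B ≤ Φ (3 + (i + r)) * A
    right-ratio zero = ≤-reflexive (*-comm A B)
    right-ratio (suc i) = *-cancelʳ-≤ _ _ y {{>-nonZero (positive (i + r))}} (begin
      y₁ * B * y ≡⟨ trans (*-assoc y₁ B y) (cong (y₁ *_) (*-comm B y)) ⟩
      y₁ * (y * B) ≤⟨ *-monoʳ-≤ y₁ (right-ratio i) ⟩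
      y₁ * (y₁ * A) ≡⟨ *-assoc y₁ y₁ A ⟨
      y₁ * y₁ * A ≤⟨ *-monoˡ-≤ A (convex (i + r)) ⟩
      y * y₂ * A ≡⟨ trans (*-assoc y y₂ A) (*-comm y _) ⟩
      y₂ * A * y ∎)
      where
      y y₁ y₂ : ℕ
      y = Φ (2 + (i + r))
      y₁ = Φ (3 + (i + r))
      y₂ = Φ (4 + (i + r))

    right : ∀ i → A * B ^ i ≤ Φ (2 + (i + r)) * A ^ i
    right zero = ≤-refl
    right (suc i) = begin
      A * (B * B ^ i) ≡⟨ e A B (B ^ i) ⟩
      B * (A * B ^ i) ≤⟨ *-monoʳ-≤ B (right i) ⟩
      B * (Φ (2 + (i + r)) * A ^ i) ≡⟨ e′ B (Φ (2 + (i + r))) (A ^ i) ⟩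
      Φ (2 + (i + r)) * B * A ^ i ≤⟨ *-monoˡ-≤ (A ^ i) (right-ratio i) ⟩
      Φ (3 + (i + r)) * A * A ^ i ≡⟨ *-assoc (Φ (3 + (i + r))) A (A ^ i) ⟩
      Φ (3 + (i + r)) * (A * A ^ i) ∎
      where
      e : ∀ a b c → a * (b * c) ≡ b * (a * c)
      e = solve-∀
      e′ : ∀ b p a → b * (p * a) ≡ p * b * a
      e′ = solve-∀

    left-ratio : ∀ i x → i + x ≡ r → Φ (3 + x) * A ≤ Φ (2 + x) * B
    left-ratio zero x refl = ≤-reflexive (*-comm B A)
    left-ratio (suc i) x e = *-cancelʳ-≤ _ _ y₁ {{>-nonZero (positive (suc x))}} (begin
      y₁ * A * y₁ ≡⟨ trans (*-assoc y₁ A y₁) (trans (cong (y₁ *_) (*-comm A y₁)) (sym (*-assoc y₁ y₁ A))) ⟩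
      y₁ * y₁ * A ≤⟨ *-monoˡ-≤ A (convex x) ⟩
      y * y₂ * A ≡⟨ *-assoc y y₂ A ⟩
      y * (y₂ * A) ≤⟨ *-monoʳ-≤ y (left-ratio i (suc x) (trans (+-suc i x) e)) ⟩
      y * (y₁ * B) ≡⟨ trans (cong (y *_) (*-comm y₁ B)) (sym (*-assoc y B y₁)) ⟩
      y * B * y₁ ∎)
      where
      y y₁ y₂ : ℕ
      y = Φ (2 + x)
      y₁ = Φ (3 + x)
      y₂ = Φ (4 + x)

    left : ∀ i x → i + x ≡ r → A * A ^ i ≤ Φ (2 + x) * B ^ i
    left zero x refl = ≤-refl
    left (suc i) x e = begin
      A * (A * A ^ i) ≤⟨ *-monoʳ-≤ A (left i (suc x) (trans (+-suc i x) e)) ⟩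
      A * (Φ (3 + x) * B ^ i) ≡⟨ e′ A (Φ (3 + x)) (B ^ i) ⟩
      Φ (3 + x) * A * B ^ i ≤⟨ *-monoˡ-≤ (B ^ i) (left-ratio (suc i) x e) ⟩
      Φ (2 + x) * B * B ^ i ≡⟨ *-assoc (Φ (2 + x)) B (B ^ i) ⟩
      Φ (2 + x) * (B * B ^ i) ∎
      where
      e′ : ∀ b p a → b * (p * a) ≡ p * b * a
      e′ = solve-∀

    -- To the right of 2 + r each quotient of consecutive values is at least B / A, to the left at
    -- most B / A; telescoping from 2 + r gives the two halves.
    secant : ∀ x → A ^ (3 + r) * B ^ (2 + x) ≤ Φ (2 + x) * (A ^ (2 + x) * B ^ (2 + r))
    secant x with ≤-total r x
    ... | inj₁ r≤x with ≤⇒+ r≤x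
    ... | i , refl = begin
      A * A ^ (2 + r) * B ^ (2 + (i + r)) ≡⟨ cong (A * A ^ (2 + r) *_) (split B) ⟩
      A * A ^ (2 + r) * (B ^ i * B ^ (2 + r)) ≡⟨ e A (A ^ (2 + r)) (B ^ i) (B ^ (2 + r)) ⟩
      A * B ^ i * (A ^ (2 + r) * B ^ (2 + r)) ≤⟨ *-monoˡ-≤ _ (right i) ⟩
      Φ (2 + (i + r)) * A ^ i * (A ^ (2 + r) * B ^ (2 + r)) ≡⟨ e₂ (Φ (2 + (i + r))) (A ^ i) (A ^ (2 + r)) (B ^ (2 + r)) ⟩
      Φ (2 + (i + r)) * (A ^ i * A ^ (2 + r) * B ^ (2 + r)) ≡⟨ cong (λ z → Φ (2 + (i + r)) * (z * B ^ (2 + r))) (sym (split A)) ⟩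
      Φ (2 + (i + r)) * (A ^ (2 + (i + r)) * B ^ (2 + r)) ∎
      where
      split : ∀ z → z ^ (2 + (i + r)) ≡ z ^ i * z ^ (2 + r)
      split z = trans (cong (z ^_) (sym (trans (+-suc i (suc r)) (cong suc (+-suc i r))))) (^-distribˡ-+-* z i (2 + r))
      e : ∀ a p b q → a * p * (b * q) ≡ a * b * (p * q)
      e = solve-∀
      e₂ : ∀ a p b q → a * p * (b * q) ≡ a * (p * b * q)
      e₂ = solve-∀
    secant x | inj₂ x≤r with ≤⇒+ x≤r
    ... | i , eq = begin
      A ^ (3 + r) * B ^ (2 + x) ≡⟨ cong (λ z → A * z * B ^ (2 + x)) (split A) ⟩
      A * (A ^ i * A ^ (2 + x)) * B ^ (2 + x) ≡⟨ e A (A ^ i) (A ^ (2 + x)) (B ^ (2 + x)) ⟩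
      A * A ^ i * (A ^ (2 + x) * B ^ (2 + x)) ≤⟨ *-monoˡ-≤ _ (left i x eq) ⟩
      Φ (2 + x) * B ^ i * (A ^ (2 + x) * B ^ (2 + x)) ≡⟨ e₂ (Φ (2 + x)) (B ^ i) (A ^ (2 + x)) (B ^ (2 + x)) ⟩
      Φ (2 + x) * (A ^ (2 + x) * (B ^ i * B ^ (2 + x))) ≡⟨ cong (λ z → Φ (2 + x) * (A ^ (2 + x) * z)) (sym (split B)) ⟩
      Φ (2 + x) * (A ^ (2 + x) * B ^ (2 + r)) ∎
      where
      split : ∀ z → z ^ (2 + r) ≡ z ^ i * z ^ (2 + x)
      split z = trans (cong (z ^_) (sym (trans (trans (+-suc i (suc x)) (cong suc (+-suc i x))) (cong (2 +_) eq)))) (^-distribˡ-+-* z i (2 + x))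
      e : ∀ a p b q → a * (p * b) * q ≡ a * p * (b * q)
      e = solve-∀
      e₂ : ∀ a p b q → a * p * (b * q) ≡ a * (b * (p * q))
      e₂ = solve-∀

-- From the degree product to the bound for the degree sum

module MooreEstimate where
  open Arithmetic
  open MeanInequalities
  open import Data.Fin as Fin using (Fin; zero; suc)
  open import Data.Nat as ℕ using (ℕ; zero; suc; _+_; _*_; _^_; _∸_; pred; _<_; _≤_; s≤s; z≤n; >-nonZero)
  open import Data.Nat.Properties
  open import Data.Nat.DivMod using (_/_; _%_; m≡m%n+[m/n]*n; m%n<n)
  open import Data.Nat.Tactic.RingSolver using (solve-∀)
  open import Data.Product using (_,_; proj₁; proj₂)
  open import Relation.Binary.PropositionalEquality
  open import Relation.Nullary using (yes; no; contradiction)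

  Φ : ℕ → ℕ → ℕ
  Φ k′ x = x ^ x * ((x ∸ 1) ^ x) ^ k′

  -- Bernoulli's inequality for 1 - 1/(v + 1), where c = v + 1 - y.
  bernoulli-below : ∀ v y c → c + y ≡ suc v → suc v ^ y * c ≤ suc v * v ^ y
  bernoulli-below v zero c e = ≤-reflexive (trans (+-identityʳ c) (trans (sym (+-identityʳ c)) (trans e (sym (*-identityʳ (suc v))))))
  bernoulli-below v (suc y) c e = begin
    suc v * suc v ^ y * c ≡⟨ e₁ (suc v) (suc v ^ y) c ⟩
    suc v ^ y * (suc v * c) ≤⟨ *-monoʳ-≤ (suc v ^ y) shift ⟩
    suc v ^ y * (suc c * v) ≡⟨ *-assoc (suc v ^ y) (suc c) v ⟨
    suc v ^ y * suc c * v ≤⟨ *-monoˡ-≤ v (bernoulli-below v y (suc c) (trans (sym (+-suc c y)) e)) ⟩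
    suc v * v ^ y * v ≡⟨ e₂ (suc v) (v ^ y) v ⟩
    suc v * (v * v ^ y) ∎
    where
    open ≤-Reasoning
    e₁ : ∀ a b c → a * b * c ≡ b * (a * c)
    e₁ = solve-∀
    e₂ : ∀ a b c → a * b * c ≡ a * (c * b)
    e₂ = solve-∀
    shift : suc v * c ≤ suc c * v
    shift = begin
      c + v * c ≤⟨ +-mono-≤ c≤v (≤-reflexive (*-comm v c)) ⟩
      v + c * v ∎
      where
      c≤v : c ≤ v
      c≤v = ≤-pred (subst (suc c ≤_) (trans (sym (+-suc c y)) e) (m≤m+n (suc c) y))

  -- The common form of both convexity claims: for a middle base u, a = u - 1, b = u + 1 and v = u²
  -- - 1. `bernoulli-below` bounds (v / (v + 1))^y from below and leaves the polynomial condition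
  -- `le`, for which the identities `gap` exhibit the surplus.
  convex-from-below : ∀ v y c a b → c + y ≡ suc v → suc v * suc v ≤ c * (b * b) → a * b ≡ v →
                      suc v ^ suc y ≤ a ^ y * b ^ (2 + y)
  convex-from-below v y c a b e le ab≡v = *-cancelˡ-≤ (suc v) (begin
    suc v * (suc v * suc v ^ y) ≡⟨ e₁ (suc v) (suc v ^ y) ⟩
    suc v ^ y * (suc v * suc v) ≤⟨ *-monoʳ-≤ (suc v ^ y) le ⟩
    suc v ^ y * (c * (b * b)) ≡⟨ *-assoc (suc v ^ y) c (b * b) ⟨
    suc v ^ y * c * (b * b) ≤⟨ *-monoˡ-≤ (b * b) (bernoulli-below v y c e) ⟩
    suc v * v ^ y * (b * b) ≡⟨ cong (λ z → suc v * z * (b * b)) (trans (cong (_^ y) (sym ab≡v)) (^-distrib-*ℕ y a b)) ⟩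
    suc v * (a ^ y * b ^ y) * (b * b) ≡⟨ e₂ (suc v) (a ^ y) (b ^ y) b ⟩
    suc v * (a ^ y * (b * (b * b ^ y))) ∎)
    where
    open ≤-Reasoning
    e₁ : ∀ s t → s * (s * t) ≡ t * (s * s)
    e₁ = solve-∀
    e₂ : ∀ s a t b → s * (a * t) * (b * b) ≡ s * (a * (b * (b * t)))
    e₂ = solve-∀

  x^x-convex : ∀ y → suc y ^ suc y * suc y ^ suc y ≤ y ^ y * (2 + y) ^ (2 + y)
  x^x-convex y = ≤-trans (≤-reflexive (trans (sym (^-distrib-*ℕ (suc y) (suc y) (suc y))) (cong (_^ suc y) (square y))))
    (convex-from-below (y * (2 + y)) y (y * y + y + 1) y (2 + y) (sum y) (≤-trans (m≤m+n _ _) (≤-reflexive (gap y))) refl)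
    where
    square : ∀ y → suc y * suc y ≡ suc (y * (2 + y))
    square = solve-∀
    sum : ∀ y → y * y + y + 1 + y ≡ suc (y * (2 + y))
    sum = solve-∀
    gap : ∀ y → suc (y * (2 + y)) * suc (y * (2 + y)) + (y * y * y + 3 * (y * y) + 4 * y + 3) ≡ (y * y + y + 1) * ((2 + y) * (2 + y))
    gap = solve-∀

  [x-1]^x-convex : ∀ x → (2 + x) ^ (3 + x) * (2 + x) ^ (3 + x) ≤ (1 + x) ^ (2 + x) * (3 + x) ^ (4 + x)
  [x-1]^x-convex x = ≤-trans (≤-reflexive (trans (sym (^-distrib-*ℕ (3 + x) (2 + x) (2 + x))) (cong (_^ (3 + x)) (square x))))
    (convex-from-below ((1 + x) * (3 + x)) (2 + x) ((1 + x) * (2 + x)) (1 + x) (3 + x) (sum x) (≤-trans (m≤m+n _ _) (≤-reflexive (gap x))) refl)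
    where
    square : ∀ x → (2 + x) * (2 + x) ≡ suc ((1 + x) * (3 + x))
    square = solve-∀
    sum : ∀ x → (1 + x) * (2 + x) + (2 + x) ≡ suc ((1 + x) * (3 + x))
    sum = solve-∀
    gap : ∀ x → suc ((1 + x) * (3 + x)) * suc ((1 + x) * (3 + x)) + (2 + 7 * x + 5 * (x * x) + x * x * x)
          ≡ (1 + x) * (2 + x) * ((3 + x) * (3 + x))
    gap = solve-∀

  Φ-positive : ∀ k′ x → 0 < Φ k′ (2 + x)
  Φ-positive k′ x = *-mono-< (m^n>0 (2 + x) (2 + x))
    (m^n>0 ((1 + x) ^ (2 + x)) {{>-nonZero (m^n>0 (1 + x) (2 + x))}} k′)

  Φ-convex : ∀ k′ x → Φ k′ (3 + x) * Φ k′ (3 + x) ≤ Φ k′ (2 + x) * Φ k′ (4 + x)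
  Φ-convex k′ x = begin
    X * U ^ k′ * (X * U ^ k′) ≡⟨ interchange X (U ^ k′) X (U ^ k′) ⟩
    X * X * (U ^ k′ * U ^ k′) ≡⟨ cong (X * X *_) (sym (^-distrib-*ℕ k′ U U)) ⟩
    X * X * (U * U) ^ k′ ≤⟨ *-mono-≤ (x^x-convex (2 + x)) (^-monoˡ-≤ k′ ([x-1]^x-convex x)) ⟩
    Y * Z * (V * W) ^ k′ ≡⟨ cong (Y * Z *_) (^-distrib-*ℕ k′ V W) ⟩
    Y * Z * (V ^ k′ * W ^ k′) ≡⟨ interchange Y Z (V ^ k′) (W ^ k′) ⟩
    Y * V ^ k′ * (Z * W ^ k′) ∎
    where
    open ≤-Reasoning
    X Y Z U V W : ℕ
    X = (3 + x) ^ (3 + x)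
    Y = (2 + x) ^ (2 + x)
    Z = (4 + x) ^ (4 + x)
    U = (2 + x) ^ (3 + x)
    V = (1 + x) ^ (2 + x)
    W = (3 + x) ^ (4 + x)
    interchange : ∀ a b c d → a * b * (c * d) ≡ a * c * (b * d)
    interchange = solve-∀

  -- Put t = P / Q, n = s + c, R = 2 + r and d = S / n = R + s / n. Either d ≤ t + 1 - 1/k, or t < d - 1/2, in which
  -- case t² (R - s / n) / (R (R - 1)) ≤ t + 2.
  final-estimate : ∀ k′ r s c S P Q → 0 < k′ → 0 < s + c → 0 < Q → S ≡ s + (2 + r) * (s + c) →
    suc k′ * S * ((2 + r) * (1 + r)) * Q ≤ P * (suc k′ * (s + c) * ((2 + r) * (1 + r)) + k′ * (c * (2 + r) + s * (1 + r))) →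
    suc k′ * S * P * Q ≤ (s + c) * (suc k′ * P * P + k′ * P * Q + 2 * suc k′ * Q * Q)
  final-estimate k′ r s c S P Q 0<k′ 0<n 0<Q S≡ H with suc k′ * S * Q ≤? (s + c) * (suc k′ * P + k′ * Q)
  ... | yes le = begin
    k * S * P * Q ≡⟨ e₁ (k * S) P Q ⟩
    P * (k * S * Q) ≤⟨ *-monoʳ-≤ P le ⟩
    P * (n * (k * P + k′ * Q)) ≤⟨ m≤m+n _ (n * (2 * k * Q * Q)) ⟩
    P * (n * (k * P + k′ * Q)) + n * (2 * k * Q * Q) ≡⟨ e₂ P n k k′ Q ⟩
    n * (k * P * P + k′ * P * Q + 2 * k * Q * Q) ∎
    where
    open ≤-Reasoning
    k n : ℕ
    k = suc k′
    n = s + c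
    e₁ : ∀ x P Q → x * P * Q ≡ P * (x * Q)
    e₁ = solve-∀
    e₂ : ∀ P n k k′ Q → P * (n * (k * P + k′ * Q)) + n * (2 * k * Q * Q) ≡ n * (k * P * P + k′ * P * Q + 2 * k * Q * Q)
    e₂ = solve-∀
  ... | no ¬le = *-cancelʳ-≤ _ _ (2 * D) {{>-nonZero (s≤s z≤n)}} (begin
    k * S * P * Q * (2 * D) ≡⟨ e₁ (k * S) P Q D ⟩
    2 * P * (k * S * D * Q) ≤⟨ *-monoʳ-≤ (2 * P) H ⟩
    2 * P * (P * (k * n * D + k′ * y)) ≡⟨ e₂ P k n D k′ y ⟩
    2 * k * n * D * P * P + k′ * P * (2 * P * y) ≤⟨ +-monoʳ-≤ _ (*-monoʳ-≤ (k′ * P) 2Py≤) ⟩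
    2 * k * n * D * P * P + k′ * P * (Q * (2 * n * D + n * (1 + R))) ≡⟨ e₃ k n D P k′ Q R ⟩
    2 * k * n * D * P * P + 2 * k′ * n * D * P * Q + k′ * n * Q * ((1 + R) * P)
                                                                         ≤⟨ +-monoʳ-≤ _ (*-mono-≤ (*-monoˡ-≤ Q (*-monoˡ-≤ n (n≤1+n k′))) P≤) ⟩
    2 * k * n * D * P * P + 2 * k′ * n * D * P * Q + k * n * Q * (4 * D * Q)
                                                                         ≡⟨ e₄ k n D P k′ Q ⟩
    n * (k * P * P + k′ * P * Q + 2 * k * Q * Q) * (2 * D) ∎)
    where
    open ≤-Reasoning
    k n R D y : ℕ
    k = suc k′
    n = s + c
    R = 2 + r
    D = R * (1 + r)
    y = c * R + s * (1 + r)
    e₁ : ∀ x P Q D → x * P * Q * (2 * D) ≡ 2 * P * (x * D * Q)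
    e₁ = solve-∀
    e₂ : ∀ P k n D k′ y → 2 * P * (P * (k * n * D + k′ * y)) ≡ 2 * k * n * D * P * P + k′ * P * (2 * P * y)
    e₂ = solve-∀
    e₃ : ∀ k n D P k′ Q R → 2 * k * n * D * P * P + k′ * P * (Q * (2 * n * D + n * (1 + R)))
         ≡ 2 * k * n * D * P * P + 2 * k′ * n * D * P * Q + k′ * n * Q * ((1 + R) * P)
    e₃ = solve-∀
    e₄ : ∀ k n D P k′ Q → 2 * k * n * D * P * P + 2 * k′ * n * D * P * Q + k * n * Q * (4 * D * Q)
         ≡ n * (k * P * P + k′ * P * Q + 2 * k * Q * Q) * (2 * D)
    e₄ = solve-∀
    -- In this case S / n ≥ t + k′ / k, and k′ / k ≥ 1/2 as k ≥ 2.
    large : 2 * n * P + n * Q ≤ 2 * S * Q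
    large = *-cancelˡ-≤ k (begin
      k * (2 * n * P + n * Q) ≡⟨ f₁ k n P Q ⟩
      2 * n * (k * P) + k * (n * Q) ≤⟨ +-monoʳ-≤ _ (*-monoˡ-≤ (n * Q) (s≤ k′ 0<k′)) ⟩
      2 * n * (k * P) + 2 * k′ * (n * Q) ≡⟨ f₂ k n P k′ Q ⟩
      2 * (n * (k * P + k′ * Q)) ≤⟨ *-monoʳ-≤ 2 (≰⇒≥ ¬le) ⟩
      2 * (k * S * Q) ≡⟨ f₃ k S Q ⟩
      k * (2 * S * Q) ∎)
      where
      s≤ : ∀ k′ → 0 < k′ → suc k′ ≤ 2 * k′
      s≤ (suc j) _ = s≤s (≤-trans (≤-reflexive (+-comm 1 j)) (+-monoʳ-≤ j (s≤s z≤n)))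
      f₁ : ∀ k n P Q → k * (2 * n * P + n * Q) ≡ 2 * n * (k * P) + k * (n * Q)
      f₁ = solve-∀
      f₂ : ∀ k n P k′ Q → 2 * n * (k * P) + 2 * k′ * (n * Q) ≡ 2 * (n * (k * P + k′ * Q))
      f₂ = solve-∀
      f₃ : ∀ k S Q → 2 * (k * S * Q) ≡ k * (2 * S * Q)
      f₃ = solve-∀
    -- Since y = n R - s, this estimates t (R - s / n). Replacing t by S / n - 1/2 leaves the exact
    -- surplus 2 s² + n c.
    2Py≤ : 2 * P * y ≤ Q * (2 * n * D + n * (1 + R))
    2Py≤ = *-cancelˡ-≤ n {{>-nonZero 0<n}} (+-cancelʳ-≤ (n * Q * y) _ _ (begin
      n * (2 * P * y) + n * Q * y ≡⟨ f₁ n P y Q ⟩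
      (2 * n * P + n * Q) * y ≤⟨ *-monoˡ-≤ y large ⟩
      2 * S * Q * y ≡⟨ f₂ S Q y ⟩
      Q * (2 * S * y) ≤⟨ *-monoʳ-≤ Q (m≤m+n (2 * S * y) (2 * s * s + n * c)) ⟩
      Q * (2 * S * y + (2 * s * s + n * c)) ≡⟨ cong (λ z → Q * (2 * z * y + (2 * s * s + n * c))) S≡ ⟩
      Q * (2 * (s + R * n) * y + (2 * s * s + n * c)) ≡⟨ cong (Q *_) (f₃ s c r) ⟩
      Q * (n * (2 * n * D + n * (1 + R)) + n * y) ≡⟨ f₄ Q n (2 * n * D + n * (1 + R)) y ⟩
      n * (Q * (2 * n * D + n * (1 + R))) + n * Q * y ∎))
      where
      f₁ : ∀ n P y Q → n * (2 * P * y) + n * Q * y ≡ (2 * n * P + n * Q) * y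
      f₁ = solve-∀
      f₂ : ∀ S Q y → 2 * S * Q * y ≡ Q * (2 * S * y)
      f₂ = solve-∀
      f₃ : ∀ s c r → 2 * (s + (2 + r) * (s + c)) * (c * (2 + r) + s * (1 + r)) + (2 * s * s + (s + c) * c)
           ≡ (s + c) * (2 * (s + c) * ((2 + r) * (1 + r)) + (s + c) * (1 + (2 + r))) + (s + c) * (c * (2 + r) + s * (1 + r))
      f₃ = solve-∀
      f₄ : ∀ Q n X y → Q * (n * X + n * y) ≡ n * (Q * X) + n * Q * y
      f₄ = solve-∀
    -- From `large` and S / n ≤ R + 1 follows t ≤ R + 1/2.
    P≤ : (1 + R) * P ≤ 4 * D * Q
    P≤ = *-cancelˡ-≤ 2 (begin
      2 * ((1 + R) * P) ≡⟨ f₁ R P ⟩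
      (1 + R) * (2 * P) ≤⟨ *-monoʳ-≤ (1 + R) 2P≤ ⟩
      (1 + R) * ((2 * R + 1) * Q) ≤⟨ ≤-trans (m≤m+n _ _) (≤-reflexive (f₂ r Q)) ⟩
      2 * (4 * D * Q) ∎)
      where
      f₁ : ∀ R P → 2 * ((1 + R) * P) ≡ (1 + R) * (2 * P)
      f₁ = solve-∀
      f₂ : ∀ r Q → (1 + (2 + r)) * ((2 * (2 + r) + 1) * Q) + (1 + 13 * r + 6 * r * r) * Q ≡ 2 * (4 * ((2 + r) * (1 + r)) * Q)
      f₂ = solve-∀
      2P≤ : 2 * P ≤ (2 * R + 1) * Q
      2P≤ = *-cancelˡ-≤ n {{>-nonZero 0<n}} (+-cancelʳ-≤ (n * Q) _ _ (begin
        n * (2 * P) + n * Q ≡⟨ cong (_+ n * Q) (g₁ n P) ⟩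
        2 * n * P + n * Q ≤⟨ large ⟩
        2 * S * Q ≡⟨ cong (λ z → 2 * z * Q) S≡ ⟩
        2 * (s + R * n) * Q ≤⟨ m≤m+n _ (2 * c * Q) ⟩
        2 * (s + R * n) * Q + 2 * c * Q ≡⟨ g₂ s c R Q ⟩
        n * ((2 * R + 1) * Q) + n * Q ∎))
        where
        g₁ : ∀ n P → n * (2 * P) ≡ 2 * n * P
        g₁ = solve-∀
        g₂ : ∀ s c R Q → 2 * (s + R * (s + c)) * Q + 2 * c * Q ≡ (s + c) * ((2 * R + 1) * Q) + (s + c) * Q
        g₂ = solve-∀

  -- AM-GM for t / r, t / (r - 1), t / (r + 1), t / r, after multiplying by the common denominator.
  balanced : ∀ k′ r s c S P Q → 0 < S → S ≡ s + (2 + r) * (s + c) → (s + c) * Q ^ suc k′ ≤ P ^ suc k′ →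
    Φ k′ (2 + r) ^ c * Φ k′ (3 + r) ^ s ≤ (s + c) ^ S →
    suc k′ * S * ((2 + r) * (1 + r)) * Q ≤ P * (suc k′ * (s + c) * ((2 + r) * (1 + r)) + k′ * (c * (2 + r) + s * (1 + r)))
  balanced k′ r s c S@(suc _) P Q _ S≡ hP hΦ = *-cancelˡ-≤ (1 + R) (begin
    (1 + R) * (k * S * (R * ρ) * Q) ≡⟨ g₁ (1 + R) (k * S) (R * ρ) Q ⟩
    M * D * Q ≤⟨ ^-cancelˡ-≤ (pred M) powers ⟩
    total * P ≡⟨ g₂ k′ r s c P ⟩
    (1 + R) * (P * (k * n * (R * ρ) + k′ * (c * R + s * ρ))) ∎)
    where
    open ≤-Reasoning
    k n R ρ D M : ℕ
    k = suc k′
    n = s + c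
    R = 2 + r
    ρ = 1 + r
    D = (1 + R) * (R * ρ)
    M = k * S
    -- `g` lists the bases occurring in `Φ k′ R ^ c * Φ k′ (1 + R) ^ s` and `a` their exponents;
    -- `f`, the reciprocals of `g` times `D`, are the numbers to be averaged.
    a f g : Fin 4 → ℕ
    a zero = R * c
    a (suc zero) = R * (k′ * c)
    a (suc (suc zero)) = (1 + R) * s
    a (suc (suc (suc zero))) = (1 + R) * (k′ * s)
    f zero = (1 + R) * ρ
    f (suc zero) = (1 + R) * R
    f (suc (suc zero)) = R * ρ
    f (suc (suc (suc zero))) = (1 + R) * ρ
    g zero = R
    g (suc zero) = ρ
    g (suc (suc zero)) = 1 + R
    g (suc (suc (suc zero))) = R
    total : ℕ
    total = ∑ (λ i → a i * f i)
    g₁ : ∀ x m y Q → x * (m * y * Q) ≡ m * (x * y) * Q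
    g₁ = solve-∀
    g₂ : ∀ k′ r s c P → ((2 + r) * c * ((1 + (2 + r)) * (1 + r)) + ((2 + r) * (k′ * c) * ((1 + (2 + r)) * (2 + r))
         + ((1 + (2 + r)) * s * ((2 + r) * (1 + r)) + ((1 + (2 + r)) * (k′ * s) * ((1 + (2 + r)) * (1 + r)) + 0)))) * P
         ≡ (1 + (2 + r)) * (P * (suc k′ * (s + c) * ((2 + r) * (1 + r)) + k′ * (c * (2 + r) + s * (1 + r))))
    g₂ = solve-∀
    ∑a : ∑ a ≡ M
    ∑a = trans (weights k′ r s c) (cong (k *_) (sym S≡))
      where
      weights : ∀ k′ r s c → (2 + r) * c + ((2 + r) * (k′ * c) + ((1 + (2 + r)) * s + ((1 + (2 + r)) * (k′ * s) + 0)))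
                ≡ suc k′ * (s + (2 + r) * (s + c))
      weights = solve-∀
    fg : ∀ i → f i * g i ≡ D
    fg zero = h (1 + R) R ρ
      where h : ∀ x y z → x * z * y ≡ x * (y * z)
            h = solve-∀
    fg (suc zero) = *-assoc (1 + R) R ρ
    fg (suc (suc zero)) = *-comm (R * ρ) (1 + R)
    fg (suc (suc (suc zero))) = fg zero
    ∏g : ∏ (λ i → g i ^ a i) ≡ Φ k′ R ^ c * Φ k′ (1 + R) ^ s
    ∏g = begin-equality
      R ^ (R * c) * (ρ ^ (R * (k′ * c)) * ((1 + R) ^ ((1 + R) * s) * (R ^ ((1 + R) * (k′ * s)) * 1)))
        ≡⟨ cong₂ _*_ (split R R c) (cong₂ _*_ (split′ ρ R c) (cong₂ _*_ (split (1 + R) (1 + R) s) (cong (_* 1) (split′ R (1 + R) s)))) ⟩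
      (R ^ R) ^ c * (((ρ ^ R) ^ k′) ^ c * (((1 + R) ^ (1 + R)) ^ s * (((R ^ (1 + R)) ^ k′) ^ s * 1)))
        ≡⟨ collect ((R ^ R) ^ c) (((ρ ^ R) ^ k′) ^ c) (((1 + R) ^ (1 + R)) ^ s) (((R ^ (1 + R)) ^ k′) ^ s) ⟩
      (R ^ R) ^ c * ((ρ ^ R) ^ k′) ^ c * (((1 + R) ^ (1 + R)) ^ s * ((R ^ (1 + R)) ^ k′) ^ s)
        ≡⟨ cong₂ _*_ (sym (^-distrib-*ℕ c (R ^ R) _)) (sym (^-distrib-*ℕ s ((1 + R) ^ (1 + R)) _)) ⟩
      Φ k′ R ^ c * Φ k′ (1 + R) ^ s ∎
      where
      split : ∀ x y z → x ^ (y * z) ≡ (x ^ y) ^ z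
      split x y z = sym (^-*-assoc x y z)
      split′ : ∀ x y z → x ^ (y * (k′ * z)) ≡ ((x ^ y) ^ k′) ^ z
      split′ x y z = trans (split x y (k′ * z)) (split (x ^ y) k′ z)
      collect : ∀ x y z w → x * (y * (z * (w * 1))) ≡ x * y * (z * w)
      collect = solve-∀
    D^M : D ^ M ≤ ∏ (λ i → f i ^ a i) * n ^ S
    D^M = begin
      D ^ M ≡⟨ cong (D ^_) ∑a ⟨
      D ^ ∑ a ≡⟨ ^-∑ D a ⟨
      ∏ (λ i → D ^ a i) ≡⟨ ∏.sum-cong-≗ (λ i → trans (cong (_^ a i) (sym (fg i))) (^-distrib-*ℕ (a i) (f i) (g i))) ⟩
      ∏ (λ i → f i ^ a i * g i ^ a i) ≡⟨ ∏.∑-distrib-+ (λ i → f i ^ a i) (λ i → g i ^ a i) ⟩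
      ∏ (λ i → f i ^ a i) * ∏ (λ i → g i ^ a i) ≤⟨ *-monoʳ-≤ (∏ (λ i → f i ^ a i)) (≤-trans (≤-reflexive ∏g) hΦ) ⟩
      ∏ (λ i → f i ^ a i) * n ^ S ∎
    powers : (M * D * Q) ^ M ≤ (total * P) ^ M
    powers = begin
      (M * D * Q) ^ M ≡⟨ trans (^-distrib-*ℕ M (M * D) Q) (cong (_* Q ^ M) (^-distrib-*ℕ M M D)) ⟩
      M ^ M * D ^ M * Q ^ M ≤⟨ *-monoˡ-≤ (Q ^ M) (*-monoʳ-≤ (M ^ M) D^M) ⟩
      M ^ M * (F * n ^ S) * Q ^ M ≡⟨ cong (M ^ M * (F * n ^ S) *_) (sym (^-*-assoc Q k S)) ⟩
      M ^ M * (F * n ^ S) * (Q ^ k) ^ S ≡⟨ h₁ (M ^ M) F (n ^ S) ((Q ^ k) ^ S) ⟩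
      M ^ M * F * (n ^ S * (Q ^ k) ^ S) ≡⟨ cong (M ^ M * F *_) (sym (^-distrib-*ℕ S n (Q ^ k))) ⟩
      M ^ M * F * (n * Q ^ k) ^ S ≤⟨ *-mono-≤ (subst (λ z → z ^ z * F ≤ total ^ z) ∑a (am-gm a f)) (^-monoˡ-≤ S hP) ⟩
      total ^ M * (P ^ k) ^ S ≡⟨ cong (total ^ M *_) (^-*-assoc P k S) ⟩
      total ^ M * P ^ M ≡⟨ ^-distrib-*ℕ M total P ⟨
      (total * P) ^ M ∎
      where
      F : ℕ
      F = ∏ (λ i → f i ^ a i)
      h₁ : ∀ m f x y → m * (f * x) * y ≡ m * f * (x * y)
      h₁ = solve-∀

  -- In logarithms the secant through R = 2 + r and R + 1 is affine in the degree, so its product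
  -- over all vertices depends only on `∑ d`. It is unchanged when the degrees become c times R and
  -- s times R + 1, where the secant meets the function.
  smoothed : ∀ k′ {n} (d : Fin n → ℕ) → (∀ i → 2 ≤ d i) → ∀ r s c → n ≡ s + c → ∑ d ≡ s + (2 + r) * n →
             ∏ (λ i → Φ k′ (d i)) ≤ n ^ ∑ d → Φ k′ (2 + r) ^ c * Φ k′ (3 + r) ^ s ≤ n ^ ∑ d
  smoothed k′ {n} d 2≤d r s c n≡ S≡ h = *-cancelʳ-≤ _ _ (A ^ s) {{>-nonZero (m^n>0 A {{>-nonZero (Φ-positive k′ r)}} s)}}
    (*-cancelʳ-≤ _ _ (A ^ (R * n) * B ^ (R * n)) {{>-nonZero (*-mono-< (m^n>0 A {{>-nonZero (Φ-positive k′ r)}} (R * n)) (m^n>0 B {{>-nonZero (Φ-positive k′ (suc r))}} (R * n)))}} (begin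
    A ^ c * B ^ s * A ^ s * (A ^ (R * n) * B ^ (R * n)) ≡⟨ e₁ (A ^ c) (B ^ s) (A ^ s) (A ^ (R * n)) (B ^ (R * n)) ⟩
    A ^ s * A ^ c * A ^ (R * n) * (B ^ s * B ^ (R * n)) ≡⟨ cong₂ _*_ (trans (cong (_* A ^ (R * n)) (sym (^-distribˡ-+-* A s c))) (sym (^-distribˡ-+-* A (s + c) (R * n)))) (sym (^-distribˡ-+-* B s (R * n))) ⟩
    A ^ (s + c + R * n) * B ^ (s + R * n) ≡⟨ cong₂ (λ x y → A ^ x * B ^ y) (cong (_+ R * n) (sym n≡)) (sym S≡) ⟩
    A ^ (suc R * n) * B ^ S ≡⟨ cong₂ _*_ (sym (^-*-assoc A (suc R) n)) (sym (^-∑ B d)) ⟩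
    (A ^ suc R) ^ n * ∏ (λ i → B ^ d i) ≡⟨ cong (_* ∏ (λ i → B ^ d i)) (constant n (A ^ suc R)) ⟩
    ∏ {n} (λ _ → A ^ suc R) * ∏ (λ i → B ^ d i) ≡⟨ ∏.∑-distrib-+ {n} (λ _ → A ^ suc R) (λ i → B ^ d i) ⟨
    ∏ (λ i → A ^ suc R * B ^ d i) ≤⟨ ∏-mono-≤ (λ i → above (d i) (2≤d i)) ⟩
    ∏ (λ i → Φ k′ (d i) * (A ^ d i * B ^ R)) ≡⟨ trans (∏.∑-distrib-+ (λ i → Φ k′ (d i)) _) (cong (∏ (λ i → Φ k′ (d i)) *_) (∏.∑-distrib-+ (λ i → A ^ d i) (λ _ → B ^ R))) ⟩
    ∏ (λ i → Φ k′ (d i)) * (∏ (λ i → A ^ d i) * ∏ {n} (λ _ → B ^ R)) ≡⟨ cong₂ (λ x y → ∏ (λ i → Φ k′ (d i)) * (x * y)) (^-∑ A d) (trans (sym (constant n (B ^ R))) (^-*-assoc B R n)) ⟩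
    ∏ (λ i → Φ k′ (d i)) * (A ^ S * B ^ (R * n)) ≤⟨ *-monoˡ-≤ _ h ⟩
    n ^ S * (A ^ S * B ^ (R * n)) ≡⟨ cong (λ z → n ^ S * (z * B ^ (R * n))) (trans (cong (A ^_) S≡) (^-distribˡ-+-* A s (R * n))) ⟩
    n ^ S * (A ^ s * A ^ (R * n) * B ^ (R * n)) ≡⟨ e₂ (n ^ S) (A ^ s) (A ^ (R * n)) (B ^ (R * n)) ⟩
    n ^ S * A ^ s * (A ^ (R * n) * B ^ (R * n)) ∎))
    where
    open ≤-Reasoning
    open LogConvex (Φ k′) (Φ-positive k′) (Φ-convex k′) r using (A; B; secant)
    R S : ℕ
    R = 2 + r
    S = ∑ d
    above : ∀ x → 2 ≤ x → A ^ suc R * B ^ x ≤ Φ k′ x * (A ^ x * B ^ R)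
    above (suc (suc x)) (s≤s (s≤s z≤n)) = secant x
    constant : ∀ n x → x ^ n ≡ ∏ {n} (λ _ → x)
    constant zero x = refl
    constant (suc n) x = cong (x *_) (constant n x)
    e₁ : ∀ c b s x y → c * b * s * (x * y) ≡ s * c * x * (b * y)
    e₁ = solve-∀
    e₂ : ∀ m a x y → m * (a * x * y) ≡ m * a * (x * y)
    e₂ = solve-∀

  moore-estimate : ∀ k′ {n} (d : Fin n → ℕ) P Q → 0 < k′ → 0 < n → 0 < Q → (∀ i → 2 ≤ d i) →
    ∏ (λ i → Φ k′ (d i)) ≤ n ^ ∑ d → n * Q ^ suc k′ ≤ P ^ suc k′ →
    suc k′ * ∑ d * P * Q ≤ n * (suc k′ * P * P + k′ * P * Q + 2 * suc k′ * Q * Q)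
  moore-estimate k′ {n@(suc n′)} d P Q 0<k′ 0<n 0<Q 2≤d h hP = go (S / n) (m≡m%n+[m/n]*n S n)
    where
    S s : ℕ
    S = ∑ d
    s = S % n
    2n≤S : n * 2 ≤ S
    2n≤S = subst (_≤ S) (∑-const n 2) (∑-mono-≤ 2≤d)
    c,e = ≤⇒+ (<⇒≤ (m%n<n S n))
    c : ℕ
    c = proj₁ c,e
    n≡ : n ≡ s + c
    n≡ = trans (sym (proj₂ c,e)) (+-comm c s)
    -- The quotient r is the smaller of the two balanced degrees; it is at least 2 because every
    -- degree is.
    go : ∀ r → S ≡ s + r * n → suc k′ * S * P * Q ≤ n * (suc k′ * P * P + k′ * P * Q + 2 * suc k′ * Q * Q)
    go zero S≡ = contradiction 2n≤S (<⇒≱ (begin-strict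
      S ≡⟨ trans S≡ (+-identityʳ s) ⟩
      s <⟨ m%n<n S n ⟩
      n ≤⟨ m≤m*n n 2 ⟩
      n * 2 ∎))
      where
      open ≤-Reasoning
    go (suc zero) S≡ = contradiction 2n≤S (<⇒≱ (begin-strict
      S ≡⟨ S≡ ⟩
      s + 1 * n <⟨ +-monoˡ-< (1 * n) (m%n<n S n) ⟩
      n + 1 * n ≡⟨ *-comm 2 n ⟩
      n * 2 ∎))
      where
      open ≤-Reasoning
    go (suc (suc r)) S≡ = subst (λ z → suc k′ * S * P * Q ≤ z * (suc k′ * P * P + k′ * P * Q + 2 * suc k′ * Q * Q)) (sym n≡)
      (final-estimate k′ r s c S P Q 0<k′ (subst (0 <_) n≡ 0<n) 0<Q S≡′
        (balanced k′ r s c S P Q (<-≤-trans (s≤s z≤n) 2n≤S) S≡′ (subst (λ z → z * Q ^ suc k′ ≤ P ^ suc k′) n≡ hP)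
          (subst (λ z → Φ k′ (2 + r) ^ c * Φ k′ (3 + r) ^ s ≤ z ^ S) n≡ (smoothed k′ d 2≤d r s c n≡ S≡ h))))
      where
      S≡′ : S ≡ s + (2 + r) * (s + c)
      S≡′ = trans S≡ (cong (λ z → s + (2 + r) * z) n≡)

-- Counting non-backtracking walks

module NonBacktracking where
  open import Defs hiding (sym)
  open Arithmetic
  open MeanInequalities
  open MooreEstimate
  open import Data.Bool as Bool using (Bool; true; false)
  open import Data.Empty using (⊥; ⊥-elim)
  open import Data.Fin as Fin using (Fin; zero; suc; toℕ)
  import Data.Fin.Properties as Fin
  open import Data.List as List using (List)
  open import Data.Nat as ℕ using (ℕ; zero; suc; _+_; _*_; _^_; _∸_; pred; _<_; _≤_; s≤s; z≤n)
  open import Data.Nat.Properties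
  open import Data.Nat.DivMod using (_%_; m%n<n; m<n⇒m%n≡m; n%n≡0; [m+n]%n≡m%n)
  open import Data.Nat.Tactic.RingSolver using (solve-∀)
  open import Data.Product using (Σ; _,_; proj₁; proj₂; _×_)
  open import Data.Sum using (_⊎_; inj₁; inj₂)
  open import Function using (_∘_; Injective)
  open import Induction.WellFounded using (Acc; acc)
  open import Data.Nat.Induction using (<-wellFounded)
  open import Relation.Binary.Definitions using (tri<; tri≈; tri>)
  open import Relation.Binary.PropositionalEquality
  open import Relation.Nullary using (¬_; yes; no; contradiction)

  bit : Bool → ℕ
  bit true = 1
  bit false = 0

  bit-01 : ∀ b → bit b ≡ 0 ⊎ bit b ≡ 1
  bit-01 true = inj₂ refl
  bit-01 false = inj₁ refl

  0<bit : ∀ {b} → 0 < bit b → b ≡ true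
  0<bit {true} _ = refl

  0<* : ∀ m n → 0 < m * n → 0 < m × 0 < n
  0<* (suc m) zero h = ⊥-elim (<-irrefl refl (subst (0 <_) (*-zeroʳ m) h))
  0<* (suc m) (suc n) h = s≤s z≤n , s≤s z≤n

  0<∑ : ∀ {n} (f : Fin n → ℕ) → 0 < ∑ f → Σ (Fin n) λ i → 0 < f i
  0<∑ {suc n} f h with f zero in eq
  ... | suc _ = zero , subst (0 <_) (sym eq) (s≤s z≤n)
  ... | zero = let (i , p) = 0<∑ (f ∘ suc) h in suc i , p

  ∑-≤1 : ∀ {n} (f : Fin n → ℕ) → (∀ i → f i ≤ 1) → (∀ i j → 0 < f i → 0 < f j → i ≡ j) → ∑ f ≤ 1
  ∑-≤1 {zero} f le unique = z≤n
  ∑-≤1 {suc n} f le unique with f zero in eq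
  ... | zero = ∑-≤1 (f ∘ suc) (λ i → le (suc i)) (λ i j p q → Fin.suc-injective (unique (suc i) (suc j) p q))
  ... | suc m = ≤-trans (+-monoʳ-≤ (suc m) (≮⇒≥ others)) (≤-trans (≤-reflexive (+-identityʳ (suc m))) (subst (_≤ 1) eq (le zero)))
    where
    others : ¬ (0 < ∑ (f ∘ suc))
    others h with 0<∑ (f ∘ suc) h
    ... | i , p with unique zero (suc i) (subst (0 <_) (sym eq) (s≤s z≤n)) p
    ... | ()

  0<differ : ∀ {n} (i j : Fin n) → 0 < differ i j → i ≢ j
  0<differ i j h refl = <-irrefl refl (subst (0 <_) (differ-refl i) h)

  module Walks {n : ℕ} (G : Graph n) where

    A : Fin n → Fin n → ℕ
    A u v = bit (adj G u v)

    A-sym : ∀ u v → A u v ≡ A v u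
    A-sym u v = cong bit (Graph.sym G u v)

    deg : Fin n → ℕ
    deg u = ∑ (A u)

    Adj : Fin n → Fin n → Set
    Adj u v = adj G u v ≡ true

    Adj-sym : ∀ {u v} → Adj u v → Adj v u
    Adj-sym {u} {v} a = trans (Graph.sym G v u) a

    Adj-irrefl : ∀ {u} → ¬ Adj u u
    Adj-irrefl {u} a with trans (sym a) (irrefl G u)
    ... | ()

    -- The number of non-backtracking walks of j further steps after the arc (u , v).
    F : ℕ → Fin n → Fin n → ℕ
    F zero u v = 1
    F (suc j) u v = ∑ (λ x → A v x * differ u x * F j v x)

    arcProduct : ℕ → ℕ
    arcProduct j = ∏ (λ u → ∏ (λ v → F j u v ^ A u v))

    arcProduct-swap : ∀ j → arcProduct j ≡ ∏ (λ v → ∏ (λ u → F j u v ^ A v u))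
    arcProduct-swap j = trans (∏.∑-comm (λ u v → F j u v ^ A u v))
      (∏.sum-cong-≗ (λ v → ∏.sum-cong-≗ (λ u → cong (F j u v ^_) (A-sym u v))))

    module _ (2≤deg : ∀ v → 2 ≤ deg v) where

      -- Fix the vertex v between two steps. Coming from a neighbour u, a walk goes on to one of the
      -- other d - 1 neighbours; `am-gm-others` bounds the product over u of these sums by (d - 1)^d
      -- times the product of all continuations at v.
      arcProduct-step : ∀ j → ∏ (λ v → (deg v ∸ 1) ^ deg v) * arcProduct j ≤ arcProduct (suc j)
      arcProduct-step j = begin
        ∏ (λ v → (deg v ∸ 1) ^ deg v) * arcProduct j ≡⟨ ∏.∑-distrib-+ (λ v → (deg v ∸ 1) ^ deg v) _ ⟨
        ∏ (λ v → (deg v ∸ 1) ^ deg v * ∏ (λ x → F j v x ^ A v x)) ≤⟨ ∏-mono-≤ at ⟩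
        ∏ (λ v → ∏ (λ u → F (suc j) u v ^ A v u)) ≡⟨ arcProduct-swap (suc j) ⟨
        arcProduct (suc j) ∎
        where
        open ≤-Reasoning
        at : ∀ v → (deg v ∸ 1) ^ deg v * ∏ (λ x → F j v x ^ A v x) ≤ ∏ (λ u → F (suc j) u v ^ A v u)
        at v with deg v in eq | 2≤deg v
        ... | suc (suc r) | s≤s (s≤s _) = subst (λ z → suc r ^ z * ∏ (λ x → F j v x ^ A v x) ≤ ∏ (λ u → F (suc j) u v ^ A v u)) eq
          (am-gm-others (A v) (F j v) r (λ x → bit-01 (adj G v x)) eq)

      arcProduct-≥ : ∀ j → ∏ (λ v → (deg v ∸ 1) ^ deg v) ^ j ≤ arcProduct j
      arcProduct-≥ zero = ≤-reflexive (sym (trans (∏.sum-cong-≗ {n} (λ u → trans (∏.sum-cong-≗ {n} (λ v → ^-zeroˡ (A u v))) (ones n))) (ones n)))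
        where
        ones : ∀ n → ∏ {n} (λ _ → 1) ≡ 1
        ones zero = refl
        ones (suc n) = trans (+-identityʳ _) (ones n)
      arcProduct-≥ (suc j) = ≤-trans (*-monoʳ-≤ (∏ (λ v → (deg v ∸ 1) ^ deg v)) (arcProduct-≥ j)) (arcProduct-step j)

      -- A last AM-GM, over the first arc at u: the d counts `F k′ u v` have sum at most N, so d^d
      -- times their product is at most N^d.
      moore-product : ∀ k′ N → (∀ u → ∑ (λ v → A u v * F k′ u v) ≤ N) → ∏ (λ v → Φ k′ (deg v)) ≤ N ^ ∑ deg
      moore-product k′ N bound = begin
        ∏ (λ v → deg v ^ deg v * ((deg v ∸ 1) ^ deg v) ^ k′) ≡⟨ ∏.∑-distrib-+ (λ v → deg v ^ deg v) _ ⟩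
        ∏ (λ v → deg v ^ deg v) * ∏ (λ v → ((deg v ∸ 1) ^ deg v) ^ k′) ≡⟨ cong (∏ (λ v → deg v ^ deg v) *_) (∏-^ (λ v → (deg v ∸ 1) ^ deg v) k′) ⟩
        ∏ (λ v → deg v ^ deg v) * ∏ (λ v → (deg v ∸ 1) ^ deg v) ^ k′ ≤⟨ *-monoʳ-≤ (∏ (λ v → deg v ^ deg v)) (arcProduct-≥ k′) ⟩
        ∏ (λ v → deg v ^ deg v) * ∏ (λ u → ∏ (λ v → F k′ u v ^ A u v)) ≡⟨ ∏.∑-distrib-+ (λ v → deg v ^ deg v) _ ⟨
        ∏ (λ u → deg u ^ deg u * ∏ (λ v → F k′ u v ^ A u v)) ≤⟨ ∏-mono-≤ (λ u → ≤-trans (am-gm (A u) (F k′ u)) (^-monoˡ-≤ (deg u) (bound u))) ⟩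
        ∏ (λ u → N ^ deg u) ≡⟨ ^-∑ N deg ⟩
        N ^ ∑ deg ∎
        where
        open ≤-Reasoning

    -- The same walks, counted by their last vertex w.
    ends : ℕ → Fin n → Fin n → Fin n → ℕ
    ends zero u v w = 1 ∸ differ v w
    ends (suc j) u v w = ∑ (λ x → A v x * differ u x * ends j v x w)

    ∑-ends : ∀ j u v → ∑ (ends j u v) ≡ F j u v
    ∑-ends zero u v = one v
      where
      zeros : ∀ m → ∑ {m} (λ _ → 0) ≡ 0
      zeros zero = refl
      zeros (suc m) = zeros m
      one : ∀ {m} (v : Fin m) → ∑ (λ w → 1 ∸ differ v w) ≡ 1
      one {suc m} zero = cong suc (zeros m)
      one {suc m} (suc v) = one v
    ∑-ends (suc j) u v = begin
      ∑ (λ w → ∑ (λ x → A v x * differ u x * ends j v x w)) ≡⟨ ∑.∑-comm (λ w x → A v x * differ u x * ends j v x w) ⟩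
      ∑ (λ x → ∑ (λ w → A v x * differ u x * ends j v x w)) ≡⟨ ∑.sum-cong-≗ (λ x → sym (*-distribˡ-sum (A v x * differ u x) (ends j v x))) ⟩
      ∑ (λ x → A v x * differ u x * ∑ (ends j v x)) ≡⟨ ∑.sum-cong-≗ (λ x → cong (A v x * differ u x *_) (∑-ends j v x)) ⟩
      F (suc j) u v ∎
      where
      open ≡-Reasoning

    record Path (m : ℕ) (u w : Fin n) : Set where
      field
        c : ℕ → Fin n
        start : c 0 ≡ u
        end : c m ≡ w
        steps : ∀ i → i < m → Adj (c i) (c (suc i))
        bends : ∀ i → suc i < m → c i ≢ c (2 + i)
    open Path

    cons : ∀ {m u v w} → Adj u v → (p : Path m v w) → (0 < m → u ≢ c p 1) → Path (suc m) u w
    cons {m} {u} {v} a p u≢ = record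
      { c = c′
      ; start = refl
      ; end = end p
      ; steps = λ { zero _ → subst (Adj u) (sym (start p)) a ; (suc i) (s≤s i<m) → steps p i i<m }
      ; bends = λ { zero (s≤s 0<m) → u≢ 0<m ; (suc i) (s≤s h) → bends p i h }
      }
      where
      c′ : ℕ → Fin n
      c′ zero = u
      c′ (suc i) = c p i

    path : ∀ j u v w → Adj u v → 0 < ends j u v w → Σ (Path (suc j) u w) λ p → c p 1 ≡ v
    path zero u v w a h = cons a (record { c = λ _ → v ; start = refl ; end = v≡w ; steps = λ _ () ; bends = λ _ () }) (λ ()) , refl
      where
      v≡w : v ≡ w
      v≡w = same v w h
        where
        same : ∀ {m} (v w : Fin m) → 0 < 1 ∸ differ v w → v ≡ w
        same zero zero h = refl
        same (suc v) (suc w) h = cong suc (same v w h)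
    path (suc j) u v w a h with 0<∑ (λ x → A v x * differ u x * ends j v x w) h
    ... | x , p with 0<* (A v x * differ u x) _ p
    ... | q , e with 0<* (A v x) _ q
    ... | avx , u≢x with path j v x w (0<bit avx) e
    ... | P , first = cons a P (λ _ z → 0<differ u x u≢x (trans z first)) , start P

    module _ {k : ℕ} (free : Free k G) where

      module _ (g : ℕ → Fin n) (g-adj : ∀ i → Adj (g i) (g (suc i))) (g-bends : ∀ i → g i ≢ g (2 + i)) where

        cycle-from : ∀ s L′ → g s ≡ g (s + suc L′) → (∀ i j → i < j → j < suc L′ → g (s + i) ≢ g (s + j)) → HasCycle G (suc L′)
        cycle-from s L′ closed distinct = (λ t → g (s + toℕ t)) , injective , adjacent
          where
          L : ℕ
          L = suc L′
          injective : Injective _≡_ _≡_ (λ (t : Fin L) → g (s + toℕ t))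
          injective {t} {t′} e with <-cmp (toℕ t) (toℕ t′)
          ... | tri< lt _ _ = contradiction e (distinct _ _ lt (Fin.toℕ<n t′))
          ... | tri≈ _ eq _ = Fin.toℕ-injective eq
          ... | tri> _ _ gt = contradiction (sym e) (distinct _ _ gt (Fin.toℕ<n t))
          adjacent : ∀ t → Adj (g (s + toℕ t)) (g (s + toℕ (next t)))
          adjacent t = subst (λ z → Adj (g (s + toℕ t)) (g (s + z))) (sym (Fin.toℕ-fromℕ< _)) go
            where
            go : Adj (g (s + toℕ t)) (g (s + suc (toℕ t) % L))
            go with m≤n⇒m<n∨m≡n (Fin.toℕ<n t)
            ... | inj₁ lt = subst₂ (λ y z → Adj (g y) (g z)) refl (trans (sym (+-suc s (toℕ t))) (cong (s +_) (sym (m<n⇒m%n≡m lt)))) (g-adj (s + toℕ t))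
            ... | inj₂ eq = subst (Adj (g (s + toℕ t))) wrap (g-adj (s + toℕ t))
              where
              wrap : g (suc (s + toℕ t)) ≡ g (s + suc (toℕ t) % L)
              wrap = trans (cong g (trans (sym (+-suc s (toℕ t))) (cong (s +_) eq)))
                (trans (sym closed) (cong g (trans (sym (+-identityʳ s)) (cong (s +_) (sym (trans (cong (_% L) eq) (n%n≡0 L)))))))

        -- Induction on ℓ: a repetition inside the segment is a shorter return, and without one the
        -- segment is a cycle of length ℓ ≤ k. Lengths 1 and 2 would be a loop and a backtrack.
        no-short-return : ∀ ℓ → 0 < ℓ → ℓ ≤ k → ∀ s → g s ≢ g (s + ℓ)
        no-short-return ℓ = go ℓ (<-wellFounded ℓ)
          where
          go : ∀ ℓ → Acc _<_ ℓ → 0 < ℓ → ℓ ≤ k → ∀ s → g s ≢ g (s + ℓ)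
          go (suc zero) _ _ _ s e = Adj-irrefl (subst (Adj (g s)) (sym (trans e (cong g (+-comm s 1)))) (g-adj s))
          go (suc (suc zero)) _ _ _ s e = g-bends s (trans e (cong g (+-comm s 2)))
          go ℓ@(suc (suc (suc ℓ′))) (acc rec) _ ℓ≤k s e =
            free ℓ (inj₁ (s≤s (s≤s (s≤s z≤n)) , ℓ≤k)) (cycle-from s (suc (suc ℓ′)) e λ i j i<j j<ℓ e′ →
              let (d , d+i≡j) = ≤⇒+ (<⇒≤ i<j)
                  0<d = m+n≢n⇒0<m i<j d+i≡j
                  d<ℓ = ≤-<-trans (subst (d ≤_) d+i≡j (m≤m+n d i)) j<ℓ
              in go d (rec d<ℓ) 0<d (≤-trans (<⇒≤ d<ℓ) ℓ≤k) (s + i)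
                   (trans e′ (cong g (trans (cong (s +_) (trans (sym d+i≡j) (+-comm d i))) (sym (+-assoc s i d))))))
            where
            m+n≢n⇒0<m : ∀ {i j d} → i < j → d + i ≡ j → 0 < d
            m+n≢n⇒0<m {d = zero} i<j refl = contradiction i<j (<-irrefl refl)
            m+n≢n⇒0<m {d = suc _} _ _ = s≤s z≤n

        -- Two equal vertices split the closed walk into two closed walks, one of length at most m.
        no-closed : ∀ m → 2 ≤ m → m ≤ k → (∀ i → g (i + (m + m)) ≡ g i) → ⊥
        no-closed m@(suc m′) 2≤m m≤k period = free (m + m) (inj₂ (4≤ , 2m≤ , m , double m))
          (cycle-from 0 (m′ + m) (sym (period 0)) distinct)
          where
          double : ∀ m → m + m ≡ 2 * m
          double = solve-∀
          4≤ : 4 ≤ m + m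
          4≤ = +-mono-≤ 2≤m 2≤m
          2m≤ : m + m ≤ 2 * k
          2m≤ = subst (_≤ 2 * k) (sym (double m)) (*-monoʳ-≤ 2 m≤k)
          distinct : ∀ i j → i < j → j < m + m → g i ≢ g j
          distinct i j i<j j<2m e with ≤⇒+ (<⇒≤ i<j)
          ... | d , refl with d ≤? m
          ... | yes d≤m = no-short-return d 0<d (≤-trans d≤m m≤k) i (trans e (cong g (+-comm d i)))
            where
            0<d : 0 < d
            0<d = +-cancelʳ-< i 0 d i<j
          ... | no d≰m with ≤⇒+ (<⇒≤ d<2m)
            where
            d<2m : d < m + m
            d<2m = ≤-<-trans (m≤m+n d i) j<2m
          ... | d′ , eq = no-short-return d′ 0<d′ (≤-trans (<⇒≤ d′<m) m≤k) (d + i)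
                  (trans (sym e) (trans (sym (period i)) (cong g (trans (cong (i +_) (sym eq)) (shuffle i d d′)))))
            where
            shuffle : ∀ i d d′ → i + (d′ + d) ≡ d + i + d′
            shuffle = solve-∀
            d<2m : d < m + m
            d<2m = ≤-<-trans (m≤m+n d i) j<2m
            0<d′ : 0 < d′
            0<d′ = +-cancelʳ-< d 0 d′ (subst (d <_) (sym eq) d<2m)
            d′<m : d′ < m
            d′<m = +-cancelʳ-< m d′ m (≤-<-trans (≤-reflexive refl) (<-≤-trans (+-monoʳ-< d′ (≰⇒> d≰m)) (≤-reflexive eq)))

      -- `b` is read cyclically with period T + 1; `seam` is the bend across the base point, which
      -- `b-bends` does not reach.
      module Periodic (T : ℕ) (b : ℕ → Fin n) (2≤T : 2 ≤ suc T) (closed : b (suc T) ≡ b 0) (b-adj : ∀ i → i < suc T → Adj (b i) (b (suc i)))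
                      (b-bends : ∀ i → suc i < suc T → b i ≢ b (2 + i)) (seam : b T ≢ b 1) where
        g : ℕ → Fin n
        g i = b (i % suc T)

        g-suc : ∀ i → g (suc i) ≡ b (suc (i % suc T))
        g-suc i with m≤n⇒m<n∨m≡n (m%n<n i (suc T))
        ... | inj₁ lt = cong b (trans (+-%-absorb 1 i T) (m<n⇒m%n≡m lt))
        ... | inj₂ eq = trans (cong b (trans (+-%-absorb 1 i T) (trans (cong (_% suc T) eq) (n%n≡0 (suc T))))) (trans (sym closed) (cong b (sym eq)))

        g-adj : ∀ i → Adj (g i) (g (suc i))
        g-adj i = subst (Adj (g i)) (sym (g-suc i)) (b-adj (i % suc T) (m%n<n i (suc T)))

        g-bends : ∀ i → g i ≢ g (2 + i)
        g-bends i e with m≤n⇒m<n∨m≡n (m%n<n i (suc T))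
        ... | inj₁ lt = b-bends (i % suc T) lt (trans e (trans (g-suc (suc i))
                (cong (λ z → b (suc z)) (trans (+-%-absorb 1 i T) (m<n⇒m%n≡m lt)))))
        ... | inj₂ eq = seam (trans (cong b (sym (suc-injective eq))) (trans e (trans (g-suc (suc i))
                (cong (λ z → b (suc z)) (trans (+-%-absorb 1 i T) (trans (cong (_% suc T) eq) (n%n≡0 (suc T))))))))

        g-period : ∀ i → g (i + suc T) ≡ g i
        g-period i = cong b ([m+n]%n≡m%n i (suc T))

      module _ {u : Fin n} (c c′ : ℕ → Fin n) (c-start : c 0 ≡ u) (c′-start : c′ 0 ≡ u) (first : c 1 ≢ c′ 1) where

        PathOn : ℕ → (ℕ → Fin n) → Set
        PathOn m c = (∀ i → i < m → Adj (c i) (c (suc i))) × (∀ i → suc i < m → c i ≢ c (2 + i))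

        -- The closed walk goes along c to the meeting point and returns along c′.
        no-meeting-at : ∀ m → 2 ≤ m → m ≤ k → PathOn m c → PathOn m c′ → c m ≡ c′ m → c (pred m) ≢ c′ (pred m) → ⊥
        no-meeting-at m@(suc m′) 2≤m m≤k (c-adj , c-bends) (c′-adj , c′-bends) meet before =
          no-closed g g-adj g-bends m 2≤m m≤k g-period
          where
          T : ℕ
          T = m′ + m
          b : ℕ → Fin n
          b i with i ≤? m
          ... | yes _ = c i
          ... | no _ = c′ (m + m ∸ i)
          b-low : ∀ i → i ≤ m → b i ≡ c i
          b-low i i≤m with i ≤? m
          ... | yes _ = refl
          ... | no ¬p = contradiction i≤m ¬p
          b-high : ∀ i → m ≤ i → b i ≡ c′ (m + m ∸ i)
          b-high i m≤i with i ≤? m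
          ... | no _ = refl
          ... | yes i≤m with ≤-antisym m≤i i≤m
          ... | refl = trans meet (cong c′ (sym (m+n∸n≡m m m)))
          down : ∀ i → i < m + m → m + m ∸ i ≡ suc (m + m ∸ suc i)
          down i i<2m = sym (trans (sym (+-∸-assoc 1 i<2m)) refl)
          small : ∀ i → m ≤ i → i < m + m → m + m ∸ suc i < m
          small i m≤i i<2m = subst (_≤ m) (down i i<2m) (≤-trans (∸-monoʳ-≤ (m + m) m≤i) (≤-reflexive (m+n∸n≡m m m)))
          closed : b (suc T) ≡ b 0
          closed = trans (b-high (m + m) (m≤m+n m m)) (trans (trans (cong c′ (n∸n≡0 (m + m))) (trans c′-start (sym c-start))) (sym (b-low 0 z≤n)))
          b-adj : ∀ i → i < suc T → Adj (b i) (b (suc i))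
          b-adj i i<2m with <-cmp i m
          ... | tri< lt _ _ = subst₂ Adj (sym (b-low i (<⇒≤ lt))) (sym (b-low (suc i) lt)) (c-adj i lt)
          ... | tri≈ _ refl _ = subst₂ Adj (sym (trans (b-high i ≤-refl) (cong c′ (down i i<2m)))) (sym (b-high (suc i) (n≤1+n i))) (Adj-sym (c′-adj _ (small i ≤-refl i<2m)))
          ... | tri> _ _ gt = subst₂ Adj (sym (trans (b-high i (<⇒≤ gt)) (cong c′ (down i i<2m)))) (sym (b-high (suc i) (≤-trans (<⇒≤ gt) (n≤1+n i)))) (Adj-sym (c′-adj _ (small i (<⇒≤ gt) i<2m)))
          -- The turn at the meeting point, where `suc i` is `m`, is no backtrack by `before`; for
          -- the turn at the base point `seam` uses `first`.
          b-bends : ∀ i → suc i < suc T → b i ≢ b (2 + i)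
          b-bends i i<2m e with <-cmp (suc i) m
          ... | tri< lt _ _ = c-bends i lt (trans (sym (b-low i (≤-trans (n≤1+n i) (<⇒≤ lt)))) (trans e (b-low (2 + i) lt)))
          ... | tri≈ _ refl _ = before (trans (sym (b-low i (n≤1+n i))) (trans e (trans (b-high (2 + i) (n≤1+n m)) (cong c′ (trans (cong (_∸ suc i) (+-suc i i)) (m+n∸n≡m i i))))))
          ... | tri> _ _ (s≤s m≤i) = c′-bends (m + m ∸ (2 + i)) (subst (_≤ m) (trans (down i (<⇒≤ i<2m)) (cong suc (down (suc i) i<2m))) (≤-trans (∸-monoʳ-≤ (m + m) m≤i) (≤-reflexive (m+n∸n≡m m m))))
                (sym (trans (cong c′ (sym (trans (down i (<⇒≤ i<2m)) (cong suc (down (suc i) i<2m))))) (trans (sym (b-high i m≤i)) (trans e (b-high (2 + i) (≤-trans m≤i (≤-trans (n≤1+n i) (n≤1+n (suc i)))))))))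
          seam : b T ≢ b 1
          seam e = first (sym (trans (sym (cong c′ (trans (cong (_∸ T) (+-comm 1 T)) (m+n∸m≡n T 1)))) (trans (sym (b-high T (m≤n+m m m′))) (trans e (b-low 1 (<⇒≤ 2≤m))))))
          open Periodic T b (≤-trans 2≤m (m≤m+n m m)) closed b-adj b-bends seam

        -- Going back from the common end leads to a time at which the walks agree but one step
        -- earlier do not. It is at least 2 because the first steps differ.
        no-meeting : ∀ m → suc m ≤ k → PathOn (suc m) c → PathOn (suc m) c′ → c (suc m) ≢ c′ (suc m)
        no-meeting zero _ _ _ e = first e
        no-meeting (suc m) m≤k p p′ e with c (suc m) Fin.≟ c′ (suc m)
        ... | no ne = no-meeting-at (suc (suc m)) (s≤s (s≤s z≤n)) m≤k p p′ e ne
        ... | yes e′ = no-meeting m (≤-trans (n≤1+n (suc m)) m≤k) (shorten p) (shorten p′) e′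
          where
          shorten : ∀ {c} → PathOn (suc (suc m)) c → PathOn (suc m) c
          shorten (adj , bends) = (λ i h → adj i (<-trans h (n<1+n (suc m)))) , (λ i h → bends i (<-trans h (n<1+n (suc m))))

      determined : ∀ j u w → suc j ≤ k → ∀ v v′ → Adj u v → Adj u v′ → 0 < ends j u v w → 0 < ends j u v′ w → v ≡ v′
      determined j u w j<k v v′ a a′ h h′ with v Fin.≟ v′ | path j u v w a h | path j u v′ w a′ h′
      ... | yes e | _ | _ = e
      ... | no ne | p , p1 | p′ , p′1 = contradiction (trans (end p) (sym (end p′)))
        (no-meeting (c p) (c p′) (start p) (start p′) (λ e → ne (trans (sym p1) (trans e p′1))) j j<k
          (steps p , bends p) (steps p′ , bends p′))

      weighted-≤1 : ∀ x y → x ≤ 1 → (0 < x → y ≤ 1) → x * y ≤ 1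
      weighted-≤1 zero y _ _ = z≤n
      weighted-≤1 (suc zero) y _ h = subst (_≤ 1) (sym (+-identityʳ y)) (h (s≤s z≤n))
      weighted-≤1 (suc (suc x)) y (s≤s ()) _

      bit-≤1 : ∀ b → bit b ≤ 1
      bit-≤1 true = ≤-refl
      bit-≤1 false = z≤n

      differ-≤1 : ∀ {m} (i j : Fin m) → differ i j ≤ 1
      differ-≤1 zero zero = z≤n
      differ-≤1 zero (suc j) = ≤-refl
      differ-≤1 (suc i) zero = ≤-refl
      differ-≤1 (suc i) (suc j) = differ-≤1 i j

      ends-≤1 : ∀ j u v w → Adj u v → suc j ≤ k → ends j u v w ≤ 1
      ends-≤1 zero u v w a j<k = m∸n≤m 1 (differ v w)
      ends-≤1 (suc j) u v w a j<k = ∑-≤1 (λ x → A v x * differ u x * ends j v x w)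
        (λ x → weighted-≤1 _ _ (weighted-≤1 _ _ (bit-≤1 (adj G v x)) (λ _ → differ-≤1 u x))
          (λ h → ends-≤1 j v x w (0<bit (proj₁ (0<* (A v x) _ h))) (≤-trans (n≤1+n (suc j)) j<k)))
        (λ x y p q → determined j v w (≤-trans (n≤1+n (suc j)) j<k) x y (adjacent p) (adjacent q) (proj₂ (0<* (A v x * differ u x) _ p)) (proj₂ (0<* (A v y * differ u y) _ q)))
        where
        adjacent : ∀ {x} → 0 < A v x * differ u x * ends j v x w → Adj v x
        adjacent {x} p = 0<bit (proj₁ (0<* (A v x) _ (proj₁ (0<* (A v x * differ u x) _ p))))

      walks-≤n : ∀ k′ → suc k′ ≤ k → ∀ u → ∑ (λ v → A u v * F k′ u v) ≤ n
      walks-≤n k′ k′<k u = begin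
        ∑ (λ v → A u v * F k′ u v) ≡⟨ ∑.sum-cong-≗ (λ v → trans (cong (A u v *_) (sym (∑-ends k′ u v))) (*-distribˡ-sum (A u v) (ends k′ u v))) ⟩
        ∑ (λ v → ∑ (λ w → A u v * ends k′ u v w)) ≡⟨ ∑.∑-comm (λ v w → A u v * ends k′ u v w) ⟩
        ∑ (λ w → ∑ (λ v → A u v * ends k′ u v w)) ≤⟨ ∑-mono-≤ (λ w → ∑-≤1 (λ v → A u v * ends k′ u v w)
              (λ v → weighted-≤1 _ _ (bit-≤1 (adj G u v)) (λ h → ends-≤1 k′ u v w (0<bit h) k′<k))
              (λ v v′ p q → determined k′ u w k′<k v v′ (0<bit (proj₁ (0<* (A u v) _ p))) (0<bit (proj₁ (0<* (A u v′) _ q)))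
                (proj₂ (0<* (A u v) _ p)) (proj₂ (0<* (A u v′) _ q)))) ⟩
        ∑ {n} (λ _ → 1) ≡⟨ trans (∑-const n 1) (*-identityʳ n) ⟩
        n ∎
        where
        open ≤-Reasoning

-- The upper bound

module UpperBounds where
  open import Defs hiding (sym)
  open ClearedBounds
  open MeanInequalities
  open MooreEstimate
  open NonBacktracking
  open import Data.Bool using (Bool; true; false)
  import Data.Bool.Properties as Bool
  open import Data.Fin as Fin using (Fin; zero; suc; toℕ; punchIn)
  import Data.Fin.Properties as Fin
  open import Data.List as List using (List; length; filter; concatMap; tabulate)
  open import Data.List.Properties using (length-++; length-map)
  open import Data.Nat as ℕ using (ℕ; zero; suc; _+_; _*_; _^_; _<_; _≤_; s≤s; z≤n)
  open import Data.Nat.Properties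
  open import Data.Nat.Tactic.RingSolver using (solve-∀)
  open import Data.Product using (_,_; _×_)
  open import Function using (_∘_)
  open import Relation.Binary.PropositionalEquality
  open import Relation.Nullary using (Dec; yes; no; does; contradiction)
  open import Relation.Nullary.Decidable using (_×-dec_)
  open import Relation.Unary using (Decidable)
  import Data.Rational.Properties as ℚ

  length-concatMap-tabulate : ∀ {A B : Set} {n} (f : A → List B) (g : Fin n → A) →
                              length (concatMap f (tabulate g)) ≡ ∑ (λ i → length (f (g i)))
  length-concatMap-tabulate {n = zero} f g = refl
  length-concatMap-tabulate {n = suc n} f g =
    trans (length-++ (f (g zero))) (cong (length (f (g zero)) +_) (length-concatMap-tabulate f (g ∘ suc)))

  length-filter-tabulate : ∀ {A : Set} {P : A → Set} (P? : Decidable P) {n} (g : Fin n → A) →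
                           length (filter P? (tabulate g)) ≡ ∑ (λ j → bit (does (P? (g j))))
  length-filter-tabulate P? {zero} g = refl
  length-filter-tabulate P? {suc n} g with does (P? (g zero))
  ... | true = cong suc (length-filter-tabulate P? (g ∘ suc))
  ... | false = length-filter-tabulate P? (g ∘ suc)

  module _ {n : ℕ} (G : Graph n) where
    open Walks G

    ascending? : ∀ i j → Dec (toℕ i < toℕ j × adj G i j ≡ true)
    ascending? i j = toℕ i ℕ.<? toℕ j ×-dec (adj G i j Bool.≟ true)

    edges-∑ : edges G ≡ ∑ (λ i → ∑ (λ j → bit (does (ascending? i j))))
    edges-∑ = trans (length-concatMap-tabulate row (λ i → i)) (∑.sum-cong-≗ λ i →
      trans (length-map (i ,_) (filter (ascending? i) (tabulate (λ j → j)))) (length-filter-tabulate (ascending? i) (λ j → j)))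
      where
      row : Fin n → List (Fin n × Fin n)
      row i = List.map (i ,_) (filter (ascending? i) (List.allFin n))

    -- Of the indicators `U i j` and `U j i` at most one is 1, and then i and j are adjacent; the
    -- comparison is made entry by entry in the adjacency matrix.
    2*edges≤∑deg : edges G + edges G ≤ ∑ deg
    2*edges≤∑deg = begin
      edges G + edges G ≡⟨ cong₂ _+_ edges-∑ (trans edges-∑ (∑.∑-comm U)) ⟩
      ∑ (λ i → ∑ (U i)) + ∑ (λ i → ∑ (λ j → U j i)) ≡⟨ ∑.∑-distrib-+ (λ i → ∑ (U i)) _ ⟨
      ∑ (λ i → ∑ (U i) + ∑ (λ j → U j i)) ≡⟨ ∑.sum-cong-≗ (λ i → sym (∑.∑-distrib-+ (U i) (λ j → U j i))) ⟩
      ∑ (λ i → ∑ (λ j → U i j + U j i)) ≤⟨ ∑-mono-≤ (λ i → ∑-mono-≤ (λ j → at i j (ascending? i j) (ascending? j i))) ⟩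
      ∑ deg ∎
      where
      open ≤-Reasoning
      U : Fin n → Fin n → ℕ
      U i j = bit (does (ascending? i j))
      at : ∀ i j (d : Dec (toℕ i < toℕ j × adj G i j ≡ true)) (d′ : Dec (toℕ j < toℕ i × adj G j i ≡ true)) →
           bit (does d) + bit (does d′) ≤ A i j
      at i j (yes (i<j , _)) (yes (j<i , _)) = contradiction i<j (<-asym j<i)
      at i j (yes (_ , a)) (no _) rewrite a = ≤-refl
      at i j (no _) (yes (_ , a)) rewrite Adj-sym a = ≤-refl
      at i j (no _) (no _) = z≤n

  module Removal {n : ℕ} (G : Graph (suc n)) (v : Fin (suc n)) where

    rest : Graph n
    rest = record
      { adj = λ i j → adj G (punchIn v i) (punchIn v j)
      ; sym = λ i j → Graph.sym G (punchIn v i) (punchIn v j)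
      ; irrefl = λ i → irrefl G (punchIn v i) }

    rest-free : ∀ {k} → Free k G → Free k rest
    rest-free free L family (c , injective , adjacent) =
      free L family ((λ t → punchIn v (c t)) , (λ e → injective (Fin.punchIn-injective v _ _ e)) , adjacent)

    open Walks G
    module Rest = Walks rest

    ∑deg-rest : ∑ deg ≡ deg v + deg v + ∑ Rest.deg
    ∑deg-rest = begin
      ∑ deg ≡⟨ ∑.sum-remove {i = v} deg ⟩
      deg v + ∑ (λ i → deg (punchIn v i)) ≡⟨ cong (deg v +_) (∑.sum-cong-≗ (λ i → ∑.sum-remove {i = v} (A (punchIn v i)))) ⟩
      deg v + ∑ (λ i → A (punchIn v i) v + Rest.deg i) ≡⟨ cong (deg v +_) (∑.∑-distrib-+ (λ i → A (punchIn v i) v) Rest.deg) ⟩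
      deg v + (∑ (λ i → A (punchIn v i) v) + ∑ Rest.deg) ≡⟨ cong (λ z → deg v + (z + ∑ Rest.deg)) (trans (∑.sum-cong-≗ (λ i → A-sym (punchIn v i) v)) (sym deg-v)) ⟩
      deg v + (deg v + ∑ Rest.deg) ≡⟨ +-assoc (deg v) (deg v) _ ⟨
      deg v + deg v + ∑ Rest.deg ∎
      where
      open ≡-Reasoning
      deg-v : deg v ≡ ∑ (λ i → A v (punchIn v i))
      deg-v = trans (∑.sum-remove {i = v} (A v)) (cong (_+ ∑ (λ i → A v (punchIn v i))) (cong bit (irrefl G v)))

  module Descent (k′ P Q : ℕ) (0<k′ : 0 < k′) (0<Q : 0 < Q) where
    k X : ℕ
    k = suc k′
    X = k * P * P + k′ * P * Q + 2 * k * Q * Q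

    2PQ≤ : P * Q + P * Q ≤ P * P + Q * Q
    2PQ≤ = subst₂ _≤_ (e₁ P Q) (e₂ P Q) (rearrangement P Q 1)
      where
      e₁ : ∀ P Q → P * 1 * Q + P * (Q * 1) ≡ P * Q + P * Q
      e₁ = solve-∀
      e₂ : ∀ P Q → P * (P * 1) + Q * (Q * 1) ≡ P * P + Q * Q
      e₂ = solve-∀

    -- Induction on n with P and Q fixed, as n Q^k ≤ P^k survives the removal of a vertex. A vertex
    -- of degree at most 1 adds at most 2 to the degree sum, hence at most 2 k P Q here, and `2PQ≤`
    -- puts this below `X`.
    degree-bound : ∀ n (G : Graph n) → Free k G → n * Q ^ k ≤ P ^ k → k * ∑ (Walks.deg G) * P * Q ≤ n * X
    degree-bound zero G free hP = ≤-reflexive (trans (cong (λ z → z * P * Q) (*-zeroʳ k)) refl)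
    degree-bound (suc n) G free hP with Fin.any? (λ v → Walks.deg G v ℕ.<? 2)
    ... | no ¬small = moore-estimate k′ deg P Q 0<k′ (s≤s z≤n) 0<Q 2≤deg
          (moore-product 2≤deg k′ (suc n) (walks-≤n free k′ ≤-refl)) hP
      where
      open Walks G
      2≤deg : ∀ v → 2 ≤ deg v
      2≤deg v = ≮⇒≥ (λ h → ¬small (v , h))
    ... | yes (v , small) = begin
      k * ∑ deg * P * Q ≡⟨ cong (λ z → k * z * P * Q) ∑deg-rest ⟩
      k * (deg v + deg v + ∑ Rest.deg) * P * Q ≤⟨ *-monoˡ-≤ Q (*-monoˡ-≤ P (*-monoʳ-≤ k (+-monoˡ-≤ (∑ Rest.deg) (+-mono-≤ (≤-pred small) (≤-pred small))))) ⟩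
      k * (1 + 1 + ∑ Rest.deg) * P * Q ≡⟨ e₁ k (∑ Rest.deg) P Q ⟩
      k * (P * Q + P * Q) + k * ∑ Rest.deg * P * Q ≤⟨ +-mono-≤ (*-monoʳ-≤ k 2PQ≤) (degree-bound n rest (rest-free free) (≤-trans (*-monoˡ-≤ (Q ^ k) (n≤1+n n)) hP)) ⟩
      k * (P * P + Q * Q) + n * X ≤⟨ +-monoˡ-≤ (n * X) (≤-trans (m≤m+n _ (k′ * P * Q + k * Q * Q)) (≤-reflexive (e₂ k k′ P Q))) ⟩
      X + n * X ∎
      where
      open ≤-Reasoning
      open Removal G v
      open Walks G
      e₁ : ∀ k s P Q → k * (1 + 1 + s) * P * Q ≡ k * (P * Q + P * Q) + k * s * P * Q
      e₁ = solve-∀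
      e₂ : ∀ k k′ P Q → k * (P * P + Q * Q) + (k′ * P * Q + k * Q * Q) ≡ k * P * P + k′ * P * Q + 2 * k * Q * Q
      e₂ = solve-∀

  -- The larger of the two values is at least the value at an approximation P / Q of n^(1/k) from
  -- above, and there the cleared inequality is `degree-bound`.
  upper : (k n : ℕ) → 2 ≤ k → 1 ≤ n → (G : Graph n) → Free k G → UpperBound k n (edges G)
  upper (suc k′) n (s≤s 0<k′) _ G free p₀ q₀ p q _ n≤ = ℚ.≤-trans
    (Cleared.upper-cleared k′ n e p q (begin
      e * (2 * k * P * Q) ≡⟨ e₁ e k P Q ⟩
      k * (e + e) * P * Q ≤⟨ *-monoˡ-≤ Q (*-monoˡ-≤ P (*-monoʳ-≤ k (2*edges≤∑deg G))) ⟩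
      k * ∑ (Walks.deg G) * P * Q ≤⟨ Descent.degree-bound k′ P Q 0<k′ (s≤s z≤n) n G free (posQ-^-≥ p q k n n≤) ⟩
      n * (k * P * P + k′ * P * Q + 2 * k * Q * Q) ≡⟨ e₂ n k k′ P Q ⟩
      n * k * P * P + k′ * n * P * Q + 2 * k * n * Q * Q ∎))
    (ℚ.p≤q⊔p (upperAt k n p₀ q₀) (upperAt k n p q))
    where
    open ≤-Reasoning
    k P Q e : ℕ
    k = suc k′
    P = suc p
    Q = suc q
    e = edges G
    e₁ : ∀ e k P Q → e * (2 * k * P * Q) ≡ k * (e + e) * P * Q
    e₁ = solve-∀
    e₂ : ∀ n k k′ P Q → n * (k * P * P + k′ * P * Q + 2 * k * Q * Q) ≡ n * k * P * P + k′ * n * P * Q + 2 * k * n * Q * Q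
    e₂ = solve-∀

open import Defs
open import Data.Nat using (ℕ; _≤_; _≥_)
open import Data.Product using (Σ; _×_; ∃; _,_)
open import Data.Sum using (_⊎_)
open import Relation.Binary.PropositionalEquality using (_≡_)

theorem5p7 : ((k n : ℕ) → 2 ≤ k → 1 ≤ n → (G : Graph n) → Free k G → UpperBound k n (edges G))
    × ((k : ℕ) → (k ≡ 2 ⊎ k ≡ 3 ⊎ k ≡ 5) → (N : ℕ) →
    Σ ℕ λ n → N ≤ n × Σ (Graph n) λ G → Free k G × LowerBound k n (edges G))
theorem5p7 = UpperBounds.upper , LowerBounds.lower
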